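{- Let $q\ge3$ be an integer. Assume DRH(A) for $L(s,\chi)$ and $L(\frac12,\chi)\neq0$ for the nontrivial Dirichlet characters $\chi$ modulo $q$. If $m(\sigma_a)=0$ for any $a\in(\mathbb Z/q\mathbb Z)^\times$, then there exists a Chebyshev bias against primes which are quadratic residues modulo $q$.
   Context: Let $G=\mathrm{Gal}(\mathbb Q(\zeta_q)/\mathbb Q)\cong(\mathbb Z/q\mathbb Z)^\times$, with $a\in(\mathbb Z/q\mathbb Z)^\times$ corresponding to the Artin symbol $\sigma_a=\left(\frac{\mathbb Q(\zeta_q)/\mathbb Q}{(a)}\right)$; characters of $G$ are identified with Dirichlet characters modulo $q$. For a nontrivial Dirichlet character $\chi$ modulo $q$, $m_\chi=\mathrm{ord}_{s=1/2}L(s,\chi)$, and $m(\sigma_a)=\sum_{\chi\ne\mathbf 1}\chi(a)m_\chi$, the sum running over nontrivial Dirichlet characters modulo $q$. DRH(A) for $L(s,\chi)$ (the Deep Riemann Hypothesis (A)) is the statement that the limit $$\lim_{x\to\infty}\left((\log x)^{m_\chi}\prod_{p\le x:\,\text{prime}}\left(1-\chi(p)p^{ -1/2}\right)^{ -1}\right)$$ exists and is nonzero. A quadratic residue modulo $q$ is an element of $((\mathbb Z/q\mathbb Z)^\times)^2$. Chebyshev bias (over $\mathbb Q$): suppose the set of all primes $p\le x$ is a disjoint union $P_1(x)\cup P_2(x)$ and the limit $\delta=\lim_{x\to\infty}|P_1(x)|/|P_2(x)|$ exists. There exists a Chebyshev bias toward $P_1$, or equivalently against $P_2$, if for some $C>0$,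 $$\sum_{p\in P_1(x)}\frac1{\sqrt p}-\delta\sum_{p\in P_2(x)}\frac1{\sqrt p}\sim C\log\log x\qquad(x\to\infty),$$ where $f\sim g$ means $f(x)/g(x)\to1$. Here $P_2$ consists of the primes which are quadratic residues modulo $q$ and $P_1$ of the remaining primes. -}

module Defs where

open import Level using (0ℓ)
open import Algebra.Bundles using (CommutativeRing; RawRing)
import Algebra.Definitions.RawSemiring as RawSemiringDefs
open import Axiom.ExcludedMiddle using (ExcludedMiddle)
open import Data.List.Base using (List; []; map; foldr; filter; length; upTo)
open import Data.List.Relation.Unary.Enumerates.Setoid using (IsEnumeration)
open import Data.List.Relation.Unary.Unique.Setoid using (Unique)
open import Data.Nat.Base as ℕ using (ℕ; ∣_-_∣; _!)
open import Data.Nat.Coprimality using (Coprime)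
open import Data.Nat.Divisibility using (_∣_)
open import Data.Nat.Primality using (Prime; prime?)
open import Data.Product.Base using (Σ; ∃; ∃-syntax; _×_; _,_; proj₁)
open import Data.Sum.Base using (_⊎_)
open import Relation.Binary.Bundles using (Setoid)
open import Relation.Binary.Core using (Rel)
open import Relation.Binary.Structures using (IsStrictTotalOrder)
import Relation.Binary.Construct.StrictToNonStrict as NonStrict
open import Relation.Nullary using (yes; no; ¬_)

-- The usual axioms for the real numbers: an ordered field in which every
-- inhabited subset that is bounded above has a least upper bound.  These
-- determine the structure up to a unique isomorphism.  Equality is a setoid
-- equality, so that no quotient types are needed.
record CompleteOrderedField : Set₁ where
  infix 4 _<_
  field
    commutativeRing : CommutativeRing 0ℓ 0ℓ

  open CommutativeRing commutativeRing public

  field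
    _<_                : Rel Carrier 0ℓ
    isStrictTotalOrder : IsStrictTotalOrder _≈_ _<_

  open NonStrict _≈_ _<_ public using (_≤_)

  UpperBound : (Carrier → Set) → Carrier → Set
  UpperBound P u = ∀ x → P x → x ≤ u

  field
    1≉0      : ¬ (1# ≈ 0#)
    inverse  : ∀ x → ¬ (x ≈ 0#) → ∃[ y ] x * y ≈ 1#
    +-mono-< : ∀ x y z → x < y → x + z < y + z
    *-pos    : ∀ x y → 0# < x → 0# < y → 0# < x * y
    supremum : ∀ (P : Carrier → Set) → ∃ P → ∃ (UpperBound P) →
               ∃[ s ] UpperBound P s × (∀ u → UpperBound P u → s ≤ u)

-- Excluded middle is a parameter because the mathematics is classical.  It
-- is used below to define objects as total functions from their
-- characterizing properties.
module Analysis (em : ExcludedMiddle 0ℓ) (R : CompleteOrderedField) where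

  open CompleteOrderedField R renaming (Carrier to ℝ)
  open RawSemiringDefs (RawRing.rawSemiring (CommutativeRing.rawRing commutativeRing))
    using (_^_) renaming (_×_ to _·_)

  -- Some element satisfying P if there is one, and the default d otherwise.
  choose : {A : Set} (P : A → Set) (d : A) → A
  choose P d with em {∃ P}
  ... | yes (a , _) = a
  ... | no  _       = d

  ι : ℕ → ℝ
  ι n = n · 1#

  -- As usual for total division, 0⁻¹ = 0.
  infix 9 _⁻¹
  _⁻¹ : ℝ → ℝ
  x ⁻¹ = choose (λ y → x * y ≈ 1#) 0#

  infixl 7 _/_
  _/_ : ℝ → ℝ → ℝ
  x / y = x * y ⁻¹

  √ : ℝ → ℝ
  √ x = choose (λ y → 0# ≤ y × y * y ≈ x) 0#

  ∣_∣ℝ : ℝ → ℝ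
  ∣ x ∣ℝ with IsStrictTotalOrder._<?_ isStrictTotalOrder x 0#
  ... | yes _ = - x
  ... | no  _ = x

  ⌊_⌋ : ℝ → ℕ
  ⌊ x ⌋ = choose (λ n → ι n ≤ x × x < ι (ℕ.suc n)) 0

  record ℂ : Set where
    constructor mkℂ
    field
      re im : ℝ
  open ℂ public

  ℂ-rawRing : RawRing 0ℓ 0ℓ
  ℂ-rawRing = record
    { Carrier = ℂ
    ; _≈_     = λ z w → re z ≈ re w × im z ≈ im w
    ; _+_     = λ z w → mkℂ (re z + re w) (im z + im w)
    ; _*_     = λ z w → mkℂ (re z * re w - im z * im w) (re z * im w + im z * re w)
    ; -_      = λ z → mkℂ (- re z) (- im z)
    ; 0#      = mkℂ 0# 0#
    ; 1#      = mkℂ 1# 0#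
    }

  open RawRing ℂ-rawRing public using () renaming
    ( _≈_ to _≈ᶜ_; _+_ to _+ᶜ_; _*_ to _*ᶜ_; -_ to -ᶜ_; 0# to 0ᶜ; 1# to 1ᶜ )
  open RawSemiringDefs (RawRing.rawSemiring ℂ-rawRing) public using ()
    renaming (_^_ to _^ᶜ_)

  infixl 6 _-ᶜ_
  _-ᶜ_ : ℂ → ℂ → ℂ
  z -ᶜ w = z +ᶜ (-ᶜ w)

  ofℝ : ℝ → ℂ
  ofℝ x = mkℂ x 0#

  normSq : ℂ → ℝ
  normSq z = re z * re z + im z * im z

  ∣_∣ᶜ : ℂ → ℝ
  ∣ z ∣ᶜ = √ (normSq z)

  infix 9 _⁻¹ᶜ
  _⁻¹ᶜ : ℂ → ℂ
  z ⁻¹ᶜ = mkℂ (re z / normSq z) (- im z / normSq z)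

  ½ : ℂ
  ½ = ofℝ (ι 2 ⁻¹)

  ∑ : {A : Set} → List A → (A → ℝ) → ℝ
  ∑ xs f = foldr _+_ 0# (map f xs)

  ∑ᶜ ∏ᶜ : {A : Set} → List A → (A → ℂ) → ℂ
  ∑ᶜ xs f = foldr _+ᶜ_ 0ᶜ (map f xs)
  ∏ᶜ xs f = foldr _*ᶜ_ 1ᶜ (map f xs)

  infix 4 _⟶_ _⟶∞_ _⟶∞ᶜ_ _∼_

  _⟶_ : (ℕ → ℂ) → ℂ → Set
  u ⟶ l = ∀ ε → 0# < ε → ∃[ N ] ∀ n → N ℕ.≤ n → ∣ u n -ᶜ l ∣ᶜ < ε

  -- Limits as the real variable tends to +∞.
  _⟶∞_ : (ℝ → ℝ) → ℝ → Set
  f ⟶∞ l = ∀ ε → 0# < ε → ∃[ X ] ∀ x → X < x → ∣ f x - l ∣ℝ < ε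

  _⟶∞ᶜ_ : (ℝ → ℂ) → ℂ → Set
  f ⟶∞ᶜ l = ∀ ε → 0# < ε → ∃[ X ] ∀ x → X < x → ∣ f x -ᶜ l ∣ᶜ < ε

  _∼_ : (ℝ → ℝ) → (ℝ → ℝ) → Set
  f ∼ g = (λ x → f x / g x) ⟶∞ 1#

  exp : ℂ → ℂ
  exp z = choose (λ w → (λ N → ∑ᶜ (upTo N) (λ n → z ^ᶜ n *ᶜ ofℝ (ι (n !) ⁻¹))) ⟶ w) 0ᶜ

  log : ℝ → ℝ
  log x = choose (λ y → exp (ofℝ y) ≈ᶜ ofℝ x) 0#

  -- n⁻ˢ for n ≥ 1.
  _^-_ : ℕ → ℂ → ℂ
  n ^- s = exp (-ᶜ (s *ᶜ ofℝ (log (ι n))))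

  HasDerivative : (ℂ → ℂ) → ℂ → ℂ → Set
  HasDerivative f d z =
    ∀ ε → 0# < ε → ∃[ η ] 0# < η × (∀ w → ∣ w -ᶜ z ∣ᶜ < η →
      ∣ (f w -ᶜ f z) -ᶜ d *ᶜ (w -ᶜ z) ∣ᶜ ≤ ε * ∣ w -ᶜ z ∣ᶜ)

  Differentiable : (ℂ → ℂ) → ℂ → Set
  Differentiable f z = ∃[ d ] HasDerivative f d z

  Entire : (ℂ → ℂ) → Set
  Entire f = ∀ z → Differentiable f z

  -- Near s₀, f s = (s - s₀)ᵐ g s with g holomorphic and g s₀ ≠ 0.
  IsOrder : (ℂ → ℂ) → ℂ → ℕ → Set
  IsOrder f s₀ m = ∃[ g ] ∃[ r ] 0# < r × ¬ (g s₀ ≈ᶜ 0ᶜ) ×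
    (∀ s → ∣ s -ᶜ s₀ ∣ᶜ < r →
      Differentiable g s × f s ≈ᶜ (s -ᶜ s₀) ^ᶜ m *ᶜ g s)

  -- The order is a natural number because this is only applied to entire
  -- functions.
  ord : (ℂ → ℂ) → ℂ → ℕ
  ord f s₀ = choose (IsOrder f s₀) 0

  -- A homomorphism (ℤ/q)ˣ → ℂˣ, viewed as a q-periodic function on ℕ
  -- extended by zero.
  record DirichletCharacter (q : ℕ) : Set where
    field
      eval           : ℕ → ℂ
      periodic       : ∀ n → eval (n ℕ.+ q) ≈ᶜ eval n
      multiplicative : ∀ m n → eval (m ℕ.* n) ≈ᶜ eval m *ᶜ eval n
      one            : eval 1 ≈ᶜ 1ᶜ
      vanishing      : ∀ n → ¬ Coprime n q → eval n ≈ᶜ 0ᶜ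
  open DirichletCharacter public using (eval)

  Nontrivial : ∀ {q} → DirichletCharacter q → Set
  Nontrivial {q} χ = ¬ (∀ n → Coprime n q → eval χ n ≈ᶜ 1ᶜ)

  -- The entire function continuing the Dirichlet series from Re s > 1; it
  -- exists and is unique for nontrivial χ.
  IsLFunction : ∀ {q} → DirichletCharacter q → (ℂ → ℂ) → Set
  IsLFunction χ f = Entire f ×
    (∀ s → 1# < re s →
      (λ N → ∑ᶜ (upTo N) (λ k → eval χ (ℕ.suc k) *ᶜ (ℕ.suc k ^- s))) ⟶ f s)

  L : ∀ {q} → DirichletCharacter q → ℂ → ℂ
  L χ = choose (IsLFunction χ) (λ _ → 0ᶜ)

  m[_] : ∀ {q} → DirichletCharacter q → ℕ
  m[ χ ] = ord (L χ) ½

  nontrivialCharacters : ℕ → Setoid 0ℓ 0ℓ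
  nontrivialCharacters q = record
    { Carrier       = Σ (DirichletCharacter q) Nontrivial
    ; _≈_           = λ χ ψ → ∀ n → eval (proj₁ χ) n ≈ᶜ eval (proj₁ ψ) n
    ; isEquivalence = record
      { refl  = λ _ → refl , refl
      ; sym   = λ e n → let (a , b) = e n in sym a , sym b
      ; trans = λ e f n → let (a , b) = e n ; (c , d) = f n in trans a c , trans b d
      }
    }

  -- The sum over a setoid with finitely many elements, each taken once.
  ∑-finite : (S : Setoid 0ℓ 0ℓ) → (Setoid.Carrier S → ℂ) → ℂ
  ∑-finite S = ∑ᶜ (choose (λ xs → IsEnumeration S xs × Unique S xs) [])

  -- m(σₐ), where the unit class of a is given by any representative a ∈ ℕ.
  mσ : ℕ → ℕ → ℂ
  mσ q a = ∑-finite (nontrivialCharacters q)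
    (λ (χ , _) → eval χ a *ᶜ ofℝ (ι m[ χ ]))

  primes≤ : ℝ → List ℕ
  primes≤ x = filter prime? (upTo (ℕ.suc ⌊ x ⌋))

  primes≤_satisfying : ℝ → (ℕ → Set) → List ℕ
  primes≤ x satisfying P = filter (λ p → em {P p}) (primes≤ x)

  DRH-A : ∀ {q} → DirichletCharacter q → Set
  DRH-A χ = ∃[ l ] ¬ (l ≈ᶜ 0ᶜ) ×
    ((λ x → ofℝ (log x ^ m[ χ ]) *ᶜ
            ∏ᶜ (primes≤ x) (λ p → (1ᶜ -ᶜ eval χ p *ᶜ ofℝ (√ (ι p) ⁻¹)) ⁻¹ᶜ))
      ⟶∞ᶜ l)

  QuadraticResidue : ℕ → ℕ → Set
  QuadraticResidue q a =
    Coprime a q × ∃[ b ] Coprime b q × q ∣ ∣ b ℕ.* b - a ∣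

  count invSqrtSum : (ℕ → Set) → ℝ → ℝ
  count      P x = ι (length (primes≤ x satisfying P))
  invSqrtSum P x = ∑ (primes≤ x satisfying P) (λ p → √ (ι p) ⁻¹)

  -- A Chebyshev bias toward the primes in P₁, against those in P₂.
  record ChebyshevBias (P₁ P₂ : ℕ → Set) : Set where
    field
      partition  : ∀ p → Prime p → (P₁ p ⊎ P₂ p) × ¬ (P₁ p × P₂ p)
      δ          : ℝ
      ratio      : (λ x → count P₁ x / count P₂ x) ⟶∞ δ
      C          : ℝ
      C>0        : 0# < C
      asymptotic : (λ x → invSqrtSum P₁ x - δ * invSqrtSum P₂ x)
                   ∼ (λ x → C * log (log x))

  -- Here P₁ consists of all primes not in P₂.
  ChebyshevBiasAgainst : (ℕ → Set) → Set
  ChebyshevBiasAgainst P = ChebyshevBias (λ p → ¬ P p) P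

{-# OPTIONS --safe #-}
-- Since L(1/2, χ) ≠ 0, every m_χ is 0, and DRH(A) says that the Euler product
-- of χ over p ≤ x at s = 1/2 tends to a nonzero limit.  For a nontrivial real
-- character χ its logarithm is Σ χ(p)/√p + Σ χ(p)²/(2p) + O(1), whence
--
--   Σ χ(p)/√p = -1/2 Σ 1/p + O(1) = -1/2 log log x + O(1)
--
-- by Mertens' theorem.  Let there be δ nontrivial real characters.  They sum to
-- δ on the squares of (ℤ/q)ˣ and to -1 on the other units, so that
-- Σ 1/√p over nonresidues minus δ Σ 1/√p over residues is, up to O(1), minus
-- the sum of all Σ χ(p)/√p, that is (δ/2) log log x; and δ ≥ 1 as q ≥ 3.
-- Partial summation gives Σ χ(p) = O(√x log x), which is o(π(x)) by Chebyshev's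
-- bound, so that δ is also the limit of the ratio of the counts.
--
-- The real characters used are the products of a family that separates the
-- nonsquares from the squares.  The results on primes are derived from
-- log N! = Σ v_p(N!) log p, and exp, log and √ from the least upper bound axiom.

module Submission where

open import Defs
open import Level using (0ℓ)
open import Algebra.Bundles using (CommutativeRing; RawRing)
import Algebra.Definitions.RawSemiring as RawSemiringDefs
import Algebra.Properties.Ring
import Algebra.Properties.Semiring.Mult
import Algebra.Solver.Ring
open import Algebra.Solver.Ring.AlmostCommutativeRing
  using (_-Raw-AlmostCommutative⟶_; fromCommutativeRing)
open import Axiom.ExcludedMiddle using (ExcludedMiddle)
open import Data.Bool.Base using (Bool; true; false; _xor_)
open import Data.Empty using (⊥; ⊥-elim)
open import Data.Fin.Base using (toℕ; fromℕ<; punchOut)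
import Data.Fin.Properties as Fin
open import Data.Integer.Base as ℤ using (ℤ; +_; -[1+_])
import Data.Integer.Properties as ℤ
open import Data.List.Base as List using (List; []; _∷_; _++_; map; filter; length; upTo)
import Data.List.Properties as List
open import Data.List.Membership.Propositional using (_∈_)
open import Data.List.Relation.Unary.All as All using (All; []; _∷_)
import Data.List.Relation.Unary.All.Properties as All
open import Data.List.Relation.Unary.Any using (here; there)
open import Data.Maybe.Base using (Maybe; just; nothing)
open import Data.Nat.Base as ℕ using (ℕ; zero; suc; z≤n; s≤s; _!; ∣_-_∣)
open import Data.Nat.Coprimality as Coprimality
  using (Coprime; coprime?; coprime-divisor; coprime-Bézout; prime⇒coprime)
open import Data.Nat.Divisibility as ℕ using (_∣_; divides; _∣?_)
import Data.Nat.DivMod as ℕ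
open import Data.Nat.GCD using (module Bézout)
open import Data.Nat.Induction using (<-rec)
open import Data.Nat.ListAction using (product)
open import Data.Nat.Primality
  using (Prime; prime?; euclidsLemma; prime⇒nonTrivial; prime⇒irreducible; ¬prime[0]; ¬prime[1])
open import Data.Nat.Primality.Factorisation using (factorise)
import Data.Nat.Properties as ℕ
open import Data.Nat.Tactic.RingSolver using (solve-∀)
open import Data.Product.Base using (Σ; ∃; ∃-syntax; _×_; _,_; proj₁; proj₂)
import Data.Sign.Base as Sign
open import Data.Sum.Base using (_⊎_; inj₁; inj₂; [_,_]′)
open import Function.Base using (_∘_; id)
open import Relation.Binary.Bundles using (StrictPartialOrder)
open import Relation.Binary.Definitions using (tri<; tri≈; tri>)
open import Relation.Binary.PropositionalEquality as ≡ using (_≡_; _≢_)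
open import Relation.Binary.Structures using (IsStrictTotalOrder)
import Relation.Binary.Construct.StrictToNonStrict as NonStrict
import Relation.Binary.Reasoning.StrictPartialOrder as OrderReasoning
open import Relation.Nullary using (¬_; Dec; yes; no)

-- The two character sums behind δ come from one identity. If χ₁, ..., χᵣ separate the nonsquares
-- from the squares, then (1 + χ₁)⋯(1 + χᵣ) is 2^r on the squares and 0 on the other units.
-- Expanded, it is 1 plus the sum of the products over nonempty subfamilies, so these 2^r - 1
-- products sum to δ = 2^r - 1 or to -1. DRH(A) and nonvanishing are assumed for nontrivial
-- characters, so every one of these products has to be nontrivial; this governs how the family is
-- built. Real characters keep the Euler products on the positive real axis, so their logarithms are
-- real ones. The expansion of -log (1 - t) is uniform only for bounded t such as |t| ≤ 1/2, that
-- is, from n = 4 on for t = χ(n)/√n; smaller primes go into the O(1). Inverses, roots, exp, log and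
-- floors are picked by `choose`, so each must be shown to exist before its defining property can be
-- used. The lower bound for π(N) comes from Mertens' first theorem, by comparing its sum at N and
-- at N/K for a large fixed K.

-- Ring identities with integer coefficients.

module IntegerSolver (CR : CommutativeRing 0ℓ 0ℓ) where
  open CommutativeRing CR
  open Algebra.Properties.Semiring.Mult semiring using (×-homo-+; ×1-homo-*) renaming (_×_ to _·_)
  open Algebra.Properties.Ring ring using (-‿distribˡ-*; -‿distribʳ-*; -0#≈0#; -‿involutive;
    -‿anti-homo-+)
  open import Relation.Binary.Reasoning.Setoid setoid

  -- The image of 1 is 1# itself and not 1# + 0#, so that the constant 1#
  -- can be reified.
  fromℕ : ℕ → Carrier
  fromℕ 1 = 1#
  fromℕ n = n · 1#

  fromℕ≈·1 : ∀ n → fromℕ n ≈ n · 1#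
  fromℕ≈·1 zero          = refl
  fromℕ≈·1 (suc zero)    = sym (+-identityʳ 1#)
  fromℕ≈·1 (suc (suc n)) = refl

  fromℤ : ℤ → Carrier
  fromℤ (+ n)    = fromℕ n
  fromℤ -[1+ n ] = - fromℕ (suc n)

  fromℕ-+ : ∀ m n → fromℕ (m ℕ.+ n) ≈ fromℕ m + fromℕ n
  fromℕ-+ m n = begin
    fromℕ (m ℕ.+ n)    ≈⟨ fromℕ≈·1 (m ℕ.+ n) ⟩
    (m ℕ.+ n) · 1#     ≈⟨ ×-homo-+ 1# m n ⟩
    m · 1# + n · 1#    ≈⟨ +-cong (fromℕ≈·1 m) (fromℕ≈·1 n) ⟨
    fromℕ m + fromℕ n  ∎

  fromℕ-* : ∀ m n → fromℕ (m ℕ.* n) ≈ fromℕ m * fromℕ n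
  fromℕ-* m n = begin
    fromℕ (m ℕ.* n)    ≈⟨ fromℕ≈·1 (m ℕ.* n) ⟩
    (m ℕ.* n) · 1#     ≈⟨ ×1-homo-* m n ⟩
    m · 1# * n · 1#    ≈⟨ *-cong (fromℕ≈·1 m) (fromℕ≈·1 n) ⟨
    fromℕ m * fromℕ n  ∎

  fromℤ-neg : ∀ i → fromℤ (ℤ.- i) ≈ - fromℤ i
  fromℤ-neg (+ zero)    = sym -0#≈0#
  fromℤ-neg (+ (suc n)) = refl
  fromℤ-neg -[1+ n ]    = sym (-‿involutive _)

  fromℤ-⊖ : ∀ m n → fromℤ (m ℤ.⊖ n) ≈ fromℕ m - fromℕ n
  fromℤ-⊖ m zero = begin
    fromℕ m       ≈⟨ +-identityʳ _ ⟨
    fromℕ m + 0#  ≈⟨ +-congˡ -0#≈0# ⟨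
    fromℕ m - 0#  ∎
  fromℤ-⊖ zero (suc n) = sym (+-identityˡ _)
  fromℤ-⊖ (suc m) (suc n) = begin
    fromℤ (suc m ℤ.⊖ suc n)             ≡⟨ ≡.cong fromℤ (ℤ.[1+m]⊖[1+n]≡m⊖n m n) ⟩
    fromℤ (m ℤ.⊖ n)                     ≈⟨ fromℤ-⊖ m n ⟩
    a - b                               ≈⟨ +-congˡ (+-identityˡ _) ⟨
    a + (0# - b)                        ≈⟨ +-congˡ (+-congʳ (-‿inverseʳ 1#)) ⟨
    a + ((1# - 1#) - b)                 ≈⟨ +-congˡ (+-assoc _ _ _) ⟩
    a + (1# + (- 1# - b))               ≈⟨ +-assoc _ _ _ ⟨
    (a + 1#) + (- 1# - b) ≈⟨ +-cong (+-comm _ _) (trans (+-comm _ _) (sym (-‿anti-homo-+ _ _))) ⟩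
    (1# + a) - (1# + b)                 ≈⟨ +-cong (fromℕ-+ 1 m) (-‿cong (fromℕ-+ 1 n)) ⟨
    fromℕ (suc m) - fromℕ (suc n)       ∎
    where
    a = fromℕ m
    b = fromℕ n

  fromℤ-+ : ∀ i j → fromℤ (i ℤ.+ j) ≈ fromℤ i + fromℤ j
  fromℤ-+ (+ m)    (+ n)    = fromℕ-+ m n
  fromℤ-+ (+ m)    -[1+ n ] = fromℤ-⊖ m (suc n)
  fromℤ-+ -[1+ m ] (+ n)    = trans (fromℤ-⊖ n (suc m)) (+-comm _ _)
  fromℤ-+ -[1+ m ] -[1+ n ] = begin
    - fromℕ (suc (suc (m ℕ.+ n)))       ≡⟨ ≡.cong (λ k → - fromℕ (suc k)) (ℕ.+-suc m n) ⟨
    - fromℕ (suc m ℕ.+ suc n)           ≈⟨ -‿cong (fromℕ-+ (suc m) (suc n)) ⟩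
    - (fromℕ (suc m) + fromℕ (suc n))   ≈⟨ trans (-‿anti-homo-+ _ _) (+-comm _ _) ⟩
    - fromℕ (suc m) - fromℕ (suc n)     ∎

  fromℤ-◃- : ∀ n → fromℤ (Sign.- ℤ.◃ n) ≈ - fromℕ n
  fromℤ-◃- zero    = sym -0#≈0#
  fromℤ-◃- (suc n) = refl

  fromℤ-◃+ : ∀ n → fromℤ (Sign.+ ℤ.◃ n) ≈ fromℕ n
  fromℤ-◃+ zero    = refl
  fromℤ-◃+ (suc n) = refl

  fromℤ-* : ∀ i j → fromℤ (i ℤ.* j) ≈ fromℤ i * fromℤ j
  fromℤ-* (+ m)    (+ n)    = trans (fromℤ-◃+ (m ℕ.* n)) (fromℕ-* m n)
  fromℤ-* (+ m)    -[1+ n ] = trans (fromℤ-◃- (m ℕ.* suc n))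
    (trans (-‿cong (fromℕ-* m (suc n))) (-‿distribʳ-* _ _))
  fromℤ-* -[1+ m ] (+ n)    = trans (fromℤ-◃- (suc m ℕ.* n))
    (trans (-‿cong (fromℕ-* (suc m) n)) (-‿distribˡ-* _ _))
  fromℤ-* -[1+ m ] -[1+ n ] = begin
    fromℕ (suc m ℕ.* suc n)               ≈⟨ fromℕ-* (suc m) (suc n) ⟩
    fromℕ (suc m) * fromℕ (suc n)         ≈⟨ -‿involutive _ ⟨
    - - (fromℕ (suc m) * fromℕ (suc n))   ≈⟨ -‿cong (-‿distribʳ-* _ _) ⟩
    - (fromℕ (suc m) * - fromℕ (suc n))   ≈⟨ -‿distribˡ-* _ _ ⟩
    - fromℕ (suc m) * - fromℕ (suc n)     ∎

  homomorphism : ℤ.+-*-rawRing -Raw-AlmostCommutative⟶ fromCommutativeRing CR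
  homomorphism = record
    { ⟦_⟧    = fromℤ
    ; +-homo = fromℤ-+
    ; *-homo = fromℤ-*
    ; -‿homo = fromℤ-neg
    ; 0-homo = refl
    ; 1-homo = refl
    }

  fromℤ-≟ : ∀ i j → Maybe (fromℤ i ≈ fromℤ j)
  fromℤ-≟ i j with i ℤ.≟ j
  ... | yes ≡.refl = just refl
  ... | no  _      = nothing

  open Algebra.Solver.Ring ℤ.+-*-rawRing (fromCommutativeRing CR) homomorphism fromℤ-≟ public

  κ : ∀ {n} → ℕ → Polynomial n
  κ k = con (+ k)

-- Multiplicities of primes in integers and in factorials.

module Valuation where

  prime⇒≥2 : ∀ {p} → Prime p → 2 ℕ.≤ p
  prime⇒≥2 {p} pr = ℕ.nonTrivial⇒n>1 p {{prime⇒nonTrivial pr}}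

  IsMultiplicity : ℕ → ℕ → ℕ → Set
  IsMultiplicity p n k = ∃[ m ] n ≡ p ℕ.^ k ℕ.* m × ¬ (p ∣ m)

  multiplicity-exists : ∀ {p} → 2 ℕ.≤ p → ∀ n → 1 ℕ.≤ n → ∃ (IsMultiplicity p n)
  multiplicity-exists {p} 2≤p = <-rec _ step
    where
    step : ∀ n → (∀ {m} → m ℕ.< n → 1 ℕ.≤ m → ∃ (IsMultiplicity p m)) → 1 ℕ.≤ n → ∃ (IsMultiplicity
      p n)
    step n rec 1≤n with p ∣? n
    ... | no  p∤n                     = 0 , n , ≡.sym (ℕ.*-identityˡ n) , p∤n
    ... | yes (divides zero ≡.refl)   = ⊥-elim (ℕ.<⇒≢ 1≤n ≡.refl)
    ... | yes (divides (suc k) ≡.refl)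
      with j , m , 1+k≡p^j*m , p∤m ← rec (ℕ.m<m*n (suc k) p 2≤p) (s≤s z≤n) =
      suc j , m , ≡.trans (ℕ.*-comm (suc k) p) (≡.trans (≡.cong (p ℕ.*_) 1+k≡p^j*m) (≡.sym
        (ℕ.*-assoc p _ m))) , p∤m

  multiplicity-unique : ∀ {p n} j k → 1 ℕ.≤ p → IsMultiplicity p n j → IsMultiplicity p n k → j ≡ k
  multiplicity-unique zero zero _ _ _ = ≡.refl
  multiplicity-unique {p} zero (suc k) _ (m , e , p∤m) (l , f , _) =
    ⊥-elim (p∤m (divides (p ℕ.^ k ℕ.* l) (≡.trans (≡.trans (≡.sym (≡.trans e (ℕ.*-identityˡ m))) f)
      (≡.trans (ℕ.*-assoc p _ l) (ℕ.*-comm p _)))))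
  multiplicity-unique (suc j) zero 1≤p h k = ≡.sym (multiplicity-unique zero (suc j) 1≤p k h)
  multiplicity-unique {suc p} (suc j) (suc k) 1≤p (m , e , p∤m) (l , f , p∤l) =
    ≡.cong suc (multiplicity-unique j k 1≤p (m , ≡.refl , p∤m)
      (l , ℕ.*-cancelˡ-≡ _ _ (suc p) (≡.trans (≡.sym (ℕ.*-assoc (suc p) (suc p ℕ.^ j) m))
        (≡.trans (≡.sym e) (≡.trans f (ℕ.*-assoc (suc p) (suc p ℕ.^ k) l)))) , p∤l))

  multiplicity : ℕ → ℕ → ℕ
  multiplicity (suc (suc p)) (suc n) = proj₁ (multiplicity-exists {suc (suc p)} (s≤s (s≤s z≤n)) (suc
    n) (s≤s z≤n))
  multiplicity _             _       = 0

  multiplicity-≡ : ∀ {p n} k → Prime p → 1 ℕ.≤ n → IsMultiplicity p n k → multiplicity p n ≡ k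
  multiplicity-≡ {p} {suc n} k pr _ h with p | prime⇒≥2 pr
  ... | suc (suc q) | s≤s (s≤s _) = multiplicity-unique _ k (s≤s z≤n)
    (proj₂ (multiplicity-exists {suc (suc q)} (s≤s (s≤s z≤n)) (suc n) (s≤s z≤n))) h

  multiplicity-spec : ∀ {p n} → Prime p → 1 ℕ.≤ n → IsMultiplicity p n (multiplicity p n)
  multiplicity-spec {p} {suc n} pr _ with p | prime⇒≥2 pr
  ... | suc (suc q) | s≤s (s≤s _) = proj₂ (multiplicity-exists {suc (suc q)} (s≤s (s≤s z≤n)) (suc n)
    (s≤s z≤n))

  multiplicity-∤ : ∀ {p n} → Prime p → 1 ℕ.≤ n → ¬ (p ∣ n) → multiplicity p n ≡ 0
  multiplicity-∤ {n = n} pr 1≤n p∤n = multiplicity-≡ 0 pr 1≤n (n , ≡.sym (ℕ.*-identityˡ n) , p∤n)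

  multiplicity-p* : ∀ {p n} → Prime p → 1 ℕ.≤ n → multiplicity p (p ℕ.* n) ≡ suc (multiplicity p n)
  multiplicity-p* {p} {n} pr 1≤n with m , e , p∤m ← multiplicity-spec pr 1≤n =
    multiplicity-≡ _ pr (ℕ.*-mono-≤ (ℕ.<⇒≤ (prime⇒≥2 pr)) 1≤n)
      (m , ≡.trans (≡.cong (p ℕ.*_) e) (≡.sym (ℕ.*-assoc p _ m)) , p∤m)

  primes-∣ : ∀ {p q} → Prime p → Prime q → p ∣ q → p ≡ q
  primes-∣ pr qr p∣q with prime⇒irreducible qr p∣q
  ... | inj₁ ≡.refl = ⊥-elim (¬prime[1] pr)
  ... | inj₂ p≡q    = p≡q

  multiplicity-q* : ∀ {p q n} → Prime p → Prime q → ¬ (p ≡ q) → 1 ℕ.≤ n → multiplicity p (q ℕ.* n) ≡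
    multiplicity p n
  multiplicity-q* {p} {q} {n} pr qr p≢q 1≤n with m , e , p∤m ← multiplicity-spec pr 1≤n =
    multiplicity-≡ _ pr (ℕ.*-mono-≤ (ℕ.<⇒≤ (prime⇒≥2 qr)) 1≤n)
      (q ℕ.* m , ≡.trans (≡.cong (q ℕ.*_) e) (≡.trans (≡.sym (ℕ.*-assoc q (p ℕ.^ multiplicity p n)
        m))
        (≡.trans (≡.cong (ℕ._* m) (ℕ.*-comm q (p ℕ.^ multiplicity p n))) (ℕ.*-assoc (p ℕ.^
          multiplicity p n) q m))) ,
       λ p∣qm → [ (λ p∣q → p≢q (primes-∣ pr qr p∣q)) , p∤m ]′ (euclidsLemma q m pr p∣qm))

  prime-divisor : ∀ n → 2 ℕ.≤ n → ∃[ p ] ∃[ m ] Prime p × 1 ℕ.≤ m × m ℕ.< n × n ≡ p ℕ.* m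
  prime-divisor n@(suc _) 2≤n with factorise n
  ... | record { factors = List.[] ; isFactorisation = e } = ⊥-elim (ℕ.<⇒≢ 2≤n (≡.sym e))
  ... | record { factors = p List.∷ ps ; isFactorisation = e ; factorsPrime = pr ∷ _ } =
    p , m , pr , 1≤m , m<n , e
    where
    m = product ps
    1≤m : 1 ℕ.≤ m
    1≤m = ℕ.n≢0⇒n>0 λ m≡0 → ℕ.1+n≢0 (≡.trans e (≡.trans (≡.cong (p ℕ.*_) m≡0) (ℕ.*-zeroʳ p)))
    m<n : m ℕ.< n
    m<n = ≡.subst (m ℕ.<_) (≡.trans (ℕ.*-comm m p) (≡.sym e)) (ℕ.m<m*n m p (prime⇒≥2 pr))
      where instance _ = ℕ.>-nonZero 1≤m

  -- The multiplicity of p in N!.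
  legendre : ℕ → ℕ → ℕ
  legendre p zero    = 0
  legendre p (suc n) = legendre p n ℕ.+ multiplicity p (suc n)

  legendre-mono : ∀ p {m n} → m ℕ.≤ n → legendre p m ℕ.≤ legendre p n
  legendre-mono p {m} m≤n with k , ≡.refl ← ℕ.m≤n⇒∃[o]m+o≡n m≤n = go k
    where
    go : ∀ k → legendre p m ℕ.≤ legendre p (m ℕ.+ k)
    go zero    rewrite ℕ.+-identityʳ m = ℕ.≤-refl
    go (suc k) rewrite ℕ.+-suc m k     = ℕ.≤-trans (go k) (ℕ.m≤m+n _ _)

  -- The multiples of p among 1, ..., r + kp are p, 2p, ..., kp; they contribute one factor p each,
  -- and what remains of them is k!. This recursion takes the place of Legendre's sum of floors.
  legendre-step : ∀ {p} → Prime p → ∀ k r → r ℕ.< p → legendre p (r ℕ.+ k ℕ.* p) ≡ k ℕ.+ legendre p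
    k
  legendre-step pr zero zero _ = ≡.refl
  legendre-step {zero}   pr (suc k) zero _ = ⊥-elim (¬prime[0] pr)
  -- The predecessor of (k+1)p is (p-1) + kp, so the induction continues with the largest remainder.
  legendre-step {suc p′} pr (suc k) zero _ = begin
    legendre (suc p′) (p′ ℕ.+ k ℕ.* suc p′) ℕ.+ multiplicity (suc p′) (suc k ℕ.* suc p′)
      ≡⟨ ≡.cong₂ ℕ._+_ (legendre-step pr k p′ ℕ.≤-refl) (≡.cong (multiplicity (suc p′)) (ℕ.*-comm
        (suc k) (suc p′))) ⟩
    (k ℕ.+ legendre (suc p′) k) ℕ.+ multiplicity (suc p′) (suc p′ ℕ.* suc k)
      ≡⟨ ≡.cong ((k ℕ.+ legendre (suc p′) k) ℕ.+_) (multiplicity-p* pr (s≤s z≤n)) ⟩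
    (k ℕ.+ legendre (suc p′) k) ℕ.+ suc (multiplicity (suc p′) (suc k))
      ≡⟨ ℕ.+-suc _ _ ⟩
    suc ((k ℕ.+ legendre (suc p′) k) ℕ.+ multiplicity (suc p′) (suc k))
      ≡⟨ ≡.cong suc (ℕ.+-assoc k _ _) ⟩
    suc k ℕ.+ legendre (suc p′) (suc k) ∎
    where open ≡.≡-Reasoning
  legendre-step {p} pr k (suc r) r<p = ≡.trans (≡.cong (legendre p (r ℕ.+ k ℕ.* p) ℕ.+_)
    (multiplicity-∤ pr (s≤s z≤n) λ p∣ → ℕ.>⇒∤ r<p (ℕ.∣m+n∣m⇒∣n (≡.subst (p ∣_) (ℕ.+-comm (suc r) _)
      p∣) (ℕ.n∣m*n k))))
    (≡.trans (ℕ.+-identityʳ _) (legendre-step pr k r (ℕ.<-trans ℕ.≤-refl r<p)))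

  quotient-remainder : ∀ {p} → 1 ℕ.≤ p → ∀ n → ∃[ k ] ∃[ r ] r ℕ.< p × n ≡ r ℕ.+ k ℕ.* p
  quotient-remainder {p} 1≤p n = n ℕ./ p , n ℕ.% p , ℕ.m%n<n n p , ℕ.m≡m%n+[m/n]*n n p
    where instance _ = ℕ.>-nonZero 1≤p

  prime⇒≥1 : ∀ {p} → Prime p → 1 ℕ.≤ p
  prime⇒≥1 pr = ℕ.<⇒≤ (prime⇒≥2 pr)

  k≤k*p : ∀ {p} → 1 ℕ.≤ p → ∀ k → k ℕ.≤ k ℕ.* p
  k≤k*p {p} 1≤p k = ℕ.m≤m*n k p {{ℕ.>-nonZero 1≤p}}

  -- By `legendre-step` and induction, (p-1)(k + v(k!)) ≤ (p-1)k + k = pk ≤ n. This is the bound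
  -- v(n!) ≤ n/(p-1) without division.
  legendre-≤ : ∀ {p} → Prime p → ∀ n → ℕ.pred p ℕ.* legendre p n ℕ.≤ n
  legendre-≤ {p} pr = <-rec _ step
    where
    open ℕ.≤-Reasoning
    step : ∀ n → (∀ {m} → m ℕ.< n → ℕ.pred p ℕ.* legendre p m ℕ.≤ m) → ℕ.pred p ℕ.* legendre p n ℕ.≤
      n
    step n rec with quotient-remainder (prime⇒≥1 pr) n
    ... | zero , r , r<p , ≡.refl rewrite legendre-step pr zero r r<p | ℕ.*-zeroʳ (ℕ.pred p) = z≤n
    ... | k@(suc _) , r , r<p , ≡.refl = begin
      ℕ.pred p ℕ.* legendre p (r ℕ.+ k ℕ.* p) ≡⟨ ≡.cong (ℕ.pred p ℕ.*_) (legendre-step pr k r r<p) ⟩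
      ℕ.pred p ℕ.* (k ℕ.+ legendre p k)                ≡⟨ ℕ.*-distribˡ-+ (ℕ.pred p) k _ ⟩
      ℕ.pred p ℕ.* k ℕ.+ ℕ.pred p ℕ.* legendre p k ≤⟨ ℕ.+-monoʳ-≤ _ (rec (ℕ.<-≤-trans (ℕ.m<m*n k p
        (prime⇒≥2 pr)) (ℕ.m≤n+m _ r))) ⟩
      ℕ.pred p ℕ.* k ℕ.+ k                             ≡⟨ ℕ.+-comm _ k ⟩
      suc (ℕ.pred p) ℕ.* k ≡⟨ ≡.cong (ℕ._* k) (ℕ.suc-pred p {{ℕ.>-nonZero (prime⇒≥1 pr)}}) ⟩
      p ℕ.* k                                          ≡⟨ ℕ.*-comm p k ⟩
      k ℕ.* p                                          ≤⟨ ℕ.m≤n+m _ r ⟩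
      r ℕ.+ k ℕ.* p                                    ∎

  -- The quotient k of n by p satisfies k ≤ v(n!) and n < p + kp.
  legendre-≥ : ∀ {p} → Prime p → ∀ n → n ℕ.≤ p ℕ.+ legendre p n ℕ.* p
  legendre-≥ {p} pr n with k , r , r<p , ≡.refl ← quotient-remainder (prime⇒≥1 pr) n =
    ℕ.+-mono-≤ (ℕ.<⇒≤ r<p) (ℕ.*-monoˡ-≤ p (ℕ.≤-trans (ℕ.m≤m+n k _) (ℕ.≤-reflexive (≡.sym
      (legendre-step pr k r r<p)))))

  legendre-small : ∀ {p n} → Prime p → n ℕ.< p → legendre p n ≡ 0
  legendre-small {p} {n} pr n<p = ≡.trans (≡.cong (legendre p) (≡.sym (ℕ.+-identityʳ n)))
    (legendre-step pr 0 n n<p)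

  legendre-pos : ∀ {p n} → Prime p → p ℕ.≤ n → 1 ℕ.≤ legendre p n
  legendre-pos {p} pr p≤n = ℕ.≤-trans (ℕ.≤-reflexive (≡.sym (≡.trans (≡.cong (legendre p) (≡.sym
    (ℕ.*-identityˡ p)))
    (≡.trans (legendre-step pr 1 0 (prime⇒≥1 pr)) (≡.cong suc (legendre-small pr (prime⇒≥2 pr)))))))
      (legendre-mono p p≤n)

  -- This is the integrality of the binomial coefficient (2n)!/(n!)², one prime at a time. Writing n
  -- = r + kp reduces it to k, and dropping 2r from 2n only lowers the right side.
  legendre-double : ∀ {p} → Prime p → ∀ n → legendre p n ℕ.+ legendre p n ℕ.≤ legendre p (n ℕ.+ n)
  legendre-double {p} pr = <-rec _ step
    where
    open ℕ.≤-Reasoning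
    step : ∀ n → (∀ {m} → m ℕ.< n → legendre p m ℕ.+ legendre p m ℕ.≤ legendre p (m ℕ.+ m)) →
           legendre p n ℕ.+ legendre p n ℕ.≤ legendre p (n ℕ.+ n)
    step n rec with quotient-remainder (prime⇒≥1 pr) n
    ... | zero , r , r<p , ≡.refl rewrite legendre-step pr zero r r<p = z≤n
    ... | k@(suc _) , r , r<p , ≡.refl = begin
      legendre p n′ ℕ.+ legendre p n′                       ≡⟨ ≡.cong₂ ℕ._+_ eq eq ⟩
      (k ℕ.+ legendre p k) ℕ.+ (k ℕ.+ legendre p k)         ≡⟨ interchange k (legendre p k) ⟩
      (k ℕ.+ k) ℕ.+ (legendre p k ℕ.+ legendre p k) ≤⟨ ℕ.+-monoʳ-≤ (k ℕ.+ k) (rec (ℕ.<-≤-trans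
        (ℕ.m<m*n k p (prime⇒≥2 pr)) (ℕ.m≤n+m _ r))) ⟩
      (k ℕ.+ k) ℕ.+ legendre p (k ℕ.+ k) ≡⟨ legendre-step pr (k ℕ.+ k) 0 (prime⇒≥1 pr) ⟨
      legendre p ((k ℕ.+ k) ℕ.* p) ≤⟨ legendre-mono p (ℕ.≤-trans (ℕ.≤-reflexive (ℕ.*-distribʳ-+ p k
        k)) (ℕ.+-mono-≤ (ℕ.m≤n+m _ r) (ℕ.m≤n+m _ r))) ⟩
      legendre p (n′ ℕ.+ n′)                                ∎
      where
      n′ = r ℕ.+ k ℕ.* p
      eq = legendre-step pr k r r<p
      interchange : ∀ a b → (a ℕ.+ b) ℕ.+ (a ℕ.+ b) ≡ (a ℕ.+ a) ℕ.+ (b ℕ.+ b)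
      interchange a b = ≡.trans (ℕ.+-assoc a b _) (≡.trans (≡.cong (a ℕ.+_)
        (≡.trans (≡.sym (ℕ.+-assoc b a b)) (≡.trans (≡.cong (ℕ._+ b) (ℕ.+-comm b a)) (ℕ.+-assoc a b
          b)))) (≡.sym (ℕ.+-assoc a a _)))
open Valuation

-- Squares modulo q and quadratic characters.

module Residues (em : ExcludedMiddle 0ℓ) (R : CompleteOrderedField) (q : ℕ) (3≤q : 3 ℕ.≤ q) where
  open Analysis em R using (QuadraticResidue)

  instance
    q≢0 : ℕ.NonZero q
    q≢0 = ℕ.>-nonZero (ℕ.≤-trans (s≤s z≤n) 3≤q)

  infix 4 _≋_
  _≋_ : ℕ → ℕ → Set
  a ≋ b = a ℕ.% q ≡ b ℕ.% q

  %-≋ : ∀ a → a ℕ.% q ≋ a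
  %-≋ a = ℕ.m%n%n≡m%n a q

  ≋-* : ∀ {a b c d} → a ≋ b → c ≋ d → a ℕ.* c ≋ b ℕ.* d
  ≋-* {a} {b} {c} {d} p r = ≡.trans (ℕ.%-distribˡ-* a c q) (≡.trans (≡.cong₂ (λ x y → (x ℕ.* y) ℕ.%
    q) p r)
    (≡.sym (ℕ.%-distribˡ-* b d q)))

  ≋⇒∣ : ∀ {a b} → a ≋ b → q ∣ ∣ a - b ∣
  ≋⇒∣ {a} {b} a≋b = divides ∣ a ℕ./ q - b ℕ./ q ∣ (begin
    ∣ a - b ∣ ≡⟨ ≡.cong₂ ∣_-_∣ (ℕ.m≡m%n+[m/n]*n a q) (ℕ.m≡m%n+[m/n]*n b q) ⟩
    ∣ a ℕ.% q ℕ.+ a ℕ./ q ℕ.* q - b ℕ.% q ℕ.+ b ℕ./ q ℕ.* q ∣ ≡⟨ ≡.cong (λ r → ∣ a ℕ.% q ℕ.+ a ℕ./ q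
      ℕ.* q - r ℕ.+ b ℕ./ q ℕ.* q ∣) (≡.sym a≋b) ⟩
    ∣ a ℕ.% q ℕ.+ a ℕ./ q ℕ.* q - a ℕ.% q ℕ.+ b ℕ./ q ℕ.* q ∣ ≡⟨ ℕ.∣m+n-m+o∣≡∣n-o∣ (a ℕ.% q) _ _ ⟩
    ∣ a ℕ./ q ℕ.* q - b ℕ./ q ℕ.* q ∣ ≡⟨ ℕ.*-distribʳ-∣-∣ q (a ℕ./ q) (b ℕ./ q) ⟨
    ∣ a ℕ./ q - b ℕ./ q ∣ ℕ.* q                                      ∎)
    where open ≡.≡-Reasoning

  ∣⇒≋ : ∀ {a b} → q ∣ ∣ a - b ∣ → a ≋ b
  ∣⇒≋ {a} {b} d = [ (λ a≤b → ordered a≤b d) , (λ b≤a → ≡.sym (ordered b≤a (≡.subst (q ∣_)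
    (ℕ.∣-∣-comm a b) d))) ]′ (ℕ.≤-total a b)
    where
    ordered : ∀ {a b} → a ℕ.≤ b → q ∣ ∣ a - b ∣ → a ≋ b
    ordered {a} {b} a≤b (divides k e) = ≡.trans (≡.sym (ℕ.[m+kn]%n≡m%n a k q)) (≡.cong (ℕ._% q)
      (≡.trans (≡.cong (a ℕ.+_) (≡.trans (≡.sym e) (ℕ.m≤n⇒∣m-n∣≡n∸m a≤b))) (ℕ.m+[n∸m]≡n a≤b)))

  Coprime-≋ : ∀ {a b} → a ≋ b → Coprime a q → Coprime b q
  Coprime-≋ {a} {b} a≋b ca (d∣b , d∣q) = ca (ℕ.∣n∣m%n⇒∣m d∣q (≡.subst (_ ∣_) (≡.sym a≋b)
    (ℕ.%-presˡ-∣ d∣b d∣q)) , d∣q)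

  Coprime-* : ∀ {a b} → Coprime a q → Coprime b q → Coprime (a ℕ.* b) q
  Coprime-* {a} {b} ca cb {d} (d∣ab , d∣q) = cb (coprime-divisor (λ { (e∣d , e∣a) → ca (e∣a ,
    ℕ.∣-trans e∣d d∣q) }) d∣ab , d∣q)

  Coprime-*ˡ : ∀ {a b} → Coprime (a ℕ.* b) q → Coprime a q
  Coprime-*ˡ {a} {b} c (d∣a , d∣q) = c (ℕ.∣m⇒∣m*n b d∣a , d∣q)

  Coprime-*ʳ : ∀ {a b} → Coprime (a ℕ.* b) q → Coprime b q
  Coprime-*ʳ {a} {b} c (d∣b , d∣q) = c (ℕ.∣n⇒∣m*n a d∣b , d∣q)

  inverse-≋ : ∀ {a} → Coprime a q → ∃[ b ] a ℕ.* b ≋ 1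
  inverse-≋ {a} ca with coprime-Bézout ca
  ... | Bézout.+- x y e = x , ≡.trans (≡.cong (ℕ._% q) (≡.trans (ℕ.*-comm a x) (≡.sym e)))
    (ℕ.[m+kn]%n≡m%n 1 y q)
  -- Here 1 + xa = yq, so x is the negative of an inverse; the factor q - 1, which is -1 modulo q,
  -- corrects the sign.
  ... | Bézout.-+ x y e = ℕ.pred q ℕ.* x , (begin
    (a ℕ.* (ℕ.pred q ℕ.* x)) ℕ.% q                         ≡⟨ ℕ.[m+kn]%n≡m%n _ y q ⟨
    (a ℕ.* (ℕ.pred q ℕ.* x) ℕ.+ y ℕ.* q) ℕ.% q ≡⟨ ≡.cong (λ z → (a ℕ.* (ℕ.pred q ℕ.* x) ℕ.+ z) ℕ.%
      q) e ⟨
    (a ℕ.* (ℕ.pred q ℕ.* x) ℕ.+ (1 ℕ.+ x ℕ.* a)) ℕ.% q ≡⟨ ≡.cong (ℕ._% q) (rearrange a (ℕ.pred q) x)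
      ⟩
    (1 ℕ.+ x ℕ.* a ℕ.* suc (ℕ.pred q)) ℕ.% q ≡⟨ ≡.cong (λ z → (1 ℕ.+ x ℕ.* a ℕ.* z) ℕ.% q)
      (ℕ.suc-pred q) ⟩
    (1 ℕ.+ x ℕ.* a ℕ.* q) ℕ.% q                            ≡⟨ ℕ.[m+kn]%n≡m%n 1 (x ℕ.* a) q ⟩
    1 ℕ.% q                                                ∎)
    where
    open ≡.≡-Reasoning
    rearrange : ∀ a p x → a ℕ.* (p ℕ.* x) ℕ.+ (1 ℕ.+ x ℕ.* a) ≡ 1 ℕ.+ x ℕ.* a ℕ.* suc p
    rearrange = solve-∀

  -- K represents a subgroup of (ℤ/q)ˣ that contains the squares; nothing is
  -- required of K outside the units.
  record SquareSubgroup (K : ℕ → Set) : Set where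
    field
      resp   : ∀ {a b} → a ≋ b → K a → K b
      square : ∀ {a} → Coprime a q → K (a ℕ.* a)
      mul    : ∀ {a b} → K a → K b → K (a ℕ.* b)
      cancel : ∀ {a b} → Coprime a q → K a → K (a ℕ.* b) → K b

  Square : ℕ → Set
  Square a = ∃[ b ] Coprime b q × b ℕ.* b ≋ a

  squares : SquareSubgroup Square
  squares = record
    { resp   = λ a≋b (c , cc , e) → c , cc , ≡.trans e a≋b
    ; square = λ {a} ca → a , ca , ≡.refl
    ; mul = λ (b , cb , e) (c , cc , f) → b ℕ.* c , Coprime-* cb cc , ≡.trans (≡.cong (ℕ._% q)
      (interchange b c)) (≋-* e f)
    ; cancel = cancel
    }
    where
    interchange : ∀ b c → b ℕ.* c ℕ.* (b ℕ.* c) ≡ b ℕ.* b ℕ.* (c ℕ.* c)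
    interchange = solve-∀
    cancel : ∀ {a b} → Coprime a q → Square a → Square (a ℕ.* b) → Square b
    cancel {a} {b} _ (c , cc , e) (d , cd , f) with c′ , cc′≋1 ← inverse-≋ cc = d ℕ.* c′ , Coprime-*
      cd c′-coprime , (begin
        (d ℕ.* c′ ℕ.* (d ℕ.* c′)) ℕ.% q         ≡⟨ ≡.cong (ℕ._% q) (interchange d c′) ⟩
        (d ℕ.* d ℕ.* (c′ ℕ.* c′)) ℕ.% q ≡⟨ ≋-* {c = c′ ℕ.* c′} (≡.trans f (≋-* (≡.sym e) (≡.refl {x
          = b ℕ.% q}))) ≡.refl ⟩
        (c ℕ.* c ℕ.* b ℕ.* (c′ ℕ.* c′)) ℕ.% q   ≡⟨ ≡.cong (ℕ._% q) (rearrange c c′ b) ⟩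
        (c ℕ.* c′ ℕ.* (c ℕ.* c′) ℕ.* b) ℕ.% q   ≡⟨ ≋-* {c = b} (≋-* cc′≋1 cc′≋1) ≡.refl ⟩
        (1 ℕ.* b) ℕ.% q                         ≡⟨ ≡.cong (ℕ._% q) (ℕ.*-identityˡ b) ⟩
        b ℕ.% q                                 ∎)
      where
      open ≡.≡-Reasoning
      rearrange : ∀ c d b → c ℕ.* c ℕ.* b ℕ.* (d ℕ.* d) ≡ c ℕ.* d ℕ.* (c ℕ.* d) ℕ.* b
      rearrange = solve-∀
      c′-coprime : Coprime c′ q
      c′-coprime = Coprime-*ʳ {c} (Coprime-≋ (≡.sym cc′≋1) (Coprimality.1-coprimeTo q))

  -- On the units this is the subgroup generated by K and b: as b² lies in K, the only new coset is
  -- Kb, and x lies in it when xb lies in K.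
  extend : (ℕ → Set) → ℕ → ℕ → Set
  extend K b x = K x ⊎ K (x ℕ.* b)

  extend-subgroup : ∀ {K} → SquareSubgroup K → ∀ {b} → Coprime b q → SquareSubgroup (extend K b)
  extend-subgroup {K} S {b} cb = record
    { resp = λ {x} {y} x≋y → [ (λ k → inj₁ (resp x≋y k)) , (λ k → inj₂ (resp (≋-* {c = b} x≋y
      ≡.refl) k)) ]′
    ; square = λ cx → inj₁ (square cx)
    ; mul    = λ {x} {y} → mul′ x y
    ; cancel = λ {x} {y} → cancel′ x y
    }
    where
    open SquareSubgroup S
    resp-≡ : ∀ {x y} → x ≡ y → K x → K y
    resp-≡ = ≡.subst K
    e₁ : ∀ x y b → x ℕ.* (y ℕ.* b) ≡ x ℕ.* y ℕ.* b
    e₁ = solve-∀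
    e₂ : ∀ x y b → x ℕ.* b ℕ.* y ≡ x ℕ.* y ℕ.* b
    e₂ = solve-∀
    e₃ : ∀ x y b → x ℕ.* b ℕ.* (y ℕ.* b) ≡ b ℕ.* b ℕ.* (x ℕ.* y)
    e₃ = solve-∀
    e₄ : ∀ x y b → x ℕ.* b ℕ.* (x ℕ.* y) ≡ x ℕ.* x ℕ.* (y ℕ.* b)
    e₄ = solve-∀
    e₅ : ∀ x y b → x ℕ.* y ℕ.* b ≡ x ℕ.* b ℕ.* y
    e₅ = solve-∀
    e₆ : ∀ x y b → x ℕ.* y ℕ.* b ≡ x ℕ.* (y ℕ.* b)
    e₆ = solve-∀
    mul′ : ∀ x y → extend K b x → extend K b y → extend K b (x ℕ.* y)
    mul′ x y (inj₁ k) (inj₁ l) = inj₁ (mul k l)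
    mul′ x y (inj₁ k) (inj₂ l) = inj₂ (resp-≡ (e₁ x y b) (mul k l))
    mul′ x y (inj₂ k) (inj₁ l) = inj₂ (resp-≡ (e₂ x y b) (mul k l))
    mul′ x y (inj₂ k) (inj₂ l) = inj₁ (cancel (Coprime-* cb cb) (square cb) (resp-≡ (e₃ x y b) (mul
      k l)))
    cancel′ : ∀ x y → Coprime x q → extend K b x → extend K b (x ℕ.* y) → extend K b y
    cancel′ x y cx (inj₁ k) (inj₁ l) = inj₁ (cancel cx k l)
    cancel′ x y cx (inj₁ k) (inj₂ l) = inj₂ (cancel cx k (resp-≡ (e₆ x y b) l))
    cancel′ x y cx (inj₂ k) (inj₁ l) = inj₂ (cancel (Coprime-* cx cx) (square cx) (resp-≡ (e₄ x y b)
      (mul k l)))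
    cancel′ x y cx (inj₂ k) (inj₂ l) = inj₁ (cancel (Coprime-* cx cb) k (resp-≡ (e₅ x y b) l))

  -- A quadratic character, sign a = true meaning that a is sent to -1.  The
  -- values of sign outside the units are irrelevant.
  record SignCharacter : Set where
    field
      sign      : ℕ → Bool
      sign-≋    : ∀ {a b} → a ≋ b → sign a ≡ sign b
      sign-*    : ∀ {a b} → Coprime a q → Coprime b q → sign (a ℕ.* b) ≡ sign a xor sign b
  open SignCharacter public

  xor-same : ∀ b → b xor b ≡ false
  xor-same true  = ≡.refl
  xor-same false = ≡.refl

  sign-square : ∀ c {a} → Coprime a q → sign c (a ℕ.* a) ≡ false
  sign-square c {a} ca = ≡.trans (sign-* c ca ca) (xor-same (sign c a))

  -- Enlarging the subgroup of squares by one residue at a time, as long as a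
  -- stays outside, yields a subgroup of index two.
  maximal-subgroup : ∀ {a} → Coprime a q → ¬ Square a → ∀ n →
    Σ (ℕ → Set) λ K → SquareSubgroup K × ¬ K a × (∀ b → b ℕ.< n → Coprime b q → K b ⊎ K (a ℕ.* b))
  maximal-subgroup ca ¬a zero = Square , squares , ¬a , λ _ ()
  maximal-subgroup {a} ca ¬a (suc n) with maximal-subgroup ca ¬a n
  ... | K , S , ¬Ka , h with em {Coprime n q} | em {K (a ℕ.* n)}
  ... | no ¬cn | _ = K , S , ¬Ka , λ b b<1+n cb →
        [ (λ b<n → h b b<n cb) , (λ { ≡.refl → ⊥-elim (¬cn cb) }) ]′ (ℕ.m≤n⇒m<n∨m≡n (ℕ.≤-pred
          b<1+n))
  ... | yes cn | yes Kan = K , S , ¬Ka , λ b b<1+n cb →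
        [ (λ b<n → h b b<n cb) , (λ { ≡.refl → inj₂ Kan }) ]′ (ℕ.m≤n⇒m<n∨m≡n (ℕ.≤-pred b<1+n))
  -- The element a stays outside because neither a nor an lies in K, and n enters because n² lies in
  -- K.
  ... | yes cn | no ¬Kan = extend K n , extend-subgroup S cn , [ ¬Ka , ¬Kan ]′ , λ b b<1+n cb →
        [ (λ b<n → [ (λ k → inj₁ (inj₁ k)) , (λ k → inj₂ (inj₁ k)) ]′ (h b b<n cb))
        , (λ { ≡.refl → inj₁ (inj₂ (SquareSubgroup.square S cb)) }) ]′ (ℕ.m≤n⇒m<n∨m≡n (ℕ.≤-pred
          b<1+n))

  -- The kernel is the subgroup K of `maximal-subgroup`. Every unit outside K lies in the coset of
  -- a, so for x and y both outside, ax and ay lie in K; cancelling a² from their product puts xy in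
  -- K, which is multiplicativity in the only case that needs index two.
  separating-character : ∀ {a} → Coprime a q → ¬ Square a → Σ SignCharacter λ c → sign c a ≡ true
  separating-character {a} ca ¬a with K , S , ¬Ka , h ← maximal-subgroup ca ¬a q = record
    { sign   = s
    ; sign-≋ = λ {x} {y} x≋y → s-cong em em (resp x≋y) (resp (≡.sym x≋y))
    ; sign-* = λ {x} {y} cx cy → s-* x y cx cy em em em
    } , s-no em ¬Ka
    where
    open SquareSubgroup S
    out : {P : Set} → Dec P → Bool
    out (yes _) = false
    out (no _)  = true
    s : ℕ → Bool
    s x = out (em {K x})
    s-no : {P : Set} (d : Dec P) → ¬ P → out d ≡ true
    s-no (yes p) ¬p = ⊥-elim (¬p p)
    s-no (no _)  _  = ≡.refl
    s-cong : {P Q : Set} (d : Dec P) (e : Dec Q) → (P → Q) → (Q → P) → out d ≡ out e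
    s-cong (yes _) (yes _) _ _ = ≡.refl
    s-cong (yes p) (no ¬r) f _ = ⊥-elim (¬r (f p))
    s-cong (no ¬p) (yes r) _ g = ⊥-elim (¬p (g r))
    s-cong (no _)  (no _)  _ _ = ≡.refl
    index-two : ∀ b → Coprime b q → ¬ K b → K (a ℕ.* b)
    index-two b cb ¬Kb with h (b ℕ.% q) (ℕ.m%n<n b q) (Coprime-≋ (≡.sym (%-≋ b)) cb)
    ... | inj₁ k = ⊥-elim (¬Kb (resp (%-≋ b) k))
    ... | inj₂ k = resp (≋-* {a} ≡.refl (%-≋ b)) k
    rearrange : ∀ a x y → a ℕ.* x ℕ.* (a ℕ.* y) ≡ a ℕ.* a ℕ.* (x ℕ.* y)
    rearrange = solve-∀
    s-* : ∀ x y → Coprime x q → Coprime y q → (d : Dec (K (x ℕ.* y))) (e : Dec (K x)) (f : Dec (K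
      y)) → out d ≡ out e xor out f
    s-* x y cx cy (yes k) (yes l) (yes m) = ≡.refl
    s-* x y cx cy (yes k) (yes l) (no ¬m) = ⊥-elim (¬m (cancel cx l k))
    s-* x y cx cy (yes k) (no ¬l) (yes m) = ⊥-elim (¬l (cancel cy m (≡.subst K (ℕ.*-comm x y) k)))
    s-* x y cx cy (yes k) (no ¬l) (no ¬m) = ≡.refl
    s-* x y cx cy (no ¬k) (yes l) (yes m) = ⊥-elim (¬k (mul l m))
    s-* x y cx cy (no ¬k) (yes l) (no ¬m) = ≡.refl
    s-* x y cx cy (no ¬k) (no ¬l) (yes m) = ≡.refl
    s-* x y cx cy (no ¬k) (no ¬l) (no ¬m) = ⊥-elim (¬k (cancel (Coprime-* ca ca) (square ca)
      (≡.subst K (rearrange a x y) (mul (index-two x cx ¬l) (index-two y cy ¬m)))))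

  infixl 7 _⊗_
  _⊗_ : SignCharacter → SignCharacter → SignCharacter
  c ⊗ d = record
    { sign   = λ a → sign c a xor sign d a
    ; sign-≋ = λ a≋b → ≡.cong₂ _xor_ (sign-≋ c a≋b) (sign-≋ d a≋b)
    ; sign-* = λ {a} {b} ca cb → ≡.trans (≡.cong₂ _xor_ (sign-* c ca cb) (sign-* d ca cb))
                 (interchange (sign c a) (sign c b) (sign d a) (sign d b))
    }
    where
    interchange : ∀ w x y z → (w xor x) xor (y xor z) ≡ (w xor y) xor (x xor z)
    interchange false false y     z     = ≡.refl
    interchange false true  false z     = ≡.refl
    interchange false true  true  false = ≡.refl
    interchange false true  true  true  = ≡.refl
    interchange true  false false z     = ≡.refl
    interchange true  false true  false = ≡.refl
    interchange true  false true  true  = ≡.refl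
    interchange true  true  false false = ≡.refl
    interchange true  true  false true  = ≡.refl
    interchange true  true  true  z     = ≡.refl

  -- One product for each nonempty subfamily, that is, the terms other than 1 in the expansion of
  -- the product of all 1 + c.
  products : List SignCharacter → List SignCharacter
  products []       = []
  products (c ∷ cs) = c ∷ products cs ++ map (c ⊗_) (products cs)

  NontrivialSign : SignCharacter → Set
  NontrivialSign c = ∃[ a ] Coprime a q × sign c a ≡ true

  nontrivial : ∀ c a → Coprime a q → sign c a ≡ true → NontrivialSign c
  nontrivial c a ca e = a , ca , e

  products-false : ∀ {a} cs → All (λ c → sign c a ≡ false) cs → All (λ c → sign c a ≡ false)
    (products cs)
  products-false []       []       = []
  products-false (c ∷ cs) (p ∷ ps) = p ∷ All.++⁺ (products-false cs ps)
    (All.map⁺ (All.map (λ r → ≡.trans (≡.cong₂ _xor_ p r) ≡.refl) (products-false cs ps)))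

  Separates : List SignCharacter → ℕ → Set
  Separates cs a = ∃[ c ] c ∈ cs × sign c a ≡ true

  separates-dec : ∀ cs a → Separates cs a ⊎ All (λ c → sign c a ≡ false) cs
  separates-dec []       a = inj₂ []
  separates-dec (c ∷ cs) a with sign c a in e | separates-dec cs a
  ... | true  | _                     = inj₁ (c , here ≡.refl , e)
  ... | false | inj₁ (d , d∈cs , f)   = inj₁ (d , there d∈cs , f)
  ... | false | inj₂ fs               = inj₂ (e ∷ fs)

  -- Characters are added for residues a that are not yet separated from the
  -- squares; then all earlier characters are trivial on a, so that the new
  -- products are nontrivial.
  separating-family : ∀ n → Σ (List SignCharacter) λ cs → All NontrivialSign (products cs) ×
    (∀ a → a ℕ.< n → Coprime a q → ¬ Square a → Separates cs a)
  separating-family zero = [] , [] , λ _ ()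
  separating-family (suc n) with separating-family n
  ... | cs , nt , sep with em {Coprime n q × ¬ Square n} | separates-dec cs n
  ... | no ¬h | _ = cs , nt , λ a a<1+n ca ¬a →
        [ (λ a<n → sep a a<n ca ¬a) , (λ { ≡.refl → ⊥-elim (¬h (ca , ¬a)) }) ]′ (ℕ.m≤n⇒m<n∨m≡n
          (ℕ.≤-pred a<1+n))
  ... | yes _ | inj₁ s = cs , nt , λ a a<1+n ca ¬a →
        [ (λ a<n → sep a a<n ca ¬a) , (λ { ≡.refl → s }) ]′ (ℕ.m≤n⇒m<n∨m≡n (ℕ.≤-pred a<1+n))
  ... | yes (cn , ¬n) | inj₂ fs with c , e ← separating-character cn ¬n =
        c ∷ cs
      , (n , cn , e) ∷ All.++⁺ nt (All.map⁺ {f = c ⊗_} (All.map (λ {d} r → nontrivial (c ⊗ d) n cn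
        (≡.cong₂ _xor_ e r)) (products-false cs fs)))
      , λ a a<1+n ca ¬a →
          [ (λ a<n → let d , d∈cs , f = sep a a<n ca ¬a in d , there d∈cs , f) , (λ { ≡.refl → c , here ≡.refl , e }) ]′
            (ℕ.m≤n⇒m<n∨m≡n (ℕ.≤-pred a<1+n))

  family : List SignCharacter
  family = proj₁ (separating-family q)

  family-nontrivial : All NontrivialSign (products family)
  family-nontrivial = proj₁ (proj₂ (separating-family q))

  family-separates : ∀ a → Coprime a q → ¬ Square a → Separates family a
  family-separates a ca ¬a with proj₂ (proj₂ (separating-family q)) (a ℕ.% q) (ℕ.m%n<n a q)
    (Coprime-≋ (≡.sym (%-≋ a)) ca)
                                  (λ s → ¬a (SquareSubgroup.resp squares (%-≋ a) s))
  ... | c , c∈ , e = c , c∈ , ≡.trans (sign-≋ c (≡.sym (%-≋ a))) e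

  family-false : ∀ {a} → Square a → All (λ c → sign c a ≡ false) (products family)
  family-false {a} (b , cb , e) = All.universal (λ c → ≡.trans (sign-≋ c (≡.sym e)) (sign-square c
    cb)) _

  residue⇒Square : ∀ {a} → QuadraticResidue q a → Square a
  residue⇒Square (_ , b , cb , d) = b , cb , ∣⇒≋ d

  Square⇒residue : ∀ {a} → Square a → QuadraticResidue q a
  Square⇒residue (b , cb , e) = Coprime-≋ e (Coprime-* cb cb) , b , cb , ≋⇒∣ e

  coprime-pred : Coprime (ℕ.pred q) q
  coprime-pred (d∣q-1 , d∣q) = ℕ.∣1⇒≡1 (ℕ.∣m+n∣m⇒∣n (≡.subst (_ ∣_) (≡.trans (≡.sym (ℕ.suc-pred q))
    (ℕ.+-comm 1 (ℕ.pred q))) d∣q) d∣q-1)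

  pred²≋1 : ℕ.pred q ℕ.* ℕ.pred q ≋ 1
  pred²≋1 = begin
    (p ℕ.* p) ℕ.% q                     ≡⟨ ℕ.[m+kn]%n≡m%n _ 2 q ⟨
    (p ℕ.* p ℕ.+ 2 ℕ.* q) ℕ.% q ≡⟨ ≡.cong (λ z → (p ℕ.* p ℕ.+ 2 ℕ.* z) ℕ.% q) (≡.sym (ℕ.suc-pred q))
      ⟩
    (p ℕ.* p ℕ.+ 2 ℕ.* suc p) ℕ.% q     ≡⟨ ≡.cong (ℕ._% q) (expand p) ⟩
    (1 ℕ.+ suc p ℕ.* suc p) ℕ.% q       ≡⟨ ≡.cong (λ z → (1 ℕ.+ z ℕ.* z) ℕ.% q) (ℕ.suc-pred q) ⟩
    (1 ℕ.+ q ℕ.* q) ℕ.% q               ≡⟨ ℕ.[m+kn]%n≡m%n 1 q q ⟩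
    1 ℕ.% q                             ∎
    where
    open ≡.≡-Reasoning
    p = ℕ.pred q
    expand : ∀ p → p ℕ.* p ℕ.+ 2 ℕ.* suc p ≡ 1 ℕ.+ suc p ℕ.* suc p
    expand = solve-∀

  -- Otherwise a choice of square roots is an injection of the residues into
  -- themselves that misses one of the two square roots ±1 of 1.
  nonsquare-exists : ∃[ a ] Coprime a q × ¬ Square a
  nonsquare-exists with em {∃[ a ] Coprime a q × ¬ Square a}
  ... | yes h = h
  ... | no ¬h = ⊥-elim (contradiction₁ (root 1 em ℕ.≟ 1))
    where
    all-squares : ∀ a → Coprime a q → Square a
    all-squares a ca with em {Square a}
    ... | yes s = s
    ... | no ¬s = ⊥-elim (¬h (a , ca , ¬s))

    -- Residues that are not units are left fixed, so that `root` maps all of 0, ..., q-1 to itself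
    -- and the pigeonhole principle applies to the whole interval.
    root : ∀ a → Dec (Coprime a q) → ℕ
    root a (yes ca) = proj₁ (all-squares a ca) ℕ.% q
    root a (no _)   = a ℕ.% q

    root<q : ∀ a d → root a d ℕ.< q
    root<q a (yes ca) = ℕ.m%n<n _ q
    root<q a (no _)   = ℕ.m%n<n a q

    root-coprime : ∀ a d → Coprime (root a d) q → root a d ℕ.* root a d ≋ a
    root-coprime a (yes ca) _ with r , cr , e ← all-squares a ca = ≡.trans (≋-* {r ℕ.% q} {r} (%-≋
      r) (%-≋ r)) e
    root-coprime a (no ¬ca) c = ⊥-elim (¬ca (Coprime-≋ (%-≋ a) c))

    root-noncoprime : ∀ a d → ¬ Coprime (root a d) q → root a d ≋ a
    root-noncoprime a (yes ca) ¬c with r , cr , e ← all-squares a ca = ⊥-elim (¬c (Coprime-≋ (≡.sym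
      (%-≋ r)) cr))
    root-noncoprime a (no _)   _  = %-≋ a

    root-injective : ∀ a b d e → a ℕ.< q → b ℕ.< q → root a d ≡ root b e → a ≡ b
    root-injective a b d e a<q b<q h = ≡.trans (≡.sym (ℕ.m<n⇒m%n≡m a<q)) (≡.trans (a≋b em)
      (ℕ.m<n⇒m%n≡m b<q))
      where
      a≋b : Dec (Coprime (root a d) q) → a ≋ b
      a≋b (yes c) = ≡.trans (≡.sym (root-coprime a d c)) (≡.trans (≡.cong (λ r → (r ℕ.* r) ℕ.% q) h)
        (root-coprime b e (≡.subst (λ r → Coprime r q) h c)))
      a≋b (no ¬c) = ≡.trans (≡.sym (root-noncoprime a d ¬c)) (≡.trans (≡.cong (ℕ._% q) h)
        (root-noncoprime b e (λ c → ¬c (≡.subst (λ r → Coprime r q) (≡.sym h) c))))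

    1<q : 1 ℕ.< q
    1<q = ℕ.≤-trans (s≤s (s≤s z≤n)) 3≤q

    -- If t with t² = 1 is the chosen root of a, then a = t² = 1; so each square root of 1 other
    -- than the chosen root of 1 is missed.
    avoids : ∀ t → Coprime t q → t ℕ.* t ≋ 1 → t ≢ root 1 em → ∀ a → a ℕ.< q → t ≢ root a em
    avoids t ct t²≋1 t≢ a a<q e = t≢ (≡.trans e (≡.cong (λ a → root a em) a≡1))
      where
      a≡1 : a ≡ 1
      a≡1 = ≡.trans (≡.sym (ℕ.m<n⇒m%n≡m a<q)) (≡.trans (≡.trans
        (≡.sym (root-coprime a em (≡.subst (λ r → Coprime r q) e ct)))
        (≡.trans (≡.cong (λ r → (r ℕ.* r) ℕ.% q) (≡.sym e)) t²≋1)) (ℕ.m<n⇒m%n≡m 1<q))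

    no-missing : ∀ t → t ℕ.< q → ¬ (∀ a → a ℕ.< q → t ≢ root a em)
    no-missing t t<q miss = absurd (ℕ.suc-pred q)
      where
      absurd : ∀ {q′} → suc q′ ≡ q → ⊥
      absurd {q′} ≡.refl = let i , j , i<j , e = Fin.pigeonhole (ℕ.n<1+n q′) (λ i → punchOut (t≢root i)) in
        Fin.<⇒≢ i<j (Fin.toℕ-injective (root-injective (toℕ i) (toℕ j) em em (Fin.toℕ<n i)
          (Fin.toℕ<n j)
          (Fin.fromℕ<-injective (root (toℕ i) em) (root (toℕ j) em) (root<q (toℕ i) em) (root<q (toℕ
            j) em)
            (Fin.punchOut-injective (t≢root i) (t≢root j) e))))
        where
        t≢root : ∀ i → fromℕ< t<q ≢ fromℕ< (root<q (toℕ i) em)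
        t≢root i h = miss (toℕ i) (Fin.toℕ<n i) (Fin.fromℕ<-injective t (root (toℕ i) em) t<q
          (root<q (toℕ i) em) h)

    contradiction₁ : Dec (root 1 em ≡ 1) → ⊥
    contradiction₁ (no r≢1) = no-missing 1 1<q (avoids 1 (Coprimality.1-coprimeTo q) ≡.refl (λ e →
      r≢1 (≡.sym e)))
    -- The root of 1 is 1, so -1 is missed; it differs from 1 because q ≥ 3.
    contradiction₁ (yes r≡1) = no-missing (ℕ.pred q) (ℕ.≤-reflexive (ℕ.suc-pred q))
      (avoids (ℕ.pred q) coprime-pred pred²≋1 (λ e → ℕ.<⇒≢ 1<q-1 (≡.sym (≡.trans e r≡1))))
      where
      1<q-1 : 1 ℕ.< ℕ.pred q
      1<q-1 = ℕ.≤-pred (≡.subst (3 ℕ.≤_) (≡.sym (ℕ.suc-pred q)) 3≤q)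

  products-nonempty : 1 ℕ.≤ List.length (products family)
  products-nonempty with a , ca , ¬a ← nonsquare-exists with family-separates a ca ¬a
  ... | c , c∈ , _ = nonempty family c∈
    where
    nonempty : ∀ cs → c ∈ cs → 1 ℕ.≤ List.length (products cs)
    nonempty (_ ∷ _) _ = s≤s z≤n

module Development (em : ExcludedMiddle 0ℓ) (R : CompleteOrderedField) where

  open Analysis em R
  open CompleteOrderedField R renaming (Carrier to ℝ)
  open RawSemiringDefs (RawRing.rawSemiring (CommutativeRing.rawRing commutativeRing)) using (_^_)
  open IntegerSolver commutativeRing using (fromℤ; solve; κ; _:+_; _:*_; _:-_; :-_; _:=_)

  -- Ordered field arithmetic.

  module < = IsStrictTotalOrder isStrictTotalOrder

  <-strictPartialOrder : StrictPartialOrder 0ℓ 0ℓ 0ℓ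
  <-strictPartialOrder = record { isStrictPartialOrder = <.isStrictPartialOrder }

  module ≤-Reasoning = OrderReasoning <-strictPartialOrder
  module ≤ = NonStrict _≈_ _<_

  ≤-refl : ∀ {x} → x ≤ x
  ≤-refl = inj₂ refl

  <⇒≤ : ∀ {x y} → x < y → x ≤ y
  <⇒≤ = inj₁

  ≈⇒≤ : ∀ {x y} → x ≈ y → x ≤ y
  ≈⇒≤ = inj₂

  <-irrefl : ∀ {x} → ¬ (x < x)
  <-irrefl = <.irrefl refl

  ≤-antisym : ∀ {x y} → x ≤ y → y ≤ x → x ≈ y
  ≤-antisym = ≤.antisym <.isEquivalence <.trans <.irrefl

  ≤-trans : ∀ {x y z} → x ≤ y → y ≤ z → x ≤ z
  ≤-trans = ≤.trans <.isEquivalence <.<-resp-≈ <.trans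

  <-≤-trans : ∀ {x y z} → x < y → y ≤ z → x < z
  <-≤-trans = ≤.<-≤-trans <.trans <.<-respʳ-≈

  ≤-<-trans : ∀ {x y z} → x ≤ y → y < z → x < z
  ≤-<-trans = ≤.≤-<-trans sym <.trans <.<-respˡ-≈

  <-or-≥ : ∀ x y → x < y ⊎ y ≤ x
  <-or-≥ x y with <.compare x y
  ... | tri< a _ _ = inj₁ a
  ... | tri≈ _ b _ = inj₂ (inj₂ (sym b))
  ... | tri> _ _ c = inj₂ (inj₁ c)

  ≤-total : ∀ x y → x ≤ y ⊎ y ≤ x
  ≤-total x y = [ inj₁ ∘ <⇒≤ , inj₂ ]′ (<-or-≥ x y)

  ≮⇒≥ : ∀ {x y} → ¬ (x < y) → y ≤ x
  ≮⇒≥ {x} {y} x≮y = [ (λ x<y → ⊥-elim (x≮y x<y)) , id ]′ (<-or-≥ x y)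

  <⇒≱ : ∀ {x y} → x < y → ¬ (y ≤ x)
  <⇒≱ x<y y≤x = <-irrefl (<-≤-trans x<y y≤x)

  ≤-resp : ∀ {x y x′ y′} → x ≈ x′ → y ≈ y′ → x ≤ y → x′ ≤ y′
  ≤-resp p q h = ≤-trans (inj₂ (sym p)) (≤-trans h (inj₂ q))

  <-resp : ∀ {x y x′ y′} → x ≈ x′ → y ≈ y′ → x < y → x′ < y′
  <-resp p q h = <.<-respʳ-≈ q (<.<-respˡ-≈ p h)

  -- A linear inequality is proved by exhibiting the difference of its sides, or
  -- a positive multiple of it, as a nonnegative combination of the differences
  -- of the sides of known inequalities; the ring solver checks the identity.

  gap< : ∀ {x y} → x < y → 0# < y - x
  gap< {x} {y} h = <-resp (-‿inverseʳ x) refl (+-mono-< x y (- x) h)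

  gap≤ : ∀ {x y} → x ≤ y → 0# ≤ y - x
  gap≤ (inj₁ h) = inj₁ (gap< h)
  gap≤ (inj₂ e) = inj₂ (trans (sym (-‿inverseʳ _)) (+-congʳ e))

  gap<⇒≤ : ∀ {x y} → x < y → 0# ≤ y - x
  gap<⇒≤ h = inj₁ (gap< h)

  gap≈ : ∀ {x y} → x ≈ y → 0# ≤ y - x
  gap≈ e = gap≤ (inj₂ e)

  gap≈˘ : ∀ {x y} → x ≈ y → 0# ≤ x - y
  gap≈˘ e = gap≤ (inj₂ (sym e))

  ungap< : ∀ {x y} → 0# < y - x → x < y
  ungap< {x} {y} h = <-resp (+-identityˡ x)
    (solve 2 (λ y x → (y :- x) :+ x := y) refl y x)
    (+-mono-< 0# (y - x) x h)

  0<1 : 0# < 1#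
  0<1 with <.compare 0# 1#
  ... | tri< a _ _ = a
  ... | tri≈ _ b _ = ⊥-elim (1≉0 (sym b))
  ... | tri> _ _ c = <-resp refl (solve 0 ((κ 0 :- κ 1) :* (κ 0 :- κ 1) := κ 1) refl)
                       (*-pos (0# - 1#) (0# - 1#) (gap< c) (gap< c))

  0≤1 : 0# ≤ 1#
  0≤1 = inj₁ 0<1

  infixr 5 _<+≤_ _≤+≤_

  _<+≤_ : ∀ {x y} → 0# < x → 0# ≤ y → 0# < x + y
  _<+≤_ {x} {y} 0<x (inj₁ 0<y) = <.trans 0<y (<-resp (+-identityˡ y) refl (+-mono-< 0# x y 0<x))
  _<+≤_ {x} {y} 0<x (inj₂ 0≈y) = <-resp refl (trans (sym (+-identityʳ x)) (+-congˡ 0≈y)) 0<x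

  _≤+≤_ : ∀ {x y} → 0# ≤ x → 0# ≤ y → 0# ≤ x + y
  inj₁ 0<x ≤+≤ 0≤y      = inj₁ (0<x <+≤ 0≤y)
  _≤+≤_ {x} {y} (inj₂ 0≈x) 0≤y = ≤-resp refl (trans (sym (+-identityˡ y)) (+-congʳ 0≈x)) 0≤y

  0<ι-suc : ∀ n → 0# < ι (suc n)
  0<ι-suc zero    = 0<1 <+≤ ≤-refl
  0<ι-suc (suc n) = 0<1 <+≤ inj₁ (0<ι-suc n)

  0<fromℤ : ∀ n → 0# < fromℤ (+ suc n)
  0<fromℤ zero    = 0<1
  0<fromℤ (suc n) = 0<ι-suc (suc n)

  scale< : ∀ n {x} → 0# < x → 0# < fromℤ (+ suc n) * x
  scale< n {x} 0<x = *-pos (fromℤ (+ suc n)) x (0<fromℤ n) 0<x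

  scale≤ : ∀ n {x} → 0# ≤ x → 0# ≤ fromℤ (+ n) * x
  scale≤ zero    {x} _          = inj₂ (sym (zeroˡ x))
  scale≤ (suc n) {x} (inj₁ 0<x) = inj₁ (scale< n 0<x)
  scale≤ (suc n) {x} (inj₂ 0≈x) = inj₂ (trans (sym (zeroʳ (fromℤ (+ suc n)))) (*-congˡ 0≈x))

  infixr 5 _≈0+≈0_

  gap≈0 : ∀ {x y} → x ≈ y → y - x ≈ 0#
  gap≈0 {x} {y} e = trans (+-congˡ (-‿cong e)) (-‿inverseʳ y)

  gap≈0˘ : ∀ {x y} → x ≈ y → x - y ≈ 0#
  gap≈0˘ e = gap≈0 (sym e)

  _≈0+≈0_ : ∀ {x y} → x ≈ 0# → y ≈ 0# → x + y ≈ 0#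
  p ≈0+≈0 q = trans (+-cong p q) (+-identityˡ 0#)

  scale≈0 : ∀ n {x} → x ≈ 0# → fromℤ (+ n) * x ≈ 0#
  scale≈0 n p = trans (*-congˡ p) (zeroʳ _)

  by≈ : ∀ {x y d} → d ≈ 0# → y - x ≈ d → x ≈ y
  by≈ {x} {y} {d} p e = begin
    x            ≈⟨ +-identityˡ x ⟨
    0# + x       ≈⟨ +-congʳ p ⟨
    d + x        ≈⟨ +-congʳ e ⟨
    (y - x) + x  ≈⟨ solve 2 (λ y x → (y :- x) :+ x := y) refl y x ⟩
    y            ∎
    where open import Relation.Binary.Reasoning.Setoid setoid

  by< : ∀ {x y d} → 0# < d → y - x ≈ d → x < y
  by< 0<d e = ungap< (<-resp refl (sym e) 0<d)

  by≤ : ∀ {x y d} → 0# ≤ d → y - x ≈ d → x ≤ y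
  by≤ (inj₁ 0<d) e = inj₁ (by< 0<d e)
  by≤ (inj₂ 0≈d) e = inj₂ (by≈ (sym 0≈d) e)

  by<-scaled : ∀ n {x y d} → 0# < d → fromℤ (+ suc n) * (y - x) ≈ d → x < y
  by<-scaled n {x} {y} 0<d e with <-or-≥ x y
  ... | inj₁ x<y = x<y
  ... | inj₂ y≤x = ⊥-elim (<-irrefl (<-resp refl
                     (solve 3 (λ k x y → k :* (y :- x) :+ k :* (x :- y) := κ 0) refl (fromℤ (+ suc
                       n)) x y)
                     (<-resp refl (sym e) 0<d <+≤ scale≤ (suc n) (gap≤ y≤x))))

  by≤-scaled : ∀ n {x y d} → 0# ≤ d → fromℤ (+ suc n) * (y - x) ≈ d → x ≤ y
  by≤-scaled n {x} {y} 0≤d e with <-or-≥ y x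
  ... | inj₂ x≤y = x≤y
  ... | inj₁ y<x = ⊥-elim (<-irrefl (<-resp refl
                     (solve 3 (λ k x y → k :* (x :- y) :+ k :* (y :- x) := κ 0) refl (fromℤ (+ suc
                       n)) x y)
                     (scale< n (gap< y<x) <+≤ ≤-resp refl (sym e) 0≤d)))

  *-nonneg : ∀ {x y} → 0# ≤ x → 0# ≤ y → 0# ≤ x * y
  *-nonneg {x} {y} (inj₁ 0<x) (inj₁ 0<y) = inj₁ (*-pos x y 0<x 0<y)
  *-nonneg {x} {y} (inj₁ _)   (inj₂ 0≈y) = inj₂ (trans (sym (zeroʳ x)) (*-congˡ 0≈y))
  *-nonneg {x} {y} (inj₂ 0≈x) _          = inj₂ (trans (sym (zeroˡ y)) (*-congʳ 0≈x))

  0≤x² : ∀ x → 0# ≤ x * x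
  0≤x² x with ≤-total 0# x
  ... | inj₁ 0≤x = *-nonneg 0≤x 0≤x
  ... | inj₂ x≤0 = by≤ (*-nonneg (gap≤ x≤0) (gap≤ x≤0)) (solve 1 (λ a → a :* a :- κ 0 := (κ 0 :- a)
    :*
    (κ 0 :- a)) refl _)

  *-monoˡ-≤ : ∀ {x y} z → 0# ≤ z → x ≤ y → z * x ≤ z * y
  *-monoˡ-≤ {x} {y} z 0≤z x≤y = by≤ (*-nonneg 0≤z (gap≤ x≤y)) (solve 3 (λ a b c → a :* b :- a :* c
    :=
    a :* (b :- c)) refl _ _ _)

  *-monoʳ-≤ : ∀ {x y} z → 0# ≤ z → x ≤ y → x * z ≤ y * z
  *-monoʳ-≤ {x} {y} z 0≤z x≤y = by≤ (*-nonneg 0≤z (gap≤ x≤y)) (solve 3 (λ a b c → a :* b :- c :* b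
    :=
    b :* (a :- c)) refl _ _ _)

  *-mono-≤ : ∀ {x y z w} → 0# ≤ x → 0# ≤ z → x ≤ y → z ≤ w → x * z ≤ y * w
  *-mono-≤ {x} {y} {z} {w} 0≤x 0≤z x≤y z≤w =
    ≤-trans (*-monoˡ-≤ x 0≤x z≤w) (*-monoʳ-≤ w (≤-trans 0≤z z≤w) x≤y)

  *-monoˡ-< : ∀ {x y} z → 0# < z → x < y → z * x < z * y
  *-monoˡ-< {x} {y} z 0<z x<y = by< (*-pos z (y - x) 0<z (gap< x<y)) (solve 3 (λ a b c → a :* b :- a
    :* c := a :* (b :- c)) refl _ _ _)

  *-monoʳ-< : ∀ {x y} z → 0# < z → x < y → x * z < y * z
  *-monoʳ-< {x} {y} z 0<z x<y = by< (*-pos z (y - x) 0<z (gap< x<y)) (solve 3 (λ a b c → a :* b :- c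
    :* b := b :* (a :- c)) refl _ _ _)

  *-cancelˡ-≤ : ∀ {x y} z → 0# < z → z * x ≤ z * y → x ≤ y
  *-cancelˡ-≤ {x} {y} z 0<z h with <-or-≥ y x
  ... | inj₂ x≤y = x≤y
  ... | inj₁ y<x = ⊥-elim (<⇒≱ (*-monoˡ-< z 0<z y<x) h)

  *-cancelˡ-< : ∀ {x y} z → 0# ≤ z → z * x < z * y → x < y
  *-cancelˡ-< {x} {y} z 0≤z h with <-or-≥ x y
  ... | inj₁ x<y = x<y
  ... | inj₂ y≤x = ⊥-elim (<⇒≱ h (*-monoˡ-≤ z 0≤z y≤x))

  *-cancelˡ-≈ : ∀ {x y} z → ¬ (z ≈ 0#) → z * x ≈ z * y → x ≈ y
  *-cancelˡ-≈ {x} {y} z z≉0 h with w , zw≈1 ← inverse z z≉0 = begin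
    x            ≈⟨ *-identityˡ x ⟨
    1# * x       ≈⟨ *-congʳ zw≈1 ⟨
    (z * w) * x  ≈⟨ solve 3 (λ z w x → z :* w :* x := w :* (z :* x)) refl z w x ⟩
    w * (z * x)  ≈⟨ *-congˡ h ⟩
    w * (z * y)  ≈⟨ solve 3 (λ z w y → w :* (z :* y) := z :* w :* y) refl z w y ⟩
    (z * w) * y  ≈⟨ *-congʳ zw≈1 ⟩
    1# * y       ≈⟨ *-identityˡ y ⟩
    y            ∎
    where open import Relation.Binary.Reasoning.Setoid setoid

  -- Everything defined by `choose` enters the proof through this lemma: existence yields the
  -- characterizing property of the chosen element, and a uniqueness lemma such as `⁻¹-unique` or
  -- `exp-injective` then identifies its value.
  choose-satisfies : {A : Set} (P : A → Set) (d : A) → ∃ P → P (choose P d)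
  choose-satisfies P d ∃P with em {∃ P}
  ... | yes (_ , Pa) = Pa
  ... | no  ¬∃P      = ⊥-elim (¬∃P ∃P)

  <⇒≉ : ∀ {x y} → x < y → ¬ (y ≈ x)
  <⇒≉ x<y y≈x = <⇒≱ x<y (inj₂ y≈x)

  ⁻¹-inverseʳ : ∀ x → ¬ (x ≈ 0#) → x * x ⁻¹ ≈ 1#
  ⁻¹-inverseʳ x x≉0 = choose-satisfies (λ y → x * y ≈ 1#) 0# (inverse x x≉0)

  x*x⁻¹≈1 : ∀ {x} → 0# < x → x * x ⁻¹ ≈ 1#
  x*x⁻¹≈1 {x} 0<x = ⁻¹-inverseʳ x (<⇒≉ 0<x)

  ⁻¹-unique : ∀ {x y} → 0# < x → x * y ≈ 1# → y ≈ x ⁻¹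
  ⁻¹-unique {x} {y} 0<x xy≈1 = *-cancelˡ-≈ x (<⇒≉ 0<x) (trans xy≈1 (sym (x*x⁻¹≈1 0<x)))

  0<x⁻¹ : ∀ {x} → 0# < x → 0# < x ⁻¹
  0<x⁻¹ {x} 0<x = *-cancelˡ-< x (<⇒≤ 0<x) (<-resp (sym (zeroʳ x)) (sym (x*x⁻¹≈1 0<x)) 0<1)

  ⁻¹-cong : ∀ {x y} → 0# < x → x ≈ y → x ⁻¹ ≈ y ⁻¹
  ⁻¹-cong {x} {y} 0<x x≈y =
    sym (⁻¹-unique 0<x (trans (*-congʳ x≈y) (x*x⁻¹≈1 (<-resp refl x≈y 0<x))))

  ⁻¹-mono-≤ : ∀ {x y} → 0# < x → x ≤ y → y ⁻¹ ≤ x ⁻¹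
  ⁻¹-mono-≤ {x} {y} 0<x x≤y =
    *-cancelˡ-≤ x 0<x
      (*-cancelˡ-≤ y 0<y
        (by≤ (gap≤ (*-monoˡ-≤ x (<⇒≤ 0<x) (≈⇒≤ (x*x⁻¹≈1 0<y))) ≤+≤ gap≤ x≤y ≤+≤ gap≤ (*-monoˡ-≤ y
          (<⇒≤
          0<y) (≈⇒≤ (sym (x*x⁻¹≈1 0<x))))) (solve 4 (λ a b c d → a :* (b :* c) :- a :* (b :* d) := b
          :* κ 1 :- b :* (a :* d) :+ (a :- b :+ (a :* (b :* c) :- a :* κ 1))) refl _ _ _ _)))
    where 0<y = <-≤-trans 0<x x≤y

  *⁻¹ : ∀ {x y} → 0# < x → 0# < y → (x * y) ⁻¹ ≈ x ⁻¹ * y ⁻¹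
  *⁻¹ {x} {y} 0<x 0<y = sym (⁻¹-unique (*-pos x y 0<x 0<y) (begin
    x * y * (x ⁻¹ * y ⁻¹) ≈⟨ (solve 4 (λ a b c d → a :* b :* (c :* d) := a :* c :* (b :* d)) refl
      _ _ _ _) ⟩
    (x * x ⁻¹) * (y * y ⁻¹)    ≈⟨ *-cong (x*x⁻¹≈1 0<x) (x*x⁻¹≈1 0<y) ⟩
    1# * 1#                    ≈⟨ *-identityˡ 1# ⟩
    1#                         ∎))
    where open import Relation.Binary.Reasoning.Setoid setoid

  /-≤ : ∀ {x y z} → 0# < y → x ≤ z * y → x / y ≤ z
  /-≤ {x} {y} {z} 0<y h = *-cancelˡ-≤ y 0<y (by≤ (gap≈ (*-congˡ (x*x⁻¹≈1 0<y)) ≤+≤ gap≤ h) (solve 4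
    (λ
    a b c d → a :* b :- a :* (c :* d) := c :* κ 1 :- c :* (a :* d) :+ (b :* a :- c)) refl _ _ _ _))

  -- Absolute values.

  ∣∣-cases : ∀ x → (0# ≤ x × ∣ x ∣ℝ ≡ x) ⊎ (x < 0# × ∣ x ∣ℝ ≡ - x)
  ∣∣-cases x with <._<?_ x 0#
  ... | yes x<0 = inj₂ (x<0 , ≡.refl)
  ... | no  x≮0 = inj₁ (≮⇒≥ x≮0 , ≡.refl)

  ∣∣-upper : ∀ x → x ≤ ∣ x ∣ℝ
  ∣∣-upper x with ∣∣-cases x
  ... | inj₁ (_ , e) = ≈⇒≤ (reflexive (≡.sym e))
  ... | inj₂ (h , e) = by≤ (gap≈˘ (reflexive e) ≤+≤ scale≤ 2 (gap<⇒≤ h)) (solve 2 (λ a b → a :- b :=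
    a
    :- :- b :+ κ 2 :* (κ 0 :- b)) refl _ _)

  ∣∣-lower : ∀ x → - x ≤ ∣ x ∣ℝ
  ∣∣-lower x with ∣∣-cases x
  ... | inj₁ (h , e) = by≤ (gap≈˘ (reflexive e) ≤+≤ scale≤ 2 h) (solve 2 (λ a b → a :- :- b := a :-
    b
    :+ κ 2 :* b) refl _ _)
  ... | inj₂ (h , e) = ≈⇒≤ (reflexive (≡.sym e))

  ∣∣-≤ : ∀ {x b} → x ≤ b → - x ≤ b → ∣ x ∣ℝ ≤ b
  ∣∣-≤ {x} h k with ∣∣-cases x
  ... | inj₁ (_ , e) = ≡.subst (_≤ _) (≡.sym e) h
  ... | inj₂ (_ , e) = ≡.subst (_≤ _) (≡.sym e) k

  ∣∣-< : ∀ {x b} → x < b → - x < b → ∣ x ∣ℝ < b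
  ∣∣-< {x} h k with ∣∣-cases x
  ... | inj₁ (_ , e) = ≡.subst (_< _) (≡.sym e) h
  ... | inj₂ (_ , e) = ≡.subst (_< _) (≡.sym e) k

  0≤∣∣ : ∀ x → 0# ≤ ∣ x ∣ℝ
  0≤∣∣ x = by≤-scaled 1 (gap≤ (∣∣-upper x) ≤+≤ gap≤ (∣∣-lower x)) (solve 2 (λ a b → κ 2 :* (a :- κ
    0)
    := a :- b :+ (a :- :- b)) refl _ _)

  ∣∣-triangle : ∀ x y → ∣ x + y ∣ℝ ≤ ∣ x ∣ℝ + ∣ y ∣ℝ
  ∣∣-triangle x y = ∣∣-≤
    (by≤ (gap≤ (∣∣-upper x) ≤+≤ gap≤ (∣∣-upper y)) (solve 4 (λ a b c d → a :+ b :- (c :+ d) := a :-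
      c
      :+ (b :- d)) refl _ _ _ _))
    (by≤ (gap≤ (∣∣-lower x) ≤+≤ gap≤ (∣∣-lower y)) (solve 4 (λ a b c d → a :+ b :- :- (c :+ d) := a
      :-
      :- c :+ (b :- :- d)) refl _ _ _ _))

  ∣∣-cong : ∀ {x y} → x ≈ y → ∣ x ∣ℝ ≈ ∣ y ∣ℝ
  ∣∣-cong {x} {y} x≈y = ≤-antisym (half x≈y) (half (sym x≈y))
    where
    half : ∀ {x y} → x ≈ y → ∣ x ∣ℝ ≤ ∣ y ∣ℝ
    half {x} {y} x≈y = ∣∣-≤
      (by≤ (gap≈ x≈y ≤+≤ gap≤ (∣∣-upper y)) (solve 3 (λ a b c → a :- b := c :- b :+ (a :- c)) refl _
        _
        _))
      (by≤ (gap≈˘ x≈y ≤+≤ gap≤ (∣∣-lower y)) (solve 3 (λ a b c → a :- :- b := b :- c :+ (a :- :- c))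
        refl _ _ _))

  ∣∣-nonneg : ∀ {x} → 0# ≤ x → ∣ x ∣ℝ ≈ x
  ∣∣-nonneg {x} 0≤x = ≤-antisym (∣∣-≤ ≤-refl (by≤ (scale≤ 2 0≤x) (solve 1 (λ a → a :- :- a := κ 2 :*
    a) refl _))) (∣∣-upper x)

  ∣-∣ : ∀ x → ∣ - x ∣ℝ ≈ ∣ x ∣ℝ
  ∣-∣ x = ≤-antisym
    (∣∣-≤ (∣∣-lower x) (by≤ (gap≤ (∣∣-upper x)) (solve 2 (λ a b → a :- :- :- b := a :- b) refl _
      _)))
    (∣∣-≤ (by≤ (gap≤ (∣∣-lower (- x))) (solve 2 (λ a b → a :- b := a :- :- :- b) refl _ _))
      (∣∣-upper (- x)))

  ∣∣-* : ∀ x y → ∣ x * y ∣ℝ ≈ ∣ x ∣ℝ * ∣ y ∣ℝ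
  ∣∣-* x y with ∣∣-cases x | ∣∣-cases y
  ... | inj₁ (p , e) | inj₁ (q , f) rewrite e | f = ∣∣-nonneg (*-nonneg p q)
  ... | inj₁ (p , e) | inj₂ (q , f) rewrite e | f = trans (sym (∣-∣ _))
        (trans (∣∣-cong (solve 2 (λ a b → :- (a :* b) := a :* :- b) refl _ _)) (∣∣-nonneg (*-nonneg
          p (by≤
          (gap<⇒≤ q) (solve 1 (λ a → :- a :- κ 0 := κ 0 :- a) refl _)))))
  ... | inj₂ (p , e) | inj₁ (q , f) rewrite e | f = trans (sym (∣-∣ _))
        (trans (∣∣-cong (solve 2 (λ a b → :- (a :* b) := :- a :* b) refl _ _)) (∣∣-nonneg (*-nonneg
          (by≤
          (gap<⇒≤ p) (solve 1 (λ a → :- a :- κ 0 := κ 0 :- a) refl _)) q)))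
  ... | inj₂ (p , e) | inj₂ (q , f) rewrite e | f =
        trans (∣∣-cong (solve 2 (λ a b → a :* b := :- a :* :- b) refl _ _))
          (∣∣-nonneg (*-nonneg (by≤ (gap<⇒≤ p) (solve 1 (λ a → :- a :- κ 0 := κ 0 :- a) refl _))
            (by≤
            (gap<⇒≤ q) (solve 1 (λ a → :- a :- κ 0 := κ 0 :- a) refl _))))

  -- The natural numbers inside ℝ.

  0≤ι : ∀ n → 0# ≤ ι n
  0≤ι zero    = ≤-refl
  0≤ι (suc n) = <⇒≤ (0<ι-suc n)

  ι-+ : ∀ m n → ι (m ℕ.+ n) ≈ ι m + ι n
  ι-+ zero    n = sym (+-identityˡ _)
  ι-+ (suc m) n = trans (+-congˡ (ι-+ m n)) (sym (+-assoc _ _ _))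

  ι-* : ∀ m n → ι (m ℕ.* n) ≈ ι m * ι n
  ι-* zero    n = sym (zeroˡ _)
  ι-* (suc m) n = trans (ι-+ n (m ℕ.* n)) (trans (+-congˡ (ι-* m n))
    (solve 2 (λ a b → a :+ b :* a := (κ 1 :+ b) :* a) refl _ _))

  ι-mono-≤ : ∀ {m n} → m ℕ.≤ n → ι m ≤ ι n
  ι-mono-≤ {n = n} z≤n = 0≤ι n
  ι-mono-≤ {suc m} {suc n} (s≤s h) = by≤ (gap≤ (ι-mono-≤ h)) (solve 2 (λ a b → κ 1 :+ a :- (κ 1 :+
    b)
    := a :- b) refl _ _)

  ι-mono-< : ∀ {m n} → m ℕ.< n → ι m < ι n
  ι-mono-< {m} {n} h = <-≤-trans (by< 0<1 (solve 1 (λ a → κ 1 :+ a :- a := κ 1) refl _)) (ι-mono-≤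
    h)

  ι-cancel-< : ∀ {m n} → ι m < ι n → m ℕ.< n
  ι-cancel-< {m} {n} h with m ℕ.<? n
  ... | yes m<n = m<n
  ... | no  m≮n = ⊥-elim (<⇒≱ h (ι-mono-≤ (ℕ.≮⇒≥ m≮n)))

  0<ι : ∀ {n} → 1 ℕ.≤ n → 0# < ι n
  0<ι {suc n} _ = 0<ι-suc n

  -- The set of all ι n would otherwise have a least upper bound s, although
  -- s - 1 is not an upper bound.
  archimedean : ∀ x → ∃[ n ] x < ι n
  archimedean x with em {∃[ n ] x < ι n}
  ... | yes h = h
  ... | no ¬h with s , ub , least ← supremum (λ y → ∃[ n ] y ≈ ι n) (ι 0 , 0 , refl)
                   (x , λ { y (n , y≈ιn) → ≤-trans (≈⇒≤ y≈ιn) (≮⇒≥ (λ x<ιn → ¬h (n , x<ιn))) }) =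
    ⊥-elim (<⇒≱ (by< 0<1 (solve 1 (λ a → a :- (a :- κ 1) := κ 1) refl _)) (least (s - 1#) λ { y (n ,
      y≈ιn) →
      (by≤ (gap≈ y≈ιn ≤+≤ gap≤ (ub (ι (suc n)) (suc n , refl))) (solve 3 (λ a b c → a :- κ 1 :- b :=
        c
        :- b :+ (a :- (κ 1 :+ c))) refl _ _ _)) }))

  bounded-ℕ : ∀ x → ∃[ n ] x < ι (suc n)
  bounded-ℕ x with n , x<ιn ← archimedean x = n , (by< (gap< x<ιn <+≤ 0≤1) (solve 2 (λ a b → κ 1 :+
    a
    :- b := a :- b :+ κ 1) refl _ _))

  -- Finite sums.

  ∑< : ℕ → (ℕ → ℝ) → ℝ
  ∑< zero    f = 0#
  ∑< (suc n) f = ∑< n f + f n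

  ∑<-mono : ∀ n {f g} → (∀ i → i ℕ.< n → f i ≤ g i) → ∑< n f ≤ ∑< n g
  ∑<-mono zero    h = ≤-refl
  ∑<-mono (suc n) {f} {g} h = by≤ (gap≤ (∑<-mono n (λ i i<n → h i (ℕ.m<n⇒m<1+n i<n))) ≤+≤ gap≤ (h n
    ℕ.≤-refl)) (solve 4 (λ a b c d → a :+ b :- (c :+ d) := a :- c :+ (b :- d)) refl _ _ _ _)

  ∑<-cong : ∀ n {f g} → (∀ i → i ℕ.< n → f i ≈ g i) → ∑< n f ≈ ∑< n g
  ∑<-cong n h = ≤-antisym (∑<-mono n λ i i<n → ≈⇒≤ (h i i<n)) (∑<-mono n λ i i<n → ≈⇒≤ (sym (h i
    i<n)))

  ∑<-zero : ∀ n → ∑< n (λ _ → 0#) ≈ 0#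
  ∑<-zero zero    = refl
  ∑<-zero (suc n) = trans (+-identityʳ _) (∑<-zero n)

  ∑<-nonneg : ∀ n {f} → (∀ i → i ℕ.< n → 0# ≤ f i) → 0# ≤ ∑< n f
  ∑<-nonneg n h = ≤-resp (∑<-zero n) refl (∑<-mono n h)

  ∑<-+ : ∀ n f g → ∑< n (λ i → f i + g i) ≈ ∑< n f + ∑< n g
  ∑<-+ zero    f g = solve 1 (λ a → κ 0 := κ 0 :+ κ 0) refl 0#
  ∑<-+ (suc n) f g = by≈ (gap≈0 (∑<-+ n f g)) (solve 5 (λ a b c d e → a :+ b :+ (c :+ d) :- (e :+ (b
    :+ d)) := a :+ c :- e) refl _ _ _ _ _)

  ∑<-*ˡ : ∀ n c f → ∑< n (λ i → c * f i) ≈ c * ∑< n f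
  ∑<-*ˡ zero    c f = sym (zeroʳ c)
  ∑<-*ˡ (suc n) c f = by≈ (gap≈0 (∑<-*ˡ n c f)) (solve 4 (λ a b c d → a :* (b :+ c) :- (d :+ a :* c)
    := a :* b :- d) refl _ _ _ _)

  ∑<-neg : ∀ n f → ∑< n (λ i → - f i) ≈ - ∑< n f
  ∑<-neg zero    f = solve 1 (λ a → κ 0 := :- κ 0) refl 0#
  ∑<-neg (suc n) f = by≈ (gap≈0 (∑<-neg n f)) (solve 3 (λ a b c → :- (a :+ b) :- (c :+ :- b) := :- a
    :- c) refl _ _ _)

  ∑<-head : ∀ n f → ∑< (suc n) f ≈ f 0 + ∑< n (λ i → f (suc i))
  ∑<-head zero    f = +-comm _ _
  ∑<-head (suc n) f = by≈ (gap≈0 (∑<-head n f)) (solve 4 (λ a b c d → a :+ (b :+ c) :- (d :+ c) := a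
    :+ b :- d) refl _ _ _ _)

  ∑<-split : ∀ m n f → ∑< (m ℕ.+ n) f ≈ ∑< m f + ∑< n (λ i → f (m ℕ.+ i))
  ∑<-split m zero    f rewrite ℕ.+-identityʳ m = sym (+-identityʳ _)
  ∑<-split m (suc n) f rewrite ℕ.+-suc m n = by≈ (gap≈0 (∑<-split m n f)) (solve 4 (λ a b c d → a
    :+ (b :+ c) :- (d :+ c) := a :+ b :- d) refl _ _ _ _)

  ∑<-swap : ∀ m n (f : ℕ → ℕ → ℝ) →
            ∑< m (λ i → ∑< n (λ j → f i j)) ≈ ∑< n (λ j → ∑< m (λ i → f i j))
  ∑<-swap zero    n f = sym (∑<-zero n)
  ∑<-swap (suc m) n f = trans (+-congʳ (∑<-swap m n f)) (sym (∑<-+ n (λ j → ∑< m (λ i → f i j)) (f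
    m)))

  ∑<-monoˡ : ∀ {m n} f → (∀ i → 0# ≤ f i) → m ℕ.≤ n → ∑< m f ≤ ∑< n f
  ∑<-monoˡ {m} f 0≤f m≤n with k , ≡.refl ← ℕ.m≤n⇒∃[o]m+o≡n m≤n =
    (by≤ (gap≈˘ (∑<-split m k f) ≤+≤ ∑<-nonneg k (λ i _ → 0≤f (m ℕ.+ i))) (solve 3 (λ a b c → a :- b
      := a :- (b :+ c) :+ c) refl _ _ _))

  ∣∑<∣ : ∀ n f → ∣ ∑< n f ∣ℝ ≤ ∑< n (λ i → ∣ f i ∣ℝ)
  ∣∑<∣ zero    f = ≈⇒≤ (∣∣-nonneg ≤-refl)
  ∣∑<∣ (suc n) f = ≤-trans (∣∣-triangle _ _)
    (by≤ (gap≤ (∣∑<∣ n f)) (solve 3 (λ a b c → a :+ b :- (c :+ b) := a :- c) refl _ _ _))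

  ∣∑<-∑<∣ : ∀ {m n} f → m ℕ.≤ n →
            ∣ ∑< n f - ∑< m f ∣ℝ ≤ ∑< n (λ i → ∣ f i ∣ℝ) - ∑< m (λ i → ∣ f i ∣ℝ)
  ∣∑<-∑<∣ {m} f m≤n with k , ≡.refl ← ℕ.m≤n⇒∃[o]m+o≡n m≤n = ≤-trans
    (≈⇒≤ (∣∣-cong (by≈ (gap≈0 (∑<-split m k f)) (solve 3 (λ a b c → a :- (b :- c) := c :+ a :- b)
      refl
      _ _ _))))
    (≤-trans (∣∑<∣ k _)
    (by≤ (gap≈˘ (∑<-split m k (λ i → ∣ f i ∣ℝ))) (solve 3 (λ a b c → a :- b :- c := a :- (b :+ c))
      refl _ _ _)))

  -- Limits of real sequences.

  infix 4 _⇢_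
  _⇢_ : (ℕ → ℝ) → ℝ → Set
  u ⇢ l = ∀ ε → 0# < ε → ∃[ N ] ∀ n → N ℕ.≤ n → ∣ u n - l ∣ℝ < ε

  ⇢-≤ : ∀ {u v l m} N → (∀ n → N ℕ.≤ n → u n ≤ v n) → u ⇢ l → v ⇢ m → l ≤ m
  ⇢-≤ {u} {v} {l} {m} N u≤v u⇢l v⇢m with <-or-≥ m l
  ... | inj₂ l≤m = l≤m
  ... | inj₁ m<l = ⊥-elim (<-irrefl (by<-scaled 1 (gap< (≤-<-trans (∣∣-lower (u n - l)) (hM n
    (ℕ.m≤n⊔m
    N M ⟨≤⟩ ℕ.m≤m⊔n (N ℕ.⊔ M) K))) <+≤ gap<⇒≤ (≤-<-trans (∣∣-upper (v n - m)) (hK n (ℕ.m≤n⊔m (N ℕ.⊔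
      M)
    K))) ≤+≤ gap≤ (u≤v n (ℕ.m≤m⊔n N M ⟨≤⟩ ℕ.m≤m⊔n (N ℕ.⊔ M) K)) ≤+≤ gap≈ (*-congˡ (x*x⁻¹≈1 (0<ι-suc
    1)))) (solve 5 (λ a b c d e → κ 2 :* (κ 0 :- κ 0) := (a :- b) :* c :- :- (d :- a) :+ ((a :- b)
      :*
    c :- (e :- b) :+ (e :- d :+ ((a :- b) :* κ 1 :- (a :- b) :* (κ 2 :* c))))) refl _ _ _ _ _)))
    where
    infixl 5 _⟨≤⟩_
    _⟨≤⟩_ = ℕ.≤-trans
    ε = (l - m) * ι 2 ⁻¹
    0<ε : 0# < ε
    0<ε = *-pos _ _ (gap< m<l) (0<x⁻¹ (0<ι-suc 1))
    M = proj₁ (u⇢l ε 0<ε)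
    hM = proj₂ (u⇢l ε 0<ε)
    K = proj₁ (v⇢m ε 0<ε)
    hK = proj₂ (v⇢m ε 0<ε)
    n = N ℕ.⊔ M ℕ.⊔ K

  ⇢-const : ∀ c → (λ _ → c) ⇢ c
  ⇢-const c ε 0<ε = 0 , λ _ _ → ≤-<-trans (≈⇒≤ (trans (∣∣-cong (-‿inverseʳ c)) (∣∣-nonneg ≤-refl)))
    0<ε

  ⇢-unique : ∀ {u l m} → u ⇢ l → u ⇢ m → l ≈ m
  ⇢-unique u⇢l u⇢m = ≤-antisym (⇢-≤ 0 (λ _ _ → ≤-refl) u⇢l u⇢m) (⇢-≤ 0 (λ _ _ → ≤-refl) u⇢m u⇢l)

  ⇢-cong : ∀ {u v l} → (∀ n → u n ≈ v n) → u ⇢ l → v ⇢ l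
  ⇢-cong u≈v u⇢l ε 0<ε with N , h ← u⇢l ε 0<ε =
    N , λ n N≤n → ≤-<-trans (≈⇒≤ (∣∣-cong (+-congʳ (sym (u≈v n))))) (h n N≤n)

  ⇢-+ : ∀ {u v l m} → u ⇢ l → v ⇢ m → (λ n → u n + v n) ⇢ l + m
  ⇢-+ {u} {v} {l} {m} u⇢l v⇢m ε 0<ε with N , h ← u⇢l (ε * ι 2 ⁻¹) (*-pos _ _ 0<ε (0<x⁻¹ (0<ι-suc
    1)))
                                       | M , k ← v⇢m (ε * ι 2 ⁻¹) (*-pos _ _ 0<ε (0<x⁻¹ (0<ι-suc
                                         1))) =
    N ℕ.⊔ M , λ n N⊔M≤n → ≤-<-trans
      (≤-trans (≈⇒≤ (∣∣-cong (solve 4 (λ a b c d → a :+ b :- (c :+ d) := a :- c :+ (b :- d)) refl _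
        _
        _ _))) (∣∣-triangle _ _))
      (by< (gap< (h n (ℕ.≤-trans (ℕ.m≤m⊔n N M) N⊔M≤n)) <+≤ gap<⇒≤ (k n (ℕ.≤-trans (ℕ.m≤n⊔m N M)
        N⊔M≤n)) ≤+≤ gap≈ (*-congˡ (x*x⁻¹≈1 (0<ι-suc 1)))) (solve 4 (λ a b c d → a :- (b :+ c) := a
          :*
        d :- b :+ (a :* d :- c :+ (a :* κ 1 :- a :* (κ 2 :* d)))) refl _ _ _ _))

  ⇢-neg : ∀ {u l} → u ⇢ l → (λ n → - u n) ⇢ - l
  ⇢-neg {u} {l} u⇢l ε 0<ε with N , h ← u⇢l ε 0<ε =
    N , λ n N≤n → ≤-<-trans (≈⇒≤ (trans (∣∣-cong (solve 2 (λ a b → :- a :- :- b := :- (a :- b)) refl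
      _
      _)) (∣-∣ _))) (h n N≤n)

  ⇢-* : ∀ {u v l m} → u ⇢ l → v ⇢ m → (λ n → u n * v n) ⇢ l * m
  ⇢-* {u} {v} {l} {m} u⇢l v⇢m ε 0<ε = N ℕ.⊔ M , λ n N⊔M≤n → bound n
      (h n (ℕ.≤-trans (ℕ.m≤m⊔n N M) N⊔M≤n)) (k n (ℕ.≤-trans (ℕ.m≤n⊔m N M) N⊔M≤n))
    where
    K = 1# + ∣ l ∣ℝ + ∣ m ∣ℝ
    0<K+ε : 0# < K + ε
    0<K+ε = by< (0<ε <+≤ 0≤∣∣ l ≤+≤ 0≤∣∣ m ≤+≤ 0≤1) (solve 3 (λ a b c → κ 1 :+ a :+ b :+ c :- κ 0 :=
      c
      :+ (a :+ (b :+ κ 1))) refl _ _ _)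
    -- With K = 1 + |l| + |m| this choice gives both η ≤ 1 and ηK = ε - ηε < ε; the product of the
    -- two errors is then at most η, and the total at most ηK.
    η = ε * (K + ε) ⁻¹
    0<η : 0# < η
    0<η = *-pos _ _ 0<ε (0<x⁻¹ 0<K+ε)
    η*[K+ε]≈ε : η * (K + ε) ≈ ε
    η*[K+ε]≈ε = trans (solve 3 (λ a b c → a :* b :* (c :+ a) := a :* ((c :+ a) :* b)) refl _ _ _)
                (trans (*-congˡ (x*x⁻¹≈1 0<K+ε)) (*-identityʳ ε))
    η≤1 : η ≤ 1#
    η≤1 = /-≤ 0<K+ε (by≤ (0≤∣∣ l ≤+≤ 0≤∣∣ m ≤+≤ 0≤1) (solve 3 (λ a b c → κ 1 :* (κ 1 :+ a :+ b :+ c)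
      :- c := a :+ (b :+ κ 1)) refl _ _ _))
    N = proj₁ (u⇢l η 0<η)
    h = proj₂ (u⇢l η 0<η)
    M = proj₁ (v⇢m η 0<η)
    k = proj₂ (v⇢m η 0<η)
    bound : ∀ n → ∣ u n - l ∣ℝ < η → ∣ v n - m ∣ℝ < η → ∣ u n * v n - l * m ∣ℝ < ε
    bound n p q = begin-strict
      ∣ u n * v n - l * m ∣ℝ
        ≈⟨ ∣∣-cong (solve 4 (λ a b c d → a :* b :- c :* d := (a :- c) :* (b :- d) :+ (c :* (b :- d)
          :+
          d :* (a :- c))) refl _ _ _ _) ⟩
      ∣ (u n - l) * (v n - m) + (l * (v n - m) + m * (u n - l)) ∣ℝ
        ≤⟨ ∣∣-triangle _ _ ⟩
      ∣ (u n - l) * (v n - m) ∣ℝ + ∣ l * (v n - m) + m * (u n - l) ∣ℝ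
        ≤⟨ ≤-trans (≈⇒≤ (+-comm _ _)) (≤-trans (+≤ (∣∣-triangle _ _)) (≈⇒≤ (+-comm _ _))) ⟩
      ∣ (u n - l) * (v n - m) ∣ℝ + (∣ l * (v n - m) ∣ℝ + ∣ m * (u n - l) ∣ℝ)
        ≈⟨ +-cong (∣∣-* _ _) (+-cong (∣∣-* _ _) (∣∣-* _ _)) ⟩
      ∣ u n - l ∣ℝ * ∣ v n - m ∣ℝ + (∣ l ∣ℝ * ∣ v n - m ∣ℝ + ∣ m ∣ℝ * ∣ u n - l ∣ℝ)
        <⟨ (by< (*-pos η ε 0<η 0<ε <+≤ gap≤ (*-mono-≤ (0≤∣∣ (u n - l)) (0≤∣∣ (v n - m)) (<⇒≤ p)
          (≤-trans (<⇒≤ q) η≤1)) ≤+≤ gap≤ (*-monoˡ-≤ ∣ l ∣ℝ (0≤∣∣ l) (<⇒≤ q)) ≤+≤ gap≤ (*-monoˡ-≤ ∣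
            m
          ∣ℝ (0≤∣∣ m) (<⇒≤ p)) ≤+≤ gap≈ η*[K+ε]≈ε) (solve 6 (λ a b c d e f → a :- (b :* c :+ (d :* c
          :+ e :* b)) := f :* a :+ (f :* κ 1 :- b :* c :+ (d :* f :- d :* c :+ (e :* f :- e :* b :+
            (a
          :- f :* (κ 1 :+ d :+ e :+ a)))))) refl _ _ _ _ _ _)) ⟩
      ε ∎
      where
      open ≤-Reasoning
      +≤ : ∀ {x y z} → x ≤ y → x + z ≤ y + z
      +≤ {x} {y} {z} x≤y = by≤ (gap≤ x≤y) (solve 3 (λ a b c → a :+ b :- (c :+ b) := a :- c) refl _ _
        _)

  ⇢-subsequence : ∀ {u l} (k : ℕ → ℕ) → (∀ n → n ℕ.≤ k n) → u ⇢ l → (λ n → u (k n)) ⇢ l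
  ⇢-subsequence k n≤k u⇢l ε 0<ε with N , h ← u⇢l ε 0<ε = N , λ n N≤n → h (k n) (ℕ.≤-trans N≤n (n≤k
    n))

  ⇢-squeeze : ∀ {u v w l} → (∀ n → ∣ u n - v n ∣ℝ ≤ w n) → w ⇢ 0# → v ⇢ l → u ⇢ l
  ⇢-squeeze {u} {v} {w} {l} h w⇢0 v⇢l = ⇢-cong (λ n → (solve 2 (λ a b → a :- b :+ b := a) refl _ _))
    (λ ε 0<ε → let N , k = ⇢-+ u-v⇢0 v⇢l ε 0<ε in N , λ n N≤n →
       ≤-<-trans (≈⇒≤ (∣∣-cong (+-congˡ (-‿cong (sym (+-identityˡ l)))))) (k n N≤n))
    where
    u-v⇢0 : (λ n → u n - v n) ⇢ 0#
    u-v⇢0 ε 0<ε with N , k ← w⇢0 ε 0<ε = N , λ n N≤n → ≤-<-trans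
      (≈⇒≤ (∣∣-cong (solve 2 (λ a b → a :- b :- κ 0 := a :- b) refl _ _)))
      (by< (gap< (≤-<-trans (∣∣-upper (w n - 0#)) (k n N≤n)) <+≤ gap≤ (h n)) (solve 3 (λ a b c → a
        :-
        b := a :- (c :- κ 0) :+ (c :- b)) refl _ _ _))

  monotone-mono : ∀ {u : ℕ → ℝ} → (∀ n → u n ≤ u (suc n)) → ∀ {m n} → m ℕ.≤ n → u m ≤ u n
  monotone-mono {u} h {m} m≤n with k , ≡.refl ← ℕ.m≤n⇒∃[o]m+o≡n m≤n = go k
    where
    go : ∀ k → u m ≤ u (m ℕ.+ k)
    go zero    rewrite ℕ.+-identityʳ m = ≤-refl
    go (suc k) rewrite ℕ.+-suc m k     = ≤-trans (go k) (h _)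

  monotone-converges : ∀ {u b} → (∀ n → u n ≤ u (suc n)) → (∀ n → u n ≤ b) → ∃[ l ] u ⇢ l
  monotone-converges {u} {b} mono u≤b
    with s , ub , least ← supremum (λ y → ∃[ n ] y ≈ u n) (u 0 , 0 , refl)
                            (b , λ { y (n , y≈un) → ≤-trans (≈⇒≤ y≈un) (u≤b n) }) = s , u⇢s
    where
    u⇢s : u ⇢ s
    u⇢s ε 0<ε with em {∃[ n ] s - ε < u n}
    ... | yes (N , h) = N , λ n N≤n → ∣∣-<
      (by< (0<ε <+≤ gap≤ (ub (u n) (n , refl))) (solve 3 (λ a b c → a :- (b :- c) := a :+ (c :- b))
        refl _ _ _))
      (by< (gap< h <+≤ gap≤ (monotone-mono mono N≤n)) (solve 4 (λ a b c d → a :- :- (b :- c) := d :-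
        (c :- a) :+ (b :- d)) refl _ _ _ _))
    ... | no ¬h = ⊥-elim (<⇒≱ (by< 0<ε (solve 2 (λ a b → a :- (a :- b) := b) refl _ _))
      (least (s - ε) λ { y (n , y≈un) → ≤-trans (≈⇒≤ y≈un) (≮⇒≥ λ p → ¬h (n , p)) }))

  -- Σ a = Σ (∣a∣ + a) - Σ ∣a∣, where both series on the right have nonnegative
  -- terms.
  absolutely-convergent : ∀ {a b} → (∀ n → ∑< n (λ i → ∣ a i ∣ℝ) ≤ b) → ∃[ l ] (λ n → ∑< n a) ⇢ l
  absolutely-convergent {a} {b} bound = l₁ + - l₂ ,
    ⇢-cong (λ n → (by≈ (gap≈0 (∑<-+ n (λ i → ∣ a i ∣ℝ) a)) (solve 3 (λ a b c → a :- (b :+ :- c) := c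
      :+ a :- b) refl _ _ _)))
      (⇢-+ {λ n → ∑< n (λ i → ∣ a i ∣ℝ + a i)} h₁ (⇢-neg h₂))
    where
    step : ∀ f → (∀ i → 0# ≤ f i) → ∀ n → ∑< n f ≤ ∑< (suc n) f
    step f 0≤f n = by≤ (0≤f n) (solve 2 (λ a b → a :+ b :- a := b) refl _ _)
    0≤∣a∣+a : ∀ i → 0# ≤ ∣ a i ∣ℝ + a i
    0≤∣a∣+a i = by≤ (gap≤ (∣∣-lower (a i))) (solve 2 (λ a b → a :+ b :- κ 0 := a :- :- b) refl _ _)
    c₁ = monotone-converges {b = b + b} (step (λ i → ∣ a i ∣ℝ + a i) 0≤∣a∣+a) λ n →
      (by≤ (gap≈ (∑<-+ n (λ i → ∣ a i ∣ℝ) a) ≤+≤ gap≤ (∑<-mono n (λ i _ → ∣∣-upper (a i))) ≤+≤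
        scale≤
        2 (gap≤ (bound n))) (solve 4 (λ a b c d → a :+ a :- b := c :+ d :- b :+ (c :- d :+ κ 2 :* (a
        :- c))) refl _ _ _ _))
    c₂ = monotone-converges (step (λ i → ∣ a i ∣ℝ) (λ i → 0≤∣∣ (a i))) bound
    l₁ = proj₁ c₁
    h₁ = proj₂ c₁
    l₂ = proj₁ c₂
    h₂ = proj₂ c₂

  -- The real exponential function.

  -- The recursive form of xⁿ/n! supplies the ratio of consecutive terms; `term-factorial`
  -- identifies it with the summand in the definition of `exp`.
  term : ℝ → ℕ → ℝ
  term x zero    = 1#
  term x (suc n) = term x n * x * ι (suc n) ⁻¹

  term-suc : ∀ x n → ι (suc n) * term x (suc n) ≈ x * term x n
  term-suc x n = by≈ (gap≈0 (*-congˡ (x*x⁻¹≈1 (0<ι-suc n)))) (solve 4 (λ a b c d → a :* b :- (κ 1 :+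
    c) :* (b :* a :* d) := a :* b :* κ 1 :- a :* b :* ((κ 1 :+ c) :* d)) refl _ _ _ _)

  term-cong : ∀ {x y} n → x ≈ y → term x n ≈ term y n
  term-cong zero    x≈y = refl
  term-cong (suc n) x≈y = *-congʳ (*-cong (term-cong n x≈y) x≈y)

  term-nonneg : ∀ {x} n → 0# ≤ x → 0# ≤ term x n
  term-nonneg zero    0≤x = 0≤1
  term-nonneg (suc n) 0≤x = *-nonneg (*-nonneg (term-nonneg n 0≤x) 0≤x) (<⇒≤ (0<x⁻¹ (0<ι-suc n)))

  ∣term∣ : ∀ x n → ∣ term x n ∣ℝ ≈ term ∣ x ∣ℝ n
  ∣term∣ x zero    = ∣∣-nonneg 0≤1
  ∣term∣ x (suc n) = trans (∣∣-* _ _) (*-cong (trans (∣∣-* _ _) (*-congʳ (∣term∣ x n)))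
                       (∣∣-nonneg (<⇒≤ (0<x⁻¹ (0<ι-suc n)))))

  partialExp : ℝ → ℕ → ℝ
  partialExp x n = ∑< n (term x)

  -- From n = m on each term is at most half its predecessor, so
  -- partialExp x n + 2 term x n decreases.
  partialExp-tail : ∀ {x} m → 0# ≤ x → x + x ≤ ι (suc m) → ∀ k →
    partialExp x (m ℕ.+ k) + ι 2 * term x (m ℕ.+ k) ≤ partialExp x m + ι 2 * term x m
  partialExp-tail m 0≤x 2x≤m zero rewrite ℕ.+-identityʳ m = ≤-refl
  partialExp-tail {x} m 0≤x 2x≤m (suc k) rewrite ℕ.+-suc m k = ≤-trans
    (by≤ (gap≤ halves) (solve 3 (λ a b c → a :+ κ 2 :* b :- (a :+ b :+ κ 2 :* c) := b :- (c :+ c))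
      refl _ _ _))
    (partialExp-tail m 0≤x 2x≤m k)
    where
    n = m ℕ.+ k
    halves : term x (suc n) + term x (suc n) ≤ term x n
    halves = *-cancelˡ-≤ (ι (suc n)) (0<ι-suc n)
      (by≤ (scale≤ 2 (gap≈ (term-suc x n)) ≤+≤ gap≤ (*-monoʳ-≤ (term x n) (term-nonneg n 0≤x)
        (≤-trans
        2x≤m (ι-mono-≤ (s≤s (ℕ.m≤m+n m k)))))) (solve 4 (λ a b c d → (κ 1 :+ a) :* b :- (κ 1 :+ a)
          :*
        (c :+ c) := κ 2 :* (d :* b :- (κ 1 :+ a) :* c) :+ ((κ 1 :+ a) :* b :- (d :+ d) :* b)) refl _
          _
        _ _))

  partialExp-mono : ∀ {x m n} → 0# ≤ x → m ℕ.≤ n → partialExp x m ≤ partialExp x n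
  partialExp-mono {x} 0≤x = ∑<-monoˡ (term x) (λ i → term-nonneg i 0≤x)

  partialExp-bounded : ∀ {x} → 0# ≤ x → ∃[ b ] ∀ n → partialExp x n ≤ b
  partialExp-bounded {x} 0≤x with m , h ← bounded-ℕ (x + x) = partialExp x m + ι 2 * term x m , λ n
    →
    ≤-trans (partialExp-mono 0≤x (ℕ.m≤n+m n m))
      (by≤ (gap≤ (partialExp-tail m 0≤x (<⇒≤ h) n) ≤+≤ scale≤ 2 (term-nonneg (m ℕ.+ n) 0≤x)) (solve
        4
        (λ a b c d → a :+ κ 2 :* b :- c := a :+ κ 2 :* b :- (c :+ κ 2 :* d) :+ κ 2 :* d) refl _ _ _
        _))

  partialExp-∣∣ : ∀ x n → ∑< n (λ i → ∣ term x i ∣ℝ) ≈ partialExp ∣ x ∣ℝ n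
  partialExp-∣∣ x n = ∑<-cong n (λ i _ → ∣term∣ x i)

  abstract
    partialExp-converges : ∀ x → ∃[ l ] partialExp x ⇢ l
    partialExp-converges x = let b , h = partialExp-bounded (0≤∣∣ x) in
      absolutely-convergent {term x} {b} (λ n → ≤-trans (≈⇒≤ (partialExp-∣∣ x n)) (h n))

  expℝ : ℝ → ℝ
  expℝ x = proj₁ (partialExp-converges x)

  partialExp⇢exp : ∀ x → partialExp x ⇢ expℝ x
  partialExp⇢exp x = proj₂ (partialExp-converges x)

  exp-cong : ∀ {x y} → x ≈ y → expℝ x ≈ expℝ y
  exp-cong {x} {y} x≈y = ⇢-unique (⇢-cong (λ n → ∑<-cong n (λ i _ → term-cong i x≈y))
    (partialExp⇢exp x)) (partialExp⇢exp y)

  convolution : (ℕ → ℝ) → (ℕ → ℝ) → ℕ → ℝ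
  convolution a b n = ∑< (suc n) (λ i → a i * b (n ℕ.∸ i))

  -- The binomial theorem divided by n!. Multiply by n + 1 = i + (n + 1 - i) inside the sum: the
  -- part with i lowers the index of the x-term and the part with n + 1 - i that of the y-term, so
  -- the convolution obeys the recursion of `term (x + y)`.
  convolution-term : ∀ x y n → convolution (term x) (term y) n ≈ term (x + y) n
  convolution-term x y zero    = solve 1 (λ a → κ 0 :+ κ 1 :* κ 1 := κ 1) refl 0#
  convolution-term x y (suc n) = *-cancelˡ-≈ (ι (suc n)) (<⇒≉ (0<ι-suc n)) (begin
    ι (suc n) * convolution (term x) (term y) (suc n)
      ≈⟨ ∑<-*ˡ (suc (suc n)) (ι (suc n)) (λ i → term x i * term y (suc n ℕ.∸ i)) ⟨
    ∑< (suc (suc n)) (λ i → ι (suc n) * (term x i * term y (suc n ℕ.∸ i)))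
      ≈⟨ ∑<-cong (suc (suc n)) split ⟩
    ∑< (suc (suc n)) (λ i → f i + g i)
      ≈⟨ ∑<-+ (suc (suc n)) f g ⟩
    ∑< (suc (suc n)) f + (∑< (suc n) g + g (suc n))
      ≈⟨ +-cong (∑<-head (suc n) f) (+-congˡ g-last) ⟩
    (f 0 + ∑< (suc n) (λ i → f (suc i))) + (∑< (suc n) g + 0#)
      ≈⟨ +-cong (+-cong (zeroˡ _) (∑<-cong (suc n) f-suc)) (+-congʳ (∑<-cong (suc n) g-init)) ⟩
    (0# + ∑< (suc n) (λ i → x * (term x i * term y (n ℕ.∸ i)))) + (∑< (suc n) (λ i → y * (term x i *
      term y (n ℕ.∸ i))) + 0#)
      ≈⟨ +-cong (+-congˡ (∑<-*ˡ (suc n) x c)) (+-congʳ (∑<-*ˡ (suc n) y c)) ⟩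
    (0# + x * ∑< (suc n) c) + (y * ∑< (suc n) c + 0#)
      ≈⟨ (solve 3 (λ a b c → κ 0 :+ a :* b :+ (c :* b :+ κ 0) := (a :+ c) :* b) refl _ _ _) ⟩
    (x + y) * convolution (term x) (term y) n
      ≈⟨ *-congˡ (convolution-term x y n) ⟩
    (x + y) * term (x + y) n
      ≈⟨ term-suc (x + y) n ⟨
    ι (suc n) * term (x + y) (suc n) ∎)
    where
    open import Relation.Binary.Reasoning.Setoid setoid
    c f g : ℕ → ℝ
    c i = term x i * term y (n ℕ.∸ i)
    f i = ι i * (term x i * term y (suc n ℕ.∸ i))
    g i = ι (suc n ℕ.∸ i) * (term x i * term y (suc n ℕ.∸ i))
    split : ∀ i → i ℕ.< suc (suc n) → ι (suc n) * (term x i * term y (suc n ℕ.∸ i)) ≈ f i + g i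
    split i (s≤s i≤n) = trans (*-congʳ (trans (reflexive (≡.cong ι (≡.sym (ℕ.m+[n∸m]≡n i≤n)))) (ι-+
      i (suc n ℕ.∸ i))))
      (distribʳ _ _ _)
    g-last : g (suc n) ≈ 0#
    g-last rewrite ℕ.n∸n≡0 n = zeroˡ _
    f-suc : ∀ i → i ℕ.< suc n → f (suc i) ≈ x * (term x i * term y (n ℕ.∸ i))
    f-suc i _ = by≈ (gap≈0 (*-congʳ (term-suc x i))) (solve 5 (λ a b c d e → a :* (b :* c) :- (κ 1
      :+
      d) :* (e :* c) := a :* b :* c :- (κ 1 :+ d) :* e :* c) refl _ _ _ _ _)
    g-init : ∀ i → i ℕ.< suc n → g i ≈ y * (term x i * term y (n ℕ.∸ i))
    g-init i (s≤s i≤n) rewrite ℕ.+-∸-assoc 1 i≤n =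
      (by≈ (gap≈0 (*-congˡ (term-suc y (n ℕ.∸ i)))) (solve 5 (λ a b c d e → a :* (b :* c) :- (κ 1 :+
        d) :* (b :* e) := b :* (a :* c) :- b :* ((κ 1 :+ d) :* e)) refl _ _ _ _ _))

  -- The triangle i + j < n, summed by diagonals on the left and by rows on the right.
  ∑<-convolution : ∀ a b n → ∑< n (convolution a b) ≈ ∑< n (λ i → a i * ∑< (n ℕ.∸ i) b)
  ∑<-convolution a b zero    = refl
  ∑<-convolution a b (suc n) = begin
    ∑< n (convolution a b) + (∑< n (λ i → a i * b (n ℕ.∸ i)) + a n * b (n ℕ.∸ n))
      ≈⟨ +-cong (∑<-convolution a b n) (+-congˡ last) ⟩
    ∑< n (λ i → a i * ∑< (n ℕ.∸ i) b) + (∑< n (λ i → a i * b (n ℕ.∸ i)) + a n * ∑< (suc n ℕ.∸ n) b)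
      ≈⟨ +-assoc _ _ _ ⟨
    ∑< n (λ i → a i * ∑< (n ℕ.∸ i) b) + ∑< n (λ i → a i * b (n ℕ.∸ i)) + a n * ∑< (suc n ℕ.∸ n) b
      ≈⟨ +-congʳ (∑<-+ n (λ i → a i * ∑< (n ℕ.∸ i) b) (λ i → a i * b (n ℕ.∸ i))) ⟨
    ∑< n (λ i → a i * ∑< (n ℕ.∸ i) b + a i * b (n ℕ.∸ i)) + a n * ∑< (suc n ℕ.∸ n) b
      ≈⟨ +-congʳ (∑<-cong n init) ⟩
    ∑< n (λ i → a i * ∑< (suc n ℕ.∸ i) b) + a n * ∑< (suc n ℕ.∸ n) b ∎
    where
    open import Relation.Binary.Reasoning.Setoid setoid
    last : a n * b (n ℕ.∸ n) ≈ a n * ∑< (suc n ℕ.∸ n) b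
    last rewrite ℕ.m+n∸n≡m 1 n | ℕ.n∸n≡0 n = *-congˡ (sym (+-identityˡ (b 0)))
    init : ∀ i → i ℕ.< n → a i * ∑< (n ℕ.∸ i) b + a i * b (n ℕ.∸ i) ≈ a i * ∑< (suc n ℕ.∸ i) b
    init i i<n rewrite ℕ.+-∸-assoc 1 (ℕ.<⇒≤ i<n) = sym (distribˡ (a i) _ _)

  -- The pairs (i , j) with i, j < 2m and i + j ≥ 2m lie outside the square i, j < m.
  cauchy-product-bound : ∀ a b m → let n = m ℕ.+ m ; A = λ k → ∑< k (λ i → ∣ a i ∣ℝ) ; B = λ k → ∑< k (λ i → ∣ b i ∣ℝ) in
    ∣ ∑< n (convolution a b) - ∑< n a * ∑< n b ∣ℝ ≤ A n * B n - A m * B m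
  cauchy-product-bound a b m = begin
    ∣ ∑< n (convolution a b) - ∑< n a * ∑< n b ∣ℝ
      ≈⟨ ∣-∣ _ ⟨
    ∣ - (∑< n (convolution a b) - ∑< n a * ∑< n b) ∣ℝ
      ≈⟨ ∣∣-cong difference ⟩
    ∣ ∑< n (λ i → a i * (∑< n b - ∑< (n ℕ.∸ i) b)) ∣ℝ
      ≤⟨ ∣∑<∣ n _ ⟩
    ∑< n (λ i → ∣ a i * (∑< n b - ∑< (n ℕ.∸ i) b) ∣ℝ)
      ≈⟨ ∑<-split m m _ ⟩
    ∑< m (λ i → ∣ a i * (∑< n b - ∑< (n ℕ.∸ i) b) ∣ℝ) + ∑< m (λ i → ∣ a (m ℕ.+ i) * (∑< n b - ∑< (n
      ℕ.∸ (m ℕ.+ i)) b) ∣ℝ)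
      ≤⟨ +-mono (∑<-mono m low) (∑<-mono m high) ⟩
    ∑< m (λ i → (B n - B m) * ∣ a i ∣ℝ) + ∑< m (λ i → B n * ∣ a (m ℕ.+ i) ∣ℝ)
      ≈⟨ +-cong (∑<-*ˡ m _ _) (∑<-*ˡ m _ _) ⟩
    (B n - B m) * A m + B n * ∑< m (λ i → ∣ a (m ℕ.+ i) ∣ℝ)
      ≈⟨ (by≈ (gap≈0˘ (*-congˡ (∑<-split m m (λ i → ∣ a i ∣ℝ)))) (solve 5 (λ a b c d e → a :* b :- c
        :* d :- ((b :- d) :* c :+ b :* e) := b :* a :- b :* (c :+ e)) refl _ _ _ _ _)) ⟩
    A n * B n - A m * B m ∎
    where
    open ≤-Reasoning
    n = m ℕ.+ m
    A B : ℕ → ℝ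
    A k = ∑< k (λ i → ∣ a i ∣ℝ)
    B k = ∑< k (λ i → ∣ b i ∣ℝ)
    +-mono : ∀ {x y z w} → x ≤ y → z ≤ w → x + z ≤ y + w
    +-mono {x} {y} {z} {w} x≤y z≤w = by≤ (gap≤ x≤y ≤+≤ gap≤ z≤w) (solve 4 (λ a b c d → a :+ b :- (c
      :+
      d) := a :- c :+ (b :- d)) refl _ _ _ _)
    difference : - (∑< n (convolution a b) - ∑< n a * ∑< n b) ≈ ∑< n (λ i → a i * (∑< n b - ∑< (n
      ℕ.∸ i) b))
    difference = sym (trans (∑<-cong n (λ i _ → (solve 3 (λ a b c → a :* (b :- c) := b :* a :+ :- (a
      :* c)) refl _ _ _)))
      (trans (∑<-+ n (λ i → ∑< n b * a i) (λ i → - (a i * ∑< (n ℕ.∸ i) b)))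
      (by≈ (gap≈0 (∑<-*ˡ n (∑< n b) a) ≈0+≈0 gap≈0 (∑<-neg n (λ i → a i * ∑< (n ℕ.∸ i) b)) ≈0+≈0
        gap≈0
        (∑<-convolution a b n)) (solve 6 (λ a b c d e f → :- (a :- b :* c) :- (d :+ e) := c :* b :-
          d
        :+ (:- f :- e :+ (f :- a))) refl _ _ _ _ _ _))))
    0≤∣b∣ : ∀ i → 0# ≤ ∣ b i ∣ℝ
    0≤∣b∣ i = 0≤∣∣ (b i)
    tail : ∀ i j k → k ℕ.≤ n ℕ.∸ i → ∣ a j * (∑< n b - ∑< (n ℕ.∸ i) b) ∣ℝ ≤ (B n - B k) * ∣ a j ∣ℝ
    tail i j k k≤n-i = begin
      ∣ a j * (∑< n b - ∑< (n ℕ.∸ i) b) ∣ℝ      ≈⟨ trans (∣∣-* _ _) (*-comm _ _) ⟩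
      ∣ ∑< n b - ∑< (n ℕ.∸ i) b ∣ℝ * ∣ a j ∣ℝ ≤⟨ *-monoʳ-≤ _ (0≤∣∣ (a j)) (∣∑<-∑<∣ b (ℕ.m∸n≤m n i))
        ⟩
      (B n - B (n ℕ.∸ i)) * ∣ a j ∣ℝ            ≤⟨ *-monoʳ-≤ _ (0≤∣∣ (a j))
                                                   (by≤ (gap≤ (∑<-monoˡ (λ i → ∣ b i ∣ℝ) 0≤∣b∣
                                                     k≤n-i))
                                                     (solve 3 (λ a b c → a :- b :- (a :- c) := c :-
                                                       b)
                                                     refl _ _ _)) ⟩
      (B n - B k) * ∣ a j ∣ℝ                    ∎
    low : ∀ i → i ℕ.< m → ∣ a i * (∑< n b - ∑< (n ℕ.∸ i) b) ∣ℝ ≤ (B n - B m) * ∣ a i ∣ℝ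
    low i i<m = tail i i m (ℕ.≤-trans (ℕ.≤-reflexive (≡.sym (ℕ.m+n∸n≡m m m))) (ℕ.∸-monoʳ-≤ n (ℕ.<⇒≤
      i<m)))
    high : ∀ i → i ℕ.< m → ∣ a (m ℕ.+ i) * (∑< n b - ∑< (n ℕ.∸ (m ℕ.+ i)) b) ∣ℝ ≤ B n * ∣ a (m ℕ.+
      i) ∣ℝ
    high i _ = ≤-trans (tail (m ℕ.+ i) (m ℕ.+ i) 0 z≤n) (≈⇒≤ (*-congʳ (solve 1 (λ a → a :- κ 0 := a)
      refl _)))

  -- Along the even indices 2m, the product of the partial sums differs from the partial sum of the
  -- convolution by at most X(2m)Y(2m) - X(m)Y(m), where X and Y are the partial sums for |x| and
  -- |y|. Both products have the same limit, so the error tends to 0.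
  exp-+ : ∀ x y → expℝ (x + y) ≈ expℝ x * expℝ y
  exp-+ x y = ⇢-unique (⇢-subsequence dbl n≤dbl (partialExp⇢exp (x + y)))
    (⇢-squeeze bound gap⇢0 (⇢-* (⇢-subsequence dbl n≤dbl (partialExp⇢exp x)) (⇢-subsequence dbl
      n≤dbl (partialExp⇢exp y))))
    where
    dbl : ℕ → ℕ
    dbl n = n ℕ.+ n
    n≤dbl : ∀ n → n ℕ.≤ dbl n
    n≤dbl n = ℕ.m≤m+n n n
    X Y : ℕ → ℝ
    X = partialExp ∣ x ∣ℝ
    Y = partialExp ∣ y ∣ℝ
    gap⇢0 : (λ m → X (dbl m) * Y (dbl m) + - (X m * Y m)) ⇢ 0#
    gap⇢0 = ≡-⇢ (⇢-+ (⇢-subsequence dbl n≤dbl XY) (⇢-neg XY))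
      where
      XY = ⇢-* (partialExp⇢exp ∣ x ∣ℝ) (partialExp⇢exp ∣ y ∣ℝ)
      ≡-⇢ : ∀ {u l} → u ⇢ l + - l → u ⇢ 0#
      ≡-⇢ {u} {l} h ε 0<ε with N , k ← h ε 0<ε = N , λ n N≤n → ≤-<-trans (≈⇒≤ (∣∣-cong
        (solve 2 (λ a b → a :- κ 0 := a :- (b :+ :- b)) refl _ _))) (k n N≤n)
    bound : ∀ m → ∣ partialExp (x + y) (dbl m) - partialExp x (dbl m) * partialExp y (dbl m) ∣ℝ ≤ X
      (dbl m) * Y (dbl m) + - (X m * Y m)
    bound m = ≤-resp
      (∣∣-cong (+-congʳ (∑<-cong (dbl m) (λ i _ → convolution-term x y i))))
      (+-cong (*-cong (partialExp-∣∣ x (dbl m)) (partialExp-∣∣ y (dbl m))) (-‿cong (*-cong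
        (partialExp-∣∣ x m) (partialExp-∣∣ y m))))
      (cauchy-product-bound (term x) (term y) m)

  ⇢-eventually-≤ : ∀ {u l b} N → (∀ n → N ℕ.≤ n → u n ≤ b) → u ⇢ l → l ≤ b
  ⇢-eventually-≤ {b = b} N h u⇢l = ⇢-≤ N h u⇢l (⇢-const b)

  ⇢-eventually-≥ : ∀ {u l b} N → (∀ n → N ℕ.≤ n → b ≤ u n) → u ⇢ l → b ≤ l
  ⇢-eventually-≥ {b = b} N h u⇢l = ⇢-≤ N h (⇢-const b) u⇢l

  ι1⁻¹≈1 : ι 1 ⁻¹ ≈ 1#
  ι1⁻¹≈1 = sym (⁻¹-unique (0<ι-suc 0) (solve 1 (λ a → (κ 1 :+ κ 0) :* κ 1 := κ 1) refl 0#))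

  partialExp-2 : ∀ x → partialExp x 2 ≈ 1# + x
  partialExp-2 x = by≈ (gap≈0 (*-congˡ ι1⁻¹≈1)) (solve 2 (λ a b → κ 1 :+ a :- (κ 0 :+ κ 1 :+ κ 1 :*
    a
    :* b) := a :* κ 1 :- a :* b) refl _ _)

  1+x≤exp-nonneg : ∀ {x} → 0# ≤ x → 1# + x ≤ expℝ x
  1+x≤exp-nonneg {x} 0≤x = ⇢-eventually-≥ 2
    (λ n 2≤n → ≤-trans (≈⇒≤ (sym (partialExp-2 x))) (partialExp-mono 0≤x 2≤n)) (partialExp⇢exp x)

  exp-0 : expℝ 0# ≈ 1#
  exp-0 = *-cancelˡ-≈ (expℝ 0#) (<⇒≉ (by< (0<1 <+≤ gap≤ (1+x≤exp-nonneg ≤-refl)) (solve 1 (λ a → a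
    :-
    κ 0 := κ 1 :+ (a :- (κ 1 :+ κ 0))) refl _)))
    (trans (sym (exp-+ 0# 0#)) (trans (exp-cong (+-identityˡ 0#)) (sym (*-identityʳ _))))

  exp-inverse : ∀ x → expℝ x * expℝ (- x) ≈ 1#
  exp-inverse x = trans (sym (exp-+ x (- x))) (trans (exp-cong (-‿inverseʳ x)) exp-0)

  0<exp : ∀ x → 0# < expℝ x
  0<exp x = [ nonneg , negative ]′ (≤-total 0# x)
    where
    nonneg : ∀ {x} → 0# ≤ x → 0# < expℝ x
    nonneg {x} 0≤x = by< (0<1 <+≤ gap≤ (1+x≤exp-nonneg 0≤x) ≤+≤ 0≤x) (solve 2 (λ a b → a :- κ 0 := κ
      1
      :+ (a :- (κ 1 :+ b) :+ b)) refl _ _)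
    negative : x ≤ 0# → 0# < expℝ x
    negative x≤0 = *-cancelˡ-< (expℝ (- x)) (<⇒≤ 0<exp-x) (by< (0<1 <+≤ gap≈˘ (exp-inverse x))
      (solve
      2 (λ a b → a :* b :- a :* κ 0 := κ 1 :+ (b :* a :- κ 1)) refl _ _))
      where
      0<exp-x : 0# < expℝ (- x)
      0<exp-x = nonneg (by≤ (gap≤ x≤0) (solve 1 (λ a → :- a :- κ 0 := κ 0 :- a) refl _))

  0<2⁻¹ : 0# < ι 2 ⁻¹
  0<2⁻¹ = 0<x⁻¹ (0<ι-suc 1)

  2*2⁻¹≈1 : ι 2 * ι 2 ⁻¹ ≈ 1#
  2*2⁻¹≈1 = x*x⁻¹≈1 (0<ι-suc 1)

  ∣x∣²≈x² : ∀ x → ∣ x ∣ℝ * ∣ x ∣ℝ ≈ x * x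
  ∣x∣²≈x² x = trans (sym (∣∣-* x x)) (∣∣-nonneg (0≤x² x))

  term-3 : ∀ y → ι 6 * term y 3 ≈ y * y * y
  term-3 y = by≈ (scale≈0 2 (gap≈0 (term-suc y 2)) ≈0+≈0 gap≈0 (*-congˡ (term-suc y 1)) ≈0+≈0 gap≈0
    (*-congˡ (term-suc y 0))) (solve 4 (λ a b c d → a :* a :* a :- κ 6 :* b := κ 2 :* (a :* c :- κ 3
    :* b) :+ (a :* (a :* d) :- a :* (κ 2 :* c) :+ (a :* a :* (a :* κ 1) :- a :* a :* ((κ 1 :+ κ 0)
      :*
    d)))) refl _ _ _ _)

  -- Terms halve from index 3 on because 2|x| ≤ 4, so the tail is at most twice |x|³/6. The bound
  -- 1/3 obtained is relaxed to 1/2, the constant already present in the quadratic term.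
  exp-cubic : ∀ x → ∣ x ∣ℝ ≤ 1# →
    ∣ expℝ x - (1# + x + x * x * ι 2 ⁻¹) ∣ℝ ≤ ∣ x ∣ℝ * ∣ x ∣ℝ * ∣ x ∣ℝ * ι 2 ⁻¹
  exp-cubic x ∣x∣≤1 = ∣∣-≤
    (by≤ (gap≤ (⇢-eventually-≤ 3 upper (partialExp⇢exp x)) ≤+≤ gap≈ partialExp-3) (solve 5 (λ a b c
      d
      e → a :* a :* a :* b :- (c :- (κ 1 :+ d :+ d :* d :* b)) := e :+ a :* a :* a :* b :- c :+ (κ 1
      :+ d :+ d :* d :* b :- e)) refl _ _ _ _ _))
    (by≤ (gap≤ (⇢-eventually-≥ 3 lower (partialExp⇢exp x)) ≤+≤ gap≈˘ partialExp-3) (solve 5 (λ a b c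
      d
      e → a :* a :* a :* b :- :- (c :- (κ 1 :+ d :+ d :* d :* b)) := c :- (e :- a :* a :* a :* b) :+
      (e :- (κ 1 :+ d :+ d :* d :* b))) refl _ _ _ _ _))
    where
    y = ∣ x ∣ℝ
    0≤y : 0# ≤ y
    0≤y = 0≤∣∣ x
    partialExp-3 : partialExp x 3 ≈ 1# + x + x * x * ι 2 ⁻¹
    partialExp-3 = trans (+-congʳ (partialExp-2 x))
      (by≈ (gap≈0 (*-congˡ ι1⁻¹≈1)) (solve 3 (λ a b c → κ 1 :+ a :+ a :* a :* b :- (κ 1 :+ a :+ κ 1
        :*
        a :* c :* a :* b) := a :* a :* b :* κ 1 :- a :* a :* b :* c) refl _ _ _))
    near : ∀ n → 3 ℕ.≤ n → ∣ partialExp x n - partialExp x 3 ∣ℝ ≤ y * y * y * ι 2 ⁻¹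
    near n 3≤n = ≤-trans (∣∑<-∑<∣ (term x) 3≤n)
      (by≤-scaled 5 (scale≤ 6 (gap≈ (partialExp-∣∣ x n)) ≤+≤ scale≤ 6 (gap≈˘ (partialExp-∣∣ x 3))
        ≤+≤
        scale≤ 6 (gap≤ (partialExp-mono 0≤y (ℕ.m≤n+m n 3))) ≤+≤ scale≤ 6 (gap≤ (partialExp-tail 3
          0≤y
        y+y≤4 n)) ≤+≤ scale≤ 12 (term-nonneg (3 ℕ.+ n) 0≤y) ≤+≤ scale≤ 2 (gap≈ (term-3 y)) ≤+≤
        *-nonneg (*-nonneg 0≤y 0≤y) 0≤y ≤+≤ scale≤ 3 (gap≈˘ (*-congˡ 2*2⁻¹≈1))) (solve 9 (λ a b c d
          e
        f g h i → κ 6 :* (a :* a :* a :* b :- (c :- d)) := κ 6 :* (e :- c) :+ (κ 6 :* (d :- f) :+ (κ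
          6
        :* (g :- e) :+ (κ 6 :* (f :+ κ 2 :* h :- (g :+ κ 2 :* i)) :+ (κ 12 :* i :+ (κ 2 :* (a :* a
          :*
        a :- κ 6 :* h) :+ (a :* a :* a :+ κ 3 :* (a :* a :* a :* (κ 2 :* b) :- a :* a :* a :* κ
        1)))))))) refl _ _ _ _ _ _ _ _ _))
      where
      y+y≤4 : y + y ≤ ι 4
      y+y≤4 = by≤ (scale≤ 2 (gap≤ ∣x∣≤1) ≤+≤ scale≤ 2 0≤1) (solve 1 (λ a → κ 4 :- (a :+ a) := κ 2 :*
        (κ 1 :- a) :+ κ 2 :* κ 1) refl _)
    upper : ∀ n → 3 ℕ.≤ n → partialExp x n ≤ partialExp x 3 + y * y * y * ι 2 ⁻¹
    upper n 3≤n = by≤ (gap≤ (near n 3≤n) ≤+≤ gap≤ (∣∣-upper (partialExp x n - partialExp x 3)))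
      (solve
      5 (λ a b c d e → a :+ b :* b :* b :* c :- d := b :* b :* b :* c :- e :+ (e :- (d :- a))) refl
        _
      _ _ _ _)
    lower : ∀ n → 3 ℕ.≤ n → partialExp x 3 - y * y * y * ι 2 ⁻¹ ≤ partialExp x n
    lower n 3≤n = by≤ (gap≤ (near n 3≤n) ≤+≤ gap≤ (∣∣-lower (partialExp x n - partialExp x 3)))
      (solve
      5 (λ a b c d e → a :- (b :- c :* c :* c :* d) := c :* c :* c :* d :- e :+ (e :- :- (a :- b)))
      refl _ _ _ _ _)

  -- For x ≥ 0 the series dominates its first two terms; for -1 ≤ x ≤ 0 the cubic error |x|³/2 is at
  -- most the quadratic term x²/2; for x ≤ -1 the left side is at most 0.
  1+x≤exp : ∀ x → 1# + x ≤ expℝ x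
  1+x≤exp x = [ 1+x≤exp-nonneg , negative ]′ (≤-total 0# x)
    where
    small : x ≤ 0# → - 1# ≤ x → 1# + x ≤ expℝ x
    small x≤0 -1≤x = by≤ (gap≤ (∣∣-lower (expℝ x - (1# + x + x * x * ι 2 ⁻¹))) ≤+≤ gap≤ (exp-cubic x
      ∣x∣≤1) ≤+≤ gap≤ (*-monoʳ-≤ (ι 2 ⁻¹) (<⇒≤ 0<2⁻¹) (*-monoˡ-≤ (∣ x ∣ℝ * ∣ x ∣ℝ) (0≤x² ∣ x ∣ℝ)
      ∣x∣≤1)) ≤+≤ gap≈ (*-congʳ (∣x∣²≈x² x))) (solve 5 (λ a b c d e → a :- (κ 1 :+ b) := c :- :- (a
        :-
      (κ 1 :+ b :+ b :* b :* d)) :+ (e :* e :* e :* d :- c :+ (e :* e :* κ 1 :* d :- e :* e :* e :*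
        d
      :+ (b :* b :* d :- e :* e :* d)))) refl _ _ _ _ _)
      where
      ∣x∣≤1 : ∣ x ∣ℝ ≤ 1#
      ∣x∣≤1 = ∣∣-≤ (by≤ (gap≤ x≤0 ≤+≤ 0≤1) (solve 1 (λ a → κ 1 :- a := κ 0 :- a :+ κ 1) refl _))
        (by≤
        (gap≤ -1≤x) (solve 1 (λ a → κ 1 :- :- a := a :- :- κ 1) refl _))
    negative : x ≤ 0# → 1# + x ≤ expℝ x
    negative x≤0 = [ small x≤0 , (λ x≤-1 → (by≤ (gap≤ x≤-1 ≤+≤ <⇒≤ (0<exp x)) (solve 2 (λ a b → a :-
      (κ 1 :+ b) := :- κ 1 :- b :+ a) refl _ _))) ]′
                   (≤-total (- 1#) x)

  exp-mono-< : ∀ {x y} → x < y → expℝ x < expℝ y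
  exp-mono-< {x} {y} x<y = begin-strict
    expℝ x                   ≈⟨ *-identityʳ _ ⟨
    expℝ x * 1#              <⟨ *-monoˡ-< (expℝ x) (0<exp x) (by< (gap< x<y <+≤ gap≤ (1+x≤exp (y -
      x))) (solve 3 (λ a b c → a :- κ 1 := b :- c :+ (a :- (κ 1 :+ (b :- c)))) refl _ _ _)) ⟩
    expℝ x * expℝ (y - x)    ≈⟨ exp-+ x (y - x) ⟨
    expℝ (x + (y - x))       ≈⟨ exp-cong (solve 2 (λ a b → a :+ (b :- a) := b) refl _ _) ⟩
    expℝ y                   ∎
    where open ≤-Reasoning

  exp-cancel-< : ∀ {x y} → expℝ x < expℝ y → x < y
  exp-cancel-< {x} {y} h = [ id , (λ { (inj₁ y<x) → ⊥-elim (<-irrefl (<.trans h (exp-mono-< y<x)))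
                                    ; (inj₂ y≈x) → ⊥-elim (<-irrefl (<-resp refl (exp-cong y≈x) h))
                                      }) ]′ (<-or-≥ x y)

  exp-cancel-≤ : ∀ {x y} → expℝ x ≤ expℝ y → x ≤ y
  exp-cancel-≤ h = ≮⇒≥ (λ y<x → <⇒≱ (exp-mono-< y<x) h)

  exp-injective : ∀ {x y} → expℝ x ≈ expℝ y → x ≈ y
  exp-injective h = ≤-antisym (exp-cancel-≤ (≈⇒≤ h)) (exp-cancel-≤ (≈⇒≤ (sym h)))

  -- The preimage is the supremum s of all y with exp y ≤ x. Were exp s not x, s could be moved by
  -- the relative gap h, taken with respect to the larger of the two values, without crossing x:
  -- this follows from exp (-h) ≥ 1 - h and contradicts the choice of s.
  exp-surjective : ∀ {x} → 0# < x → ∃[ y ] expℝ y ≈ x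
  exp-surjective {x} 0<x = s , ≤-antisym (≮⇒≥ not-above) (≮⇒≥ not-below)
    where
    P : ℝ → Set
    P y = expℝ y ≤ x
    P-inhabited : ∃ P
    -- From exp (1/x) ≥ 1 + 1/x one gets x exp (1/x) ≥ 1, that is, exp (-1/x) ≤ x.
    P-inhabited = - x ⁻¹ , *-cancelˡ-≤ (expℝ (x ⁻¹)) (0<exp _) (by≤ (gap≈ (exp-inverse (x ⁻¹)) ≤+≤
      gap≤ (*-monoʳ-≤ x (<⇒≤ 0<x) (1+x≤exp (x ⁻¹))) ≤+≤ gap≈˘ (x*x⁻¹≈1 0<x) ≤+≤ <⇒≤ 0<x) (solve 4 (λ
        a
      b c d → a :* b :- a :* c := κ 1 :- a :* c :+ (a :* b :- (κ 1 :+ d) :* b :+ (b :* d :- κ 1 :+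
      b))) refl _ _ _ _))
    P-bounded : UpperBound P x
    P-bounded y h = by≤ (gap≤ h ≤+≤ gap≤ (1+x≤exp y) ≤+≤ 0≤1) (solve 3 (λ a b c → a :- b := a :- c
      :+
      (c :- (κ 1 :+ b) :+ κ 1)) refl _ _ _)
    sup = supremum P P-inhabited (x , P-bounded)
    s = proj₁ sup
    ub : UpperBound P s
    ub = proj₁ (proj₂ sup)
    least : ∀ u → UpperBound P u → s ≤ u
    least = proj₂ (proj₂ sup)
    not-below : ¬ (expℝ s < x)
    not-below es<x = <⇒≱ s<s+h (ub (s + h) exp[s+h]≤x)
      where
      h = (x - expℝ s) / x
      s<s+h : s < s + h
      s<s+h = by< (*-pos _ _ (gap< es<x) (0<x⁻¹ 0<x)) (solve 4 (λ a b c d → a :+ (b :- c) :* d :- a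
        :=
        (b :- c) :* d) refl _ _ _ _)
      x[1-h]≈exp-s : x * (1# - h) ≈ expℝ s
      x[1-h]≈exp-s = by≈ (gap≈0˘ (*-congˡ (x*x⁻¹≈1 0<x))) (solve 3 (λ a b c → a :- b :* (κ 1 :- (b
        :-
        a) :* c) := (b :- a) :* (b :* c) :- (b :- a) :* κ 1) refl _ _ _)
      exp[s+h]≤x : expℝ (s + h) ≤ x
      exp[s+h]≤x = *-cancelˡ-≤ (expℝ (- h)) (0<exp (- h)) (begin
        expℝ (- h) * expℝ (s + h)  ≈⟨ exp-+ (- h) (s + h) ⟨
        expℝ (- h + (s + h))       ≈⟨ exp-cong (solve 2 (λ a b → :- a :+ (b :+ a) := b) refl _ _) ⟩
        expℝ s                     ≈⟨ x[1-h]≈exp-s ⟨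
        x * (1# - h)               ≤⟨ *-monoˡ-≤ x (<⇒≤ 0<x) (1+x≤exp (- h)) ⟩
        x * expℝ (- h)             ≈⟨ *-comm _ _ ⟩
        expℝ (- h) * x             ∎)
        where open ≤-Reasoning
    not-above : ¬ (x < expℝ s)
    not-above x<es = <⇒≱ s-h<s (least (s - h) λ y ey≤x → ≮⇒≥ λ s-h<y →
        <⇒≱ (≤-<-trans x≤exp[s-h] (exp-mono-< s-h<y)) ey≤x)
      where
      h = (expℝ s - x) / expℝ s
      s-h<s : s - h < s
      s-h<s = by< (*-pos _ _ (gap< x<es) (0<x⁻¹ (0<exp s))) (solve 4 (λ a b c d → a :- (a :- (b :-
        c)
        :* d) := (b :- c) :* d) refl _ _ _ _)
      x≤exp[s-h] : x ≤ expℝ (s - h)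
      x≤exp[s-h] = begin
        x ≈⟨ (by≈ (gap≈0 (*-congˡ (x*x⁻¹≈1 (0<exp s)))) (solve 3 (λ a b c → a
          :* (κ 1 :- (a :- b) :* c) :- b := (a :- b) :* κ 1 :- (a :- b) :* (a :* c)) refl _ _ _)) ⟩
        expℝ s * (1# - h)         ≤⟨ *-monoˡ-≤ _ (<⇒≤ (0<exp s)) (1+x≤exp (- h)) ⟩
        expℝ s * expℝ (- h)       ≈⟨ exp-+ s (- h) ⟨
        expℝ (s - h)              ∎
        where open ≤-Reasoning

  -- Square roots and complex absolute values.

  ²-cancel-≤ : ∀ {x y} → 0# ≤ y → x * x ≤ y * y → x ≤ y
  ²-cancel-≤ {x} {y} 0≤y h = ≮⇒≥ λ y<x → <⇒≱ (by< (gap< (*-monoʳ-< x (≤-<-trans 0≤y y<x) y<x) <+≤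
    gap≤
    (*-monoˡ-≤ y 0≤y (<⇒≤ y<x))) (solve 2 (λ a b → a :* a :- b :* b := a :* a :- b :* a :+ (b :* a
      :-
    b :* b)) refl _ _)) h

  -- For positive x the root is the exponential of half a logarithm.
  √-exists : ∀ {x} → 0# ≤ x → ∃[ y ] 0# ≤ y × y * y ≈ x
  √-exists {x} (inj₂ 0≈x) = 0# , ≤-refl , trans (zeroˡ 0#) 0≈x
  √-exists {x} (inj₁ 0<x) = let y , ey≈x = exp-surjective 0<x in expℝ (y * ι 2 ⁻¹) , <⇒≤ (0<exp _) ,
    trans (sym (exp-+ _ _)) (trans (exp-cong (by≈ (gap≈0 (*-congˡ 2*2⁻¹≈1)) (solve 2 (λ a b → a :-
      (a
      :* b :+ a :* b) := a :* κ 1 :- a :* (κ 2 :* b)) refl _ _))) ey≈x)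

  √-spec : ∀ {x} → 0# ≤ x → 0# ≤ √ x × √ x * √ x ≈ x
  √-spec {x} 0≤x = choose-satisfies (λ y → 0# ≤ y × y * y ≈ x) 0# (√-exists 0≤x)

  0≤√ : ∀ {x} → 0# ≤ x → 0# ≤ √ x
  0≤√ 0≤x = proj₁ (√-spec 0≤x)

  √*√ : ∀ {x} → 0# ≤ x → √ x * √ x ≈ x
  √*√ 0≤x = proj₂ (√-spec 0≤x)

  0<√ : ∀ {x} → 0# < x → 0# < √ x
  0<√ {x} 0<x = ≤∧≉⇒< (0≤√ (<⇒≤ 0<x)) (λ 0≈√x → <⇒≉ 0<x (trans (sym (√*√ (<⇒≤ 0<x))) (trans (*-congˡ
    (sym 0≈√x)) (zeroʳ _))))
    where
    ≤∧≉⇒< : ∀ {x y} → x ≤ y → ¬ (x ≈ y) → x < y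
    ≤∧≉⇒< (inj₁ x<y) _   = x<y
    ≤∧≉⇒< (inj₂ x≈y) x≉y = ⊥-elim (x≉y x≈y)

  √-mono-≤ : ∀ {x y} → 0# ≤ x → x ≤ y → √ x ≤ √ y
  √-mono-≤ 0≤x x≤y = ²-cancel-≤ (0≤√ (≤-trans 0≤x x≤y)) (≤-resp (sym (√*√ 0≤x)) (sym (√*√ (≤-trans
    0≤x x≤y))) x≤y)

  0≤normSq : ∀ z → 0# ≤ normSq z
  0≤normSq z = 0≤x² (re z) ≤+≤ 0≤x² (im z)

  ∣re∣≤ : ∀ z → ∣ re z ∣ℝ ≤ ∣ z ∣ᶜ
  ∣re∣≤ z = ²-cancel-≤ (0≤√ (0≤normSq z)) (by≤ (gap≈˘ (√*√ (0≤normSq z)) ≤+≤ gap≈ (∣x∣²≈x² (re z))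
    ≤+≤
    0≤x² (im z)) (solve 4 (λ a b c d → a :* a :- b :* b := a :* a :- (c :* c :+ d :* d) :+ (c :* c
      :-
    b :* b :+ d :* d)) refl _ _ _ _))

  ∣im∣≤ : ∀ z → ∣ im z ∣ℝ ≤ ∣ z ∣ᶜ
  ∣im∣≤ z = ²-cancel-≤ (0≤√ (0≤normSq z)) (by≤ (gap≈˘ (√*√ (0≤normSq z)) ≤+≤ gap≈ (∣x∣²≈x² (im z))
    ≤+≤
    0≤x² (re z)) (solve 4 (λ a b c d → a :* a :- b :* b := a :* a :- (c :* c :+ d :* d) :+ (d :* d
      :-
    b :* b :+ c :* c)) refl _ _ _ _))

  ∣∣ᶜ-real : ∀ z → im z ≈ 0# → ∣ z ∣ᶜ ≤ ∣ re z ∣ℝ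
  ∣∣ᶜ-real z im≈0 = ²-cancel-≤ (0≤∣∣ (re z)) (by≤ (gap≈ (√*√ (0≤normSq z)) ≤+≤ gap≈˘ (∣x∣²≈x² (re
    z))
    ≤+≤ gap≈ (*-congˡ im≈0)) (solve 4 (λ a b c d → a :* a :- b :* b := c :* c :+ d :* d :- b :* b :+
    (a :* a :- c :* c :+ (d :* κ 0 :- d :* d))) refl _ _ _ _))

  re-⟶ : ∀ {u w} → u ⟶ w → (λ n → re (u n)) ⇢ re w
  re-⟶ h ε 0<ε = let N , k = h ε 0<ε in N , λ n N≤n → ≤-<-trans (∣re∣≤ _) (k n N≤n)

  im-⟶ : ∀ {u w} → u ⟶ w → (λ n → im (u n)) ⇢ im w
  im-⟶ h ε 0<ε = let N , k = h ε 0<ε in N , λ n N≤n → ≤-<-trans (∣im∣≤ _) (k n N≤n)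

  real-⟶ : ∀ {u w} → (λ n → re (u n)) ⇢ re w → (∀ n → im (u n) ≈ 0#) → im w ≈ 0# → u ⟶ w
  real-⟶ {u} {w} h imu≈0 imw≈0 ε 0<ε = let N , k = h ε 0<ε in N , λ n N≤n → ≤-<-trans
    (∣∣ᶜ-real (u n -ᶜ w) (by≈ (gap≈0 (imu≈0 n) ≈0+≈0 gap≈0˘ imw≈0) (solve 2 (λ a b → κ 0 :- (a :- b)
      := κ 0 :- a :+ (b :- κ 0)) refl _ _))) (k n N≤n)

  -- The complex exponential on the real axis, and the logarithm.

  re-∑ᶜ : ∀ {A : Set} (xs : List A) f → re (∑ᶜ xs f) ≡ ∑ xs (λ x → re (f x))
  re-∑ᶜ []       f = ≡.refl
  re-∑ᶜ (x ∷ xs) f = ≡.cong (λ s → re (f x) + s) (re-∑ᶜ xs f)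

  im-∑ᶜ : ∀ {A : Set} (xs : List A) f → im (∑ᶜ xs f) ≡ ∑ xs (λ x → im (f x))
  im-∑ᶜ []       f = ≡.refl
  im-∑ᶜ (x ∷ xs) f = ≡.cong (λ s → im (f x) + s) (im-∑ᶜ xs f)

  ∑-++ : ∀ {A : Set} (xs ys : List A) f → ∑ (xs ++ ys) f ≈ ∑ xs f + ∑ ys f
  ∑-++ []       ys f = sym (+-identityˡ _)
  ∑-++ (x ∷ xs) ys f = trans (+-congˡ (∑-++ xs ys f)) (sym (+-assoc _ _ _))

  ∑-upTo : ∀ n f → ∑ (upTo n) f ≈ ∑< n f
  ∑-upTo zero    f = refl
  ∑-upTo (suc n) f = trans (reflexive (≡.cong (λ xs → ∑ xs f) (≡.sym (List.upTo-∷ʳ n))))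
    (trans (∑-++ (upTo n) (n ∷ []) f) (+-cong (∑-upTo n f) (+-identityʳ _)))

  ofℝ-^ : ∀ y n → ofℝ y ^ᶜ n ≈ᶜ ofℝ (y ^ n)
  ofℝ-^ y zero    = refl , refl
  ofℝ-^ y (suc n) = let r , i = ofℝ-^ y n in
      (by≈ (gap≈0 (*-congˡ r)) (solve 4 (λ a b c d → a :* b :- (a :* c :- κ 0 :* d) := a :* b :- a
        :*
        c) refl _ _ _ _))
    , (by≈ (gap≈0 (*-congˡ i)) (solve 3 (λ a b c → κ 0 :- (a :* b :+ κ 0 :* c) := a :* κ 0 :- a :*
      b)
      refl _ _ _))

  term-factorial : ∀ y n → y ^ n * ι (n !) ⁻¹ ≈ term y n
  term-factorial y zero    = trans (*-identityˡ _) ι1⁻¹≈1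
  term-factorial y (suc n) = begin
    y * y ^ n * ι (suc n ℕ.* n !) ⁻¹ ≈⟨ *-congˡ (⁻¹-cong (0<ι (ℕ.1≤n! (suc n))) (ι-* (suc n) (n !)))
      ⟩
    y * y ^ n * (ι (suc n) * ι (n !)) ⁻¹     ≈⟨ *-congˡ (*⁻¹ (0<ι-suc n) (0<ι (ℕ.1≤n! n))) ⟩
    y * y ^ n * (ι (suc n) ⁻¹ * ι (n !) ⁻¹) ≈⟨ (solve 4 (λ a b c d → a :* b :* (c :* d) := b :* d :*
      a :* c) refl _ _ _ _) ⟩
    y ^ n * ι (n !) ⁻¹ * y * ι (suc n) ⁻¹    ≈⟨ *-congʳ (*-congʳ (term-factorial y n)) ⟩
    term y n * y * ι (suc n) ⁻¹              ∎
    where open import Relation.Binary.Reasoning.Setoid setoid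

  exp-series : ℂ → ℕ → ℂ
  exp-series z N = ∑ᶜ (upTo N) (λ n → z ^ᶜ n *ᶜ ofℝ (ι (n !) ⁻¹))

  exp-series-re : ∀ y N → re (exp-series (ofℝ y) N) ≈ partialExp y N
  exp-series-re y N = trans (reflexive (re-∑ᶜ (upTo N) _)) (trans (∑-upTo N _) (∑<-cong N λ n _ →
    trans
    (solve 3 (λ a b c → a :* b :- c :* κ 0 := a :* b) refl _ _ _)
    (trans (*-congʳ (proj₁ (ofℝ-^ y n))) (term-factorial y n))))

  exp-series-im : ∀ y N → im (exp-series (ofℝ y) N) ≈ 0#
  exp-series-im y N = trans (reflexive (im-∑ᶜ (upTo N) _)) (trans (∑-upTo N _) (trans (∑<-cong N λ n
    _ →
    (by≈ (gap≈0 (*-congʳ (proj₂ (ofℝ-^ y n)))) (solve 3 (λ a b c → κ 0 :- (a :* κ 0 :+ b :* c) := κ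
      0
      :* c :- b :* c) refl _ _ _)))
    (∑<-zero N)))

  -- The value of `exp` is a chosen limit of the complex series. At a real point the partial sums
  -- have real part `partialExp` and imaginary part 0, so uniqueness of limits in each component
  -- determines it.
  exp-ofℝ : ∀ y → exp (ofℝ y) ≈ᶜ ofℝ (expℝ y)
  exp-ofℝ y = ⇢-unique (re-⟶ converges) (⇢-cong (λ N → sym (exp-series-re y N)) (partialExp⇢exp y))
            , ⇢-unique (im-⟶ converges) (⇢-cong (λ N → sym (exp-series-im y N)) (⇢-const 0#))
    where
    converges : exp-series (ofℝ y) ⟶ exp (ofℝ y)
    converges = choose-satisfies (λ w → exp-series (ofℝ y) ⟶ w) 0ᶜ (ofℝ (expℝ y) ,
      real-⟶ (⇢-cong (λ N → sym (exp-series-re y N)) (partialExp⇢exp y)) (exp-series-im y) refl)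

  exp-log : ∀ {x} → 0# < x → expℝ (log x) ≈ x
  exp-log {x} 0<x = trans (sym (proj₁ (exp-ofℝ (log x)))) (proj₁ (choose-satisfies (λ y → exp (ofℝ
    y) ≈ᶜ ofℝ x) 0#
    (let y , ey≈x = exp-surjective 0<x in y , trans (proj₁ (exp-ofℝ y)) ey≈x , proj₂ (exp-ofℝ y))))

  log-exp : ∀ y → log (expℝ y) ≈ y
  log-exp y = exp-injective (exp-log (0<exp y))

  log-cong : ∀ {x y} → 0# < x → x ≈ y → log x ≈ log y
  log-cong 0<x x≈y = exp-injective (trans (exp-log 0<x) (trans x≈y (sym (exp-log (<-resp refl x≈y
    0<x)))))

  log-mono-≤ : ∀ {x y} → 0# < x → x ≤ y → log x ≤ log y
  log-mono-≤ 0<x x≤y = exp-cancel-≤ (≤-resp (sym (exp-log 0<x)) (sym (exp-log (<-≤-trans 0<x x≤y)))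
    x≤y)

  log-mono-< : ∀ {x y} → 0# < x → x < y → log x < log y
  log-mono-< 0<x x<y = exp-cancel-< (<-resp (sym (exp-log 0<x)) (sym (exp-log (<.trans 0<x x<y)))
    x<y)

  log-1 : log 1# ≈ 0#
  log-1 = exp-injective (trans (exp-log 0<1) (sym exp-0))

  log-* : ∀ {x y} → 0# < x → 0# < y → log (x * y) ≈ log x + log y
  log-* {x} {y} 0<x 0<y = exp-injective (trans (exp-log (*-pos x y 0<x 0<y))
    (sym (trans (exp-+ _ _) (*-cong (exp-log 0<x) (exp-log 0<y)))))

  log-⁻¹ : ∀ {x} → 0# < x → log (x ⁻¹) ≈ - log x
  log-⁻¹ {x} 0<x = by≈ (gap≈0 (trans (sym (log-* 0<x (0<x⁻¹ 0<x))) (trans (log-cong (*-pos _ _ 0<x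
    (0<x⁻¹ 0<x)) (x*x⁻¹≈1 0<x)) log-1))) (solve 2 (λ a b → :- a :- b := κ 0 :- (a :+ b)) refl _ _)

  log≤x-1 : ∀ {x} → 0# < x → log x ≤ x - 1#
  log≤x-1 {x} 0<x = by≤ (gap≤ (1+x≤exp (log x)) ≤+≤ gap≈ (exp-log 0<x)) (solve 3 (λ a b c → a :- κ 1
    :- b := c :- (κ 1 :+ b) :+ (a :- c)) refl _ _ _)

  1-x⁻¹≤log : ∀ {x} → 0# < x → 1# - x ⁻¹ ≤ log x
  1-x⁻¹≤log {x} 0<x = by≤ (gap≤ (log≤x-1 (0<x⁻¹ 0<x)) ≤+≤ gap≈˘ (log-⁻¹ 0<x)) (solve 3 (λ a b c → a
    :-
    (κ 1 :- b) := b :- κ 1 :- c :+ (c :- :- a)) refl _ _ _)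

  0≤log : ∀ {x} → 1# ≤ x → 0# ≤ log x
  0≤log 1≤x = ≤-trans (≈⇒≤ (sym log-1)) (log-mono-≤ 0<1 1≤x)

  -- Sums over primes.

  -- A condition on an index is encoded by summands that vanish where it fails. Sums over primes,
  -- residues or units then all run over one interval, and they can be added, swapped and compared
  -- term by term.
  when : {P : Set} → Dec P → ℝ → ℝ
  when (yes _) x = x
  when (no _)  x = 0#

  when-yes : {P : Set} (d : Dec P) {x : ℝ} → P → when d x ≈ x
  when-yes (yes _) _ = refl
  when-yes (no ¬p) p = ⊥-elim (¬p p)

  when-no : {P : Set} (d : Dec P) {x : ℝ} → ¬ P → when d x ≈ 0#
  when-no (yes p) ¬p = ⊥-elim (¬p p)
  when-no (no _)  _  = refl

  when-mono : {P : Set} (d : Dec P) {x y : ℝ} → (P → x ≤ y) → when d x ≤ when d y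
  when-mono (yes p) h = h p
  when-mono (no _)  h = ≤-refl

  when-cong : {P : Set} (d : Dec P) {x y : ℝ} → (P → x ≈ y) → when d x ≈ when d y
  when-cong (yes p) h = h p
  when-cong (no _)  h = refl

  when-zero : {P : Set} (d : Dec P) → when d 0# ≈ 0#
  when-zero (yes _) = refl
  when-zero (no _)  = refl

  when-+ : {P : Set} (d : Dec P) (x y : ℝ) → when d (x + y) ≈ when d x + when d y
  when-+ (yes _) x y = refl
  when-+ (no _)  x y = sym (+-identityˡ 0#)

  when-*ˡ : {P : Set} (d : Dec P) (c x : ℝ) → when d (c * x) ≈ c * when d x
  when-*ˡ (yes _) c x = refl
  when-*ˡ (no _)  c x = sym (zeroʳ c)

  when-∣∣ : {P : Set} (d : Dec P) (x : ℝ) → ∣ when d x ∣ℝ ≈ when d ∣ x ∣ℝ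
  when-∣∣ (yes _) x = refl
  when-∣∣ (no _)  x = ∣∣-nonneg ≤-refl

  when-nonneg : {P : Set} (d : Dec P) {x : ℝ} → (P → 0# ≤ x) → 0# ≤ when d x
  when-nonneg d h = ≤-trans (≈⇒≤ (sym (when-zero d))) (when-mono d h)

  when-≤ : {P : Set} (d : Dec P) {x : ℝ} → 0# ≤ x → when d x ≤ x
  when-≤ (yes _) _   = ≤-refl
  when-≤ (no _)  0≤x = 0≤x

  ∑ₚ : ℕ → (ℕ → ℝ) → ℝ
  ∑ₚ N f = ∑< (suc N) (λ n → when (prime? n) (f n))

  ∑ₚ-mono : ∀ N {f g} → (∀ p → Prime p → p ℕ.≤ N → f p ≤ g p) → ∑ₚ N f ≤ ∑ₚ N g
  ∑ₚ-mono N h = ∑<-mono (suc N) λ { n (s≤s n≤N) → when-mono (prime? n) λ pr → h n pr n≤N }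

  ∑ₚ-cong : ∀ N {f g} → (∀ p → Prime p → p ℕ.≤ N → f p ≈ g p) → ∑ₚ N f ≈ ∑ₚ N g
  ∑ₚ-cong N h = ∑<-cong (suc N) λ { n (s≤s n≤N) → when-cong (prime? n) λ pr → h n pr n≤N }

  ∑ₚ-+ : ∀ N f g → ∑ₚ N (λ p → f p + g p) ≈ ∑ₚ N f + ∑ₚ N g
  ∑ₚ-+ N f g = trans (∑<-cong (suc N) λ n _ → when-+ (prime? n) (f n) (g n))
    (∑<-+ (suc N) (λ n → when (prime? n) (f n)) (λ n → when (prime? n) (g n)))

  ∑ₚ-*ˡ : ∀ N c f → ∑ₚ N (λ p → c * f p) ≈ c * ∑ₚ N f
  ∑ₚ-*ˡ N c f = trans (∑<-cong (suc N) λ n _ → when-*ˡ (prime? n) c (f n))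
    (∑<-*ˡ (suc N) c (λ n → when (prime? n) (f n)))

  ∑ₚ-zero : ∀ N {f} → (∀ p → Prime p → p ℕ.≤ N → f p ≈ 0#) → ∑ₚ N f ≈ 0#
  ∑ₚ-zero N h = trans (∑ₚ-cong N h) (trans (∑<-cong (suc N) λ n _ → when-zero (prime? n)) (∑<-zero
    (suc N)))

  ∑ₚ-nonneg : ∀ N {f} → (∀ p → Prime p → p ℕ.≤ N → 0# ≤ f p) → 0# ≤ ∑ₚ N f
  ∑ₚ-nonneg N h = ∑<-nonneg (suc N) λ { n (s≤s n≤N) → when-nonneg (prime? n) λ pr → h n pr n≤N }

  ∑ₚ-split : ∀ m k f → ∑ₚ (m ℕ.+ k) f ≈ ∑ₚ m f + ∑< k (λ i → when (prime? (suc m ℕ.+ i)) (f (suc m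
    ℕ.+ i)))
  ∑ₚ-split m k f = ∑<-split (suc m) k (λ n → when (prime? n) (f n))

  ∑<-single : ∀ n {q} (f : ℕ → ℝ) → q ℕ.< n → ∑< n (λ i → when (i ℕ.≟ q) (f i)) ≈ f q
  ∑<-single (suc n) {q} f (s≤s q≤n) = [ earlier , last ]′ (ℕ.m≤n⇒m<n∨m≡n q≤n)
    where
    earlier : q ℕ.< n → ∑< (suc n) (λ i → when (i ℕ.≟ q) (f i)) ≈ f q
    earlier q<n = trans (+-cong (∑<-single n f q<n) (when-no (n ℕ.≟ q) (λ e → ℕ.<⇒≢ q<n (≡.sym e))))
      (+-identityʳ _)
    last : q ≡ n → ∑< (suc n) (λ i → when (i ℕ.≟ q) (f i)) ≈ f q
    last ≡.refl = trans (+-cong (trans (∑<-cong n λ i i<n → when-no (i ℕ.≟ q) (ℕ.<⇒≢ i<n)) (∑<-zero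
      n))
      (when-yes (q ℕ.≟ q) ≡.refl)) (+-identityˡ _)

  ∑ₚ-single : ∀ N {q} (f : ℕ → ℝ) → Prime q → q ℕ.≤ N → ∑ₚ N (λ p → when (p ℕ.≟ q) (f p)) ≈ f q
  ∑ₚ-single N {q} f pr q≤N = trans (∑<-cong (suc N) λ n _ → when-when n (n ℕ.≟ q)) (∑<-single (suc
    N) f (s≤s q≤N))
    where
    when-when : ∀ n (d : Dec (n ≡ q)) → when (prime? n) (when d (f n)) ≈ when d (f n)
    when-when n (no _)       = when-zero (prime? n)
    when-when n (yes ≡.refl) = when-yes (prime? n) pr

  0<ιp : ∀ {p} → Prime p → 0# < ι p
  0<ιp pr = 0<ι (prime⇒≥1 pr)

  1≤ιn : ∀ {n} → 1 ℕ.≤ n → 1# ≤ ι n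
  1≤ιn {n} 1≤n = ≤-trans (≈⇒≤ (sym (+-identityʳ 1#))) (ι-mono-≤ 1≤n)

  0≤logι : ∀ {n} → 1 ℕ.≤ n → 0# ≤ log (ι n)
  0≤logι 1≤n = 0≤log (1≤ιn 1≤n)

  logι-mono : ∀ {m n} → 1 ℕ.≤ m → m ℕ.≤ n → log (ι m) ≤ log (ι n)
  logι-mono 1≤m m≤n = log-mono-≤ (0<ι 1≤m) (ι-mono-≤ m≤n)

  log-diff-≤ : ∀ {x y} → 0# < x → 0# < y → log y - log x ≤ (y - x) * x ⁻¹
  log-diff-≤ {x} {y} 0<x 0<y = by≤ (gap≤ (log≤x-1 0<y/x) ≤+≤ gap≈˘ (log-* 0<y (0<x⁻¹ 0<x)) ≤+≤ gap≈˘
    (log-⁻¹ 0<x) ≤+≤ gap≈ (x*x⁻¹≈1 0<x)) (solve 7 (λ a b c d e f g → (a :- b) :* c :- (d :- e) := a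
      :*
    c :- κ 1 :- f :+ (f :- (d :+ g) :+ (g :- :- e :+ (κ 1 :- b :* c)))) refl _ _ _ _ _ _ _)
    where
    0<y/x : 0# < y * x ⁻¹
    0<y/x = *-pos _ _ 0<y (0<x⁻¹ 0<x)

  log-diff-≥ : ∀ {x y} → 0# < x → 0# < y → (y - x) * y ⁻¹ ≤ log y - log x
  log-diff-≥ {x} {y} 0<x 0<y = by≤ (gap≤ (log-diff-≤ 0<y 0<x)) (solve 5 (λ a b c d e → a :- b :- (c
    :-
    d) :* e := (d :- c) :* e :- (b :- a)) refl _ _ _ _ _)

  -- Logarithms of factorials and their prime factorisation.

  logFactorial : ℕ → ℝ
  logFactorial N = ∑< N (λ i → log (ι (suc i)))

  -- Strong induction on n: splitting off a prime factor q lowers the multiplicity of q by one and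
  -- changes no other. The range N is kept fixed, so that the sums for different n can be added.
  log-factorisation : ∀ {N} n → 1 ℕ.≤ n → n ℕ.≤ N → log (ι n) ≈ ∑ₚ N (λ p → ι (multiplicity p n) *
    log (ι p))
  log-factorisation {N} = <-rec _ step
    where
    Goal : ℕ → Set
    Goal n = 1 ℕ.≤ n → n ℕ.≤ N → log (ι n) ≈ ∑ₚ N (λ p → ι (multiplicity p n) * log (ι p))
    step : ∀ n → (∀ {m} → m ℕ.< n → Goal m) → Goal n
    step n rec 1≤n n≤N = [ composite , one ]′ (ℕ.m≤n⇒m<n∨m≡n 1≤n)
      where
      one : 1 ≡ n → log (ι n) ≈ ∑ₚ N (λ p → ι (multiplicity p n) * log (ι p))
      one ≡.refl = trans (trans (log-cong (0<ι-suc 0) (+-identityʳ 1#)) log-1) (sym (∑ₚ-zero N λ p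
        pr _ →
        trans (*-congʳ (reflexive (≡.cong ι (multiplicity-∤ {n = 1} pr ℕ.≤-refl λ p∣1 → ¬prime[1]
          (≡.subst Prime (ℕ.∣1⇒≡1 p∣1) pr))))) (zeroˡ _)))
      composite : 2 ℕ.≤ n → log (ι n) ≈ ∑ₚ N (λ p → ι (multiplicity p n) * log (ι p))
      composite 2≤n = go (prime-divisor n 2≤n)
        where
        go : ∃[ q ] ∃[ m ] Prime q × 1 ℕ.≤ m × m ℕ.< n × n ≡ q ℕ.* m → log (ι n) ≈ ∑ₚ N (λ p → ι
          (multiplicity p n) * log (ι p))
        go (q , m , qr , 1≤m , m<n , ≡.refl) = begin
          log (ι (q ℕ.* m))        ≈⟨ log-cong (0<ι 1≤n) (ι-* q m) ⟩
          log (ι q * ι m)          ≈⟨ log-* (0<ιp qr) (0<ι 1≤m) ⟩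
          log (ι q) + log (ι m) ≈⟨ +-cong (sym (∑ₚ-single N (λ p → log (ι p)) qr q≤N)) (rec m<n 1≤m
            (ℕ.≤-trans (ℕ.<⇒≤ m<n) n≤N)) ⟩
          ∑ₚ N (λ p → when (p ℕ.≟ q) (log (ι p))) + ∑ₚ N (λ p → ι (multiplicity p m) * log (ι p))
                                   ≈⟨ ∑ₚ-+ N (λ p → when (p ℕ.≟ q) (log (ι p))) (λ p → ι
                                     (multiplicity p m) * log (ι p)) ⟨
          ∑ₚ N (λ p → when (p ℕ.≟ q) (log (ι p)) + ι (multiplicity p m) * log (ι p))
                                   ≈⟨ ∑ₚ-cong N (λ p pr _ → merge p pr (p ℕ.≟ q)) ⟩
          ∑ₚ N (λ p → ι (multiplicity p (q ℕ.* m)) * log (ι p)) ∎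
          where
          open import Relation.Binary.Reasoning.Setoid setoid
          q≤N : q ℕ.≤ N
          q≤N = ℕ.≤-trans (k≤k*p 1≤m q) n≤N
          merge : ∀ p → Prime p → (d : Dec (p ≡ q)) →
                  when d (log (ι p)) + ι (multiplicity p m) * log (ι p) ≈ ι (multiplicity p (q ℕ.*
                    m)) * log (ι p)
          merge p pr (yes ≡.refl) = trans (solve 2 (λ a b → a :+ b :* a := (κ 1 :+ b) :* a) refl _
            _)
            (*-congʳ (reflexive (≡.cong ι (≡.sym (multiplicity-p* pr 1≤m)))))
          merge p pr (no p≢q) = trans (+-identityˡ _) (*-congʳ (reflexive (≡.cong ι (≡.sym
            (multiplicity-q* pr qr p≢q 1≤m)))))

  -- The range M may exceed N, so that n! and (2n)! can be compared prime by prime in `θ-double`.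
  legendre-formula : ∀ {M} N → N ℕ.≤ M → logFactorial N ≈ ∑ₚ M (λ p → ι (legendre p N) * log (ι p))
  legendre-formula {M} zero    _   = sym (∑ₚ-zero M λ p _ _ → zeroˡ _)
  legendre-formula {M} (suc N) N<M = begin
    logFactorial N + log (ι (suc N))
      ≈⟨ +-cong (legendre-formula N (ℕ.<⇒≤ N<M)) (log-factorisation (suc N) (s≤s z≤n) N<M) ⟩
    ∑ₚ M (λ p → ι (legendre p N) * log (ι p)) + ∑ₚ M (λ p → ι (multiplicity p (suc N)) * log (ι p))
      ≈⟨ ∑ₚ-+ M (λ p → ι (legendre p N) * log (ι p)) (λ p → ι (multiplicity p (suc N)) * log (ι p))
        ⟨
    ∑ₚ M (λ p → ι (legendre p N) * log (ι p) + ι (multiplicity p (suc N)) * log (ι p))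
      ≈⟨ ∑ₚ-cong M (λ p _ _ → trans (sym (distribʳ _ _ _)) (*-congʳ (sym (ι-+ (legendre p N)
        (multiplicity p (suc N)))))) ⟩
    ∑ₚ M (λ p → ι (legendre p (suc N)) * log (ι p)) ∎
    where open import Relation.Binary.Reasoning.Setoid setoid

  ∑<-const : ∀ n c → ∑< n (λ _ → c) ≈ ι n * c
  ∑<-const zero    c = sym (zeroˡ c)
  ∑<-const (suc n) c = by≈ (gap≈0 (∑<-const n c)) (solve 3 (λ a b c → (κ 1 :+ a) :* b :- (c :+ b) :=
    a
    :* b :- c) refl _ _ _)

  logFactorial-≤ : ∀ N → logFactorial N ≤ ι N * log (ι N)
  logFactorial-≤ N = ≤-trans (∑<-mono N λ i i<N → logι-mono (s≤s z≤n) i<N) (≈⇒≤ (∑<-const N (log (ι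
    N))))

  log-suc-≤ : ∀ {n} → 1 ℕ.≤ n → log (ι (suc n)) - log (ι n) ≤ ι n ⁻¹
  log-suc-≤ {n} 1≤n = by≤ (gap≤ (log-diff-≤ (0<ι 1≤n) (0<ι-suc n))) (solve 4 (λ a b c d → a :- (b :-
    c) := (κ 1 :+ d :- d) :* a :- (b :- c)) refl _ _ _ _)

  -- The step adds log (N+1) on the right, and N log (N+1) - N log N ≤ 1 bounds the increase on the
  -- left.
  logFactorial-≥ : ∀ N → 1 ℕ.≤ N → ι N * log (ι N) - ι N ≤ logFactorial N
  logFactorial-≥ (suc zero) _ = by≤ 0≤1 (solve 1 (λ a → κ 0 :+ a :- ((κ 1 :+ κ 0) :* a :- (κ 1 :+
    κ 0)) := κ 1) refl _)
  logFactorial-≥ (suc N@(suc _)) _ = by≤ (gap≤ (logFactorial-≥ N (s≤s z≤n)) ≤+≤ gap≤ (*-monoˡ-≤ (ι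
    N)
    (0≤ι N) (log-suc-≤ {N} (s≤s z≤n))) ≤+≤ gap≈ (x*x⁻¹≈1 (0<ι {N} (s≤s z≤n)))) (solve 5 (λ a b c d e
      →
    a :+ b :- ((κ 1 :+ c) :* b :- (κ 1 :+ c)) := a :- (c :* d :- c) :+ (c :* e :- c :* (b :- d) :+
      (κ
    1 :- c :* e))) refl _ _ _ _ _)

  log2≤1 : log (ι 2) ≤ 1#
  log2≤1 = by≤ (gap≤ (log≤x-1 (0<ι-suc 1))) (solve 1 (λ a → κ 1 :- a := κ 2 :- κ 1 :- a) refl _)

  -- A weak form of the bound 4ⁿ for the central binomial coefficient: the step multiplies (2n)! by
  -- (2n+1)(2n+2) ≤ (2(n+1))², and log 2 is replaced by 1.
  logFactorial-double : ∀ n → logFactorial (n ℕ.+ n) ≤ logFactorial n + logFactorial n + ι (n ℕ.+ n)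
  logFactorial-double zero    = by≤ ≤-refl (solve 1 (λ a → κ 0 :+ κ 0 :+ κ 0 :- κ 0 := κ 0) refl 0#)
  logFactorial-double (suc n) = ≡.subst (λ k → logFactorial (suc k) ≤ logFactorial (suc n) +
    logFactorial (suc n) + ι (suc k)) (≡.sym (ℕ.+-suc n n)) (by≤
    (gap≤ (logFactorial-double n) ≤+≤ gap≤ (logι-mono (s≤s z≤n) (ℕ.n≤1+n (suc (n ℕ.+ n)))) ≤+≤
      scale≤
    2 (gap≈ log-2+2n) ≤+≤ scale≤ 2 (gap≤ log2≤1)) (solve 7 (λ a b c d e f g → a :+ b :+ (a :+ b) :+
      (κ
    1 :+ (κ 1 :+ c)) :- (d :+ e :+ f) := a :+ a :+ c :- d :+ (f :- e :+ (κ 2 :* (g :+ b :- f) :+ κ 2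
    :* (κ 1 :- g)))) refl _ _ _ _ _ _ _))
    where
    log-2+2n : log (ι (suc (suc (n ℕ.+ n)))) ≈ log (ι 2) + log (ι (suc n))
    log-2+2n = trans (log-cong (0<ι-suc (suc (n ℕ.+ n)))
      (by≈ (gap≈0 (ι-+ n n)) (solve 2 (λ a b → κ 2 :* (κ 1 :+ a) :- (κ 1 :+ (κ 1 :+ b)) := a :+ a :-
        b) refl _ _))) (log-* (0<ι-suc 1) (0<ι-suc n))

  -- Chebyshev's upper bound for θ.

  θ : ℕ → ℝ
  θ N = ∑ₚ N (λ p → log (ι p))

  0≤logp : ∀ {p} → Prime p → 0# ≤ log (ι p)
  0≤logp pr = 0≤logι (prime⇒≥1 pr)

  -- In (2n)!/(n!)² a prime p has exponent c(p) ≥ 0, and c(p) ≥ 1 if n < p ≤ 2n. Hence θ(2n) - θ(n)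
  -- is at most the logarithm of that quotient, which is at most 2n.
  θ-double : ∀ n → θ (n ℕ.+ n) ≤ θ n + ι (n ℕ.+ n)
  θ-double n = by≤ (gap≈ (∑ₚ-split n n (λ p → log (ι p))) ≤+≤ gap≤ (∑<-mono n tail) ≤+≤ gap≈˘
    (∑ₚ-split n n f) ≤+≤ ∑ₚ-nonneg n (λ p pr _ → *-nonneg (0≤c p pr) (0≤logp pr)) ≤+≤ gap≈ ∑ₚ-f ≤+≤
    gap≤ (logFactorial-double n)) (solve 9 (λ a b c d e f g h i → a :+ b :- c := a :+ d :- c :+ (e
      :-
    d :+ (f :- (g :+ e) :+ (g :+ (h :- (f :+ (i :+ i)) :+ (i :+ i :+ b :- h)))))) refl _ _ _ _ _ _ _
      _
    _)
    where
    c f : ℕ → ℝ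
    c p = ι (legendre p (n ℕ.+ n)) - (ι (legendre p n) + ι (legendre p n))
    f p = c p * log (ι p)
    0≤c : ∀ p → Prime p → 0# ≤ c p
    0≤c p pr = by≤ (gap≤ (ι-mono-≤ (legendre-double pr n)) ≤+≤ gap≈˘ (ι-+ (legendre p n) (legendre p
      n))) (solve 3 (λ a b c → a :- (b :+ b) :- κ 0 := a :- c :+ (c :- (b :+ b))) refl _ _ _)
    1≤c : ∀ p → Prime p → n ℕ.< p → p ℕ.≤ n ℕ.+ n → 1# ≤ c p
    1≤c p pr n<p p≤2n = by≤ (gap≤ (1≤ιn (legendre-pos pr p≤2n)) ≤+≤ scale≤ 2 (gap≈ (reflexive
      (≡.cong
      ι (legendre-small pr n<p))))) (solve 2 (λ a b → a :- (b :+ b) :- κ 1 := a :- κ 1 :+ κ 2 :* (κ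
        0
      :- b)) refl _ _)
    tail : ∀ i → i ℕ.< n → when (prime? (suc n ℕ.+ i)) (log (ι (suc n ℕ.+ i))) ≤ when (prime? (suc n
      ℕ.+ i)) (f (suc n ℕ.+ i))
    tail i i<n = when-mono (prime? (suc n ℕ.+ i)) λ pr → ≤-trans (≈⇒≤ (sym (*-identityˡ _)))
      (*-monoʳ-≤ _ (0≤logp pr) (1≤c (suc n ℕ.+ i) pr (s≤s (ℕ.m≤m+n n i)) (ℕ.≤-trans (ℕ.≤-reflexive
        (≡.sym (ℕ.+-suc n i))) (ℕ.+-monoʳ-≤ n i<n))))
    ∑ₚ-f : ∑ₚ (n ℕ.+ n) f + (logFactorial n + logFactorial n) ≈ logFactorial (n ℕ.+ n)
    ∑ₚ-f = begin
      ∑ₚ (n ℕ.+ n) f + (logFactorial n + logFactorial n)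
        ≈⟨ +-congˡ (+-cong (legendre-formula n (ℕ.m≤m+n n n)) (legendre-formula n (ℕ.m≤m+n n n))) ⟩
      ∑ₚ (n ℕ.+ n) f + (∑ₚ (n ℕ.+ n) g + ∑ₚ (n ℕ.+ n) g)
        ≈⟨ +-congˡ (∑ₚ-+ (n ℕ.+ n) g g) ⟨
      ∑ₚ (n ℕ.+ n) f + ∑ₚ (n ℕ.+ n) (λ p → g p + g p)
        ≈⟨ ∑ₚ-+ (n ℕ.+ n) f (λ p → g p + g p) ⟨
      ∑ₚ (n ℕ.+ n) (λ p → f p + (g p + g p))
        ≈⟨ ∑ₚ-cong (n ℕ.+ n) (λ p _ _ → (solve 3 (λ a b c → (a :- (b :+ b)) :* c :+ (b :* c :+ b :*
          c)
          := a :* c) refl _ _ _)) ⟩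
      ∑ₚ (n ℕ.+ n) (λ p → ι (legendre p (n ℕ.+ n)) * log (ι p))
        ≈⟨ legendre-formula (n ℕ.+ n) ℕ.≤-refl ⟨
      logFactorial (n ℕ.+ n) ∎
      where
      open import Relation.Binary.Reasoning.Setoid setoid
      g : ℕ → ℝ
      g p = ι (legendre p n) * log (ι p)

  parity : ∀ N → ∃[ n ] (N ≡ n ℕ.+ n ⊎ N ≡ suc (n ℕ.+ n))
  parity zero    = 0 , inj₁ ≡.refl
  parity (suc N) with parity N
  ... | n , inj₁ e = n , inj₂ (≡.cong suc e)
  ... | n , inj₂ e = suc n , inj₁ (≡.cong suc (≡.trans e (≡.sym (ℕ.+-suc n n))))

  -- Halving gives θ(2n) ≤ 4n + 2n. At an odd index the additional term log (2n+1) ≤ 2n still fits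
  -- below 4(2n+1).
  θ-≤ : ∀ N → θ N ≤ ι 4 * ι N
  θ-≤ = <-rec _ step
    where
    step : ∀ N → (∀ {m} → m ℕ.< N → θ m ≤ ι 4 * ι m) → θ N ≤ ι 4 * ι N
    step zero rec = ≈⇒≤ (trans (trans (+-identityˡ _) (when-no (prime? 0) {log (ι 0)} ¬prime[0]))
      (sym (zeroʳ (ι 4))))
    step (suc N) rec = go (parity (suc N))
      where
      go : ∃[ n ] (suc N ≡ n ℕ.+ n ⊎ suc N ≡ suc (n ℕ.+ n)) → θ (suc N) ≤ ι 4 * ι (suc N)
      go (n , inj₁ e) = ≡.subst (λ N → θ N ≤ ι 4 * ι N) (≡.sym e) (by≤ (gap≤ (θ-double n) ≤+≤ gap≤
        (rec n<2n) ≤+≤ scale≤ 2 (0≤ι n) ≤+≤ scale≤ 3 (gap≈˘ (ι-+ n n))) (solve 4 (λ a b c d → κ 4 :*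
          a
        :- b := c :+ a :- b :+ (κ 4 :* d :- c :+ (κ 2 :* d :+ κ 3 :* (a :- (d :+ d))))) refl _ _ _
          _))
        where
        n<2n : n ℕ.< suc N
        n<2n = ≡.subst (n ℕ.<_) (≡.sym e) (ℕ.m<m+n n (ℕ.n≢0⇒n>0 λ { ≡.refl → ℕ.1+n≢0 e }))
      go (n , inj₂ ≡.refl) = by≤ (gap≤ (θ-double n) ≤+≤ gap≤ (rec (s≤s (ℕ.m≤m+n n n))) ≤+≤ scale≤ 2
        (gap≈˘ (ι-+ n n)) ≤+≤ gap≤ (when-≤ (prime? (suc (n ℕ.+ n))) (0≤logι {suc (n ℕ.+ n)} (s≤s
        z≤n))) ≤+≤ gap≤ (log≤x-1 (0<ι-suc (n ℕ.+ n))) ≤+≤ scale≤ 4 0≤1) (solve 6 (λ a b c d e f → κ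
          4
        :* (κ 1 :+ a) :- (b :+ c) := d :+ a :- b :+ (κ 4 :* e :- d :+ (κ 2 :* (a :- (e :+ e)) :+ (f
          :-
        c :+ (κ 1 :+ a :- κ 1 :- f :+ κ 4 :* κ 1))))) refl _ _ _ _ _ _)

  -- Mertens' first theorem.

  A : ℕ → ℝ
  A N = ∑ₚ N (λ p → log (ι p) * ι p ⁻¹)

  -- Since v_p(N!) ≥ N/p - 1, the sum N A(N) is at most θ(N) + log N!; the constant 4 is the one in
  -- `θ-≤`.
  A-≤ : ∀ N → 1 ℕ.≤ N → A N ≤ log (ι N) + ι 4
  A-≤ N 1≤N = *-cancelˡ-≤ (ι N) (0<ι 1≤N) (begin
    ι N * A N ≈⟨ ∑ₚ-*ˡ N (ι N) (λ p → log (ι p) * ι p ⁻¹) ⟨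
    ∑ₚ N (λ p → ι N * (log (ι p) * ι p ⁻¹)) ≤⟨ ∑ₚ-mono N (λ p pr _ → termwise p pr) ⟩
    ∑ₚ N (λ p → log (ι p) + ι (legendre p N) * log (ι p)) ≈⟨ ∑ₚ-+ N (λ p → log (ι p)) (λ p → ι
      (legendre p N) * log (ι p)) ⟩
    θ N + ∑ₚ N (λ p → ι (legendre p N) * log (ι p)) ≈⟨ +-congˡ (legendre-formula N ℕ.≤-refl) ⟨
    θ N + logFactorial N                                     ≤⟨ (by≤ (gap≤ (θ-≤ N) ≤+≤ gap≤
      (logFactorial-≤ N)) (solve 4 (λ a b c d → a :* (b :+ κ 4) :- (c :+ d) := κ 4 :* a :- c :+ (a
        :*
      b :- d)) refl _ _ _ _)) ⟩
    ι N * (log (ι N) + ι 4)                                  ∎)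
    where
    open ≤-Reasoning
    termwise : ∀ p → Prime p → ι N * (log (ι p) * ι p ⁻¹) ≤ log (ι p) + ι (legendre p N) * log (ι p)
    termwise p pr = by≤ (gap≤ (*-monoʳ-≤ (log (ι p) * ι p ⁻¹) (*-nonneg (0≤logp pr) (<⇒≤ (0<x⁻¹
      (0<ιp
      pr)))) N≤) ≤+≤ gap≈ (*-congˡ (x*x⁻¹≈1 (0<ιp pr)))) (solve 5 (λ a b c d e → a :+ b :* a :- c :*
      (a :* d) := (e :+ b :* e) :* (a :* d) :- c :* (a :* d) :+ (a :* (κ 1 :+ b) :* κ 1 :- a :* (κ 1
      :+ b) :* (e :* d))) refl _ _ _ _ _)
      where
      N≤ : ι N ≤ ι p + ι (legendre p N) * ι p
      N≤ = ≤-trans (ι-mono-≤ (legendre-≥ pr N)) (≈⇒≤ (trans (ι-+ p (legendre p N ℕ.* p)) (+-congˡ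
        (ι-* (legendre p N) p))))

  -- The excess of log n/(n-1) over log n/n. It measures the contribution of higher prime powers to
  -- N! in the bound v_p(N!) ≤ N/(p-1).
  tail-term : ℕ → ℝ
  tail-term n = log (ι n) * (ι n ⁻¹ * ι (ℕ.pred n) ⁻¹)

  1/m-1/[1+m] : ∀ {m} → 1 ℕ.≤ m → ι m ⁻¹ - ι (suc m) ⁻¹ ≈ ι m ⁻¹ * ι (suc m) ⁻¹
  1/m-1/[1+m] {m} 1≤m = by≈ (gap≈0˘ (*-congˡ (x*x⁻¹≈1 (0<ι-suc m))) ≈0+≈0 gap≈0 (*-congˡ (x*x⁻¹≈1
    (0<ι
    1≤m)))) (solve 3 (λ a b c → a :* b :- (a :- b) := a :* ((κ 1 :+ c) :* b) :- a :* κ 1 :+ (b :* κ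
      1
    :- b :* (c :* a))) refl _ _ _)

  1≤m⇒1/m≤2/[1+m] : ∀ {m} → 1 ℕ.≤ m → ι m ⁻¹ ≤ ι 2 * ι (suc m) ⁻¹
  1≤m⇒1/m≤2/[1+m] {m} 1≤m = by≤ (gap≈ (1/m-1/[1+m] 1≤m) ≤+≤ gap≤ (*-monoˡ-≤ (ι (suc m) ⁻¹) (<⇒≤
    (0<x⁻¹
    (0<ι-suc m))) (≤-trans (⁻¹-mono-≤ 0<1 (1≤ιn 1≤m)) (≈⇒≤ (sym (⁻¹-unique 0<1 (*-identityˡ
      1#)))))))
    (solve 2 (λ a b → κ 2 :* a :- b := b :* a :- (b :- a) :+ (a :* κ 1 :- a :* b)) refl _ _)

  -- The bound telescopes: (log m + 2)/m decreases by at least tail-term (1 + m).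
  ∑ₚ-tail-term-≤ : ∀ N → 1 ℕ.≤ N → ∑ₚ N tail-term + (log (ι N) + ι 2) * ι N ⁻¹ ≤ ι 2
  ∑ₚ-tail-term-≤ (suc zero) _ = by≤ (gap≈ (when-no (prime? 0) {tail-term 0} ¬prime[0]) ≤+≤ gap≈
    (when-no (prime? 1) {tail-term 1} ¬prime[1]) ≤+≤ gap≈ (*-congʳ (trans (log-cong (0<ι-suc 0)
    (+-identityʳ 1#)) log-1)) ≤+≤ scale≤ 2 (gap≈ ι1⁻¹≈1)) (solve 4 (λ a b c d → κ 2 :- (κ 0 :+ a :+
      b
    :+ (c :+ κ 2) :* d) := κ 0 :- a :+ (κ 0 :- b :+ (κ 0 :* d :- c :* d :+ κ 2 :* (κ 1 :- d)))) refl
      _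
    _ _ _)
  ∑ₚ-tail-term-≤ (suc m@(suc _)) _ = ≤-trans (by≤ (gap≤ (when-≤ (prime? (suc m)) 0≤tail) ≤+≤ gap≈˘
    (*-congˡ {log (ι (suc m)) + ι 2} (1/m-1/[1+m] 1≤m)) ≤+≤ gap≤ (*-monoˡ-≤ (ι m ⁻¹) 0≤1/m
      (log-suc-≤
    1≤m)) ≤+≤ gap≤ (*-monoˡ-≤ (ι m ⁻¹) 0≤1/m (1≤m⇒1/m≤2/[1+m] 1≤m))) (solve 6 (λ a b c d e f → a :+
      (b
    :+ κ 2) :* c :- (a :+ d :+ (e :+ κ 2) :* f) := e :* (f :* c) :- d :+ ((e :+ κ 2) :* (c :- f) :-
      (e
    :+ κ 2) :* (c :* f) :+ (c :* c :- c :* (e :- b) :+ (c :* (κ 2 :* f) :- c :* c)))) refl _ _ _ _ _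
    _))
    (∑ₚ-tail-term-≤ m 1≤m)
    where
    1≤m : 1 ℕ.≤ m
    1≤m = s≤s z≤n
    0≤1/m : 0# ≤ ι m ⁻¹
    0≤1/m = <⇒≤ (0<x⁻¹ (0<ι 1≤m))
    0≤tail : 0# ≤ tail-term (suc m)
    0≤tail = *-nonneg (0≤logι {suc m} (s≤s z≤n)) (*-nonneg (<⇒≤ (0<x⁻¹ (0<ι-suc m))) 0≤1/m)

  -- Here N log N - N ≤ log N!, and by v_p(N!) ≤ N/(p-1) the latter is at most N(A(N) + Σ
  -- `tail-term`). The constant is 3 = 1 + 2, where 2 bounds the tail sum.
  A-≥ : ∀ N → 1 ℕ.≤ N → log (ι N) - ι 3 ≤ A N
  A-≥ N 1≤N = *-cancelˡ-≤ (ι N) (0<ι 1≤N) (by≤ (gap≤ (logFactorial-≥ N 1≤N) ≤+≤ gap≈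
    (legendre-formula
    N ℕ.≤-refl) ≤+≤ gap≤ (∑ₚ-mono N (λ p pr _ → termwise p pr)) ≤+≤ gap≈ (∑ₚ-*ˡ N (ι N) (λ p → log
      (ι
    p) * ι p ⁻¹ + tail-term p)) ≤+≤ gap≈ (*-congˡ (∑ₚ-+ N (λ p → log (ι p) * ι p ⁻¹) tail-term)) ≤+≤
    gap≤ (*-monoˡ-≤ (ι N) (0≤ι N) ∑ₚ-tail≤2)) (solve 8 (λ a b c d e f g h → a :* b :- a :* (c :- κ
      3)
    := d :- (a :* c :- a) :+ (e :- d :+ (f :- e :+ (a :* g :- f :+ (a :* (b :+ h) :- a :* g :+ (a :*
      κ
    2 :- a :* h)))))) refl _ _ _ _ _ _ _ _))
    where
    ∑ₚ-tail≤2 : ∑ₚ N tail-term ≤ ι 2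
    ∑ₚ-tail≤2 = by≤ (gap≤ (∑ₚ-tail-term-≤ N 1≤N) ≤+≤ *-nonneg (0≤logι 1≤N ≤+≤ 0≤ι 2) (<⇒≤ (0<x⁻¹
      (0<ι
      1≤N)))) (solve 3 (λ a b c → κ 2 :- a := κ 2 :- (a :+ (b :+ κ 2) :* c) :+ (b :+ κ 2) :* c) refl
        _
      _ _)
    termwise : ∀ p → Prime p → ι (legendre p N) * log (ι p) ≤ ι N * (log (ι p) * ι p ⁻¹ + tail-term
      p)
    termwise zero    pr = ⊥-elim (¬prime[0] pr)
    termwise (suc m) pr = by≤ (gap≤ (*-monoʳ-≤ (log (ι (suc m)) * ι m ⁻¹) (*-nonneg (0≤logp pr) (<⇒≤
      (0<x⁻¹ (0<ι 1≤m)))) legendre≤) ≤+≤ gap≈˘ (*-congˡ (x*x⁻¹≈1 (0<ι 1≤m))) ≤+≤ gap≈ (*-congˡ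
      (1/m-1/[1+m] 1≤m))) (solve 6 (λ a b c d e f → a :* (b :* c :+ b :* (c :* d)) :- e :* b := a :*
      (b :* d) :- f :* e :* (b :* d) :+ (e :* b :* (f :* d) :- e :* b :* κ 1 :+ (a :* b :* (d :* c)
        :-
      a :* b :* (d :- c)))) refl _ _ _ _ _ _)
      where
      1≤m : 1 ℕ.≤ m
      1≤m = ℕ.≤-pred (prime⇒≥2 pr)
      legendre≤ : ι m * ι (legendre (suc m) N) ≤ ι N
      legendre≤ = ≤-trans (≈⇒≤ (sym (ι-* m (legendre (suc m) N)))) (ι-mono-≤ (legendre-≤ pr N))

  -- A lower bound for the number of primes.

  primeCount : ℕ → ℝ
  primeCount N = ∑ₚ N (λ _ → 1#)

  θ≤log*primeCount : ∀ N → θ N ≤ log (ι N) * primeCount N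
  θ≤log*primeCount N = ≤-trans (∑ₚ-mono N (λ p pr p≤N → ≤-trans (logι-mono (prime⇒≥1 pr) p≤N) (≈⇒≤
    (sym (*-identityʳ _)))))
    (≈⇒≤ (∑ₚ-*ˡ N (log (ι N)) (λ _ → 1#)))

  -- As A(N) lies between log N - 3 and log N + 4, the difference A(N) - A(M) is at least log N -
  -- log M - 7; the exponent 8 makes it at least 1 when N ≥ MK₈.
  e⁸ : ∃[ K ] expℝ (ι 8) < ι (suc K)
  e⁸ = bounded-ℕ (expℝ (ι 8))

  K₈ : ℕ
  K₈ = suc (proj₁ e⁸)

  8≤logK₈ : ι 8 ≤ log (ι K₈)
  8≤logK₈ = ≤-trans (≈⇒≤ (sym (log-exp (ι 8)))) (log-mono-≤ (0<exp (ι 8)) (<⇒≤ (proj₂ e⁸)))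

  -- The primes in (N/K₈, N] contribute at least 1 to A N.
  primeCount-≥ : ∀ N → K₈ ℕ.≤ N → ι N ≤ ι K₈ * (log (ι N) * primeCount N)
  primeCount-≥ N K₈≤N = ≤-trans (go (quotient-remainder {K₈} (s≤s z≤n) N)) (*-monoˡ-≤ (ι K₈) (0≤ι
    K₈) (θ≤log*primeCount N))
    where
    go : ∃[ M ] ∃[ r ] r ℕ.< K₈ × N ≡ r ℕ.+ M ℕ.* K₈ → ι N ≤ ι K₈ * θ N
    go (zero , r , r<K , ≡.refl) = ⊥-elim (ℕ.<⇒≱ r<K (ℕ.≤-trans K₈≤N (ℕ.≤-reflexive (ℕ.+-identityʳ
      r))))
    -- Primes above M have 1/p ≤ 1/(M+1), so 1 ≤ A(N) - A(M) ≤ θ(N)/(M+1); and N ≤ (M+1)K₈.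
    go (M@(suc _) , r , r<K , N≡) = *-cancelˡ-≤ (ι (suc M)) (0<ι-suc M) (by≤ (gap≤ (*-monoʳ-≤ (ι
      (suc
      M) * ι N) (*-nonneg (0≤ι (suc M)) (0≤ι N)) 1≤A-gap) ≤+≤ gap≤ (*-monoʳ-≤ (ι (suc M) * ι N)
      (*-nonneg (0≤ι (suc M)) (0≤ι N)) A-gap≤) ≤+≤ gap≈ (*-congˡ {ι N * θ N} (x*x⁻¹≈1 (0<ι-suc M)))
      ≤+≤ gap≤ (*-monoʳ-≤ (θ N) 0≤θ N≤[1+M]K)) (solve 7 (λ a b c d e f g → (κ 1 :+ a) :* (b :* c) :-
      (κ 1 :+ a) :* d := (e :- f) :* ((κ 1 :+ a) :* d) :- κ 1 :* ((κ 1 :+ a) :* d) :+ (g :* c :* ((κ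
        1
      :+ a) :* d) :- (e :- f) :* ((κ 1 :+ a) :* d) :+ (d :* c :* κ 1 :- d :* c :* ((κ 1 :+ a) :* g)
        :+
      ((κ 1 :+ a) :* b :* c :- d :* c)))) refl _ _ _ _ _ _ _))
      where
      M≤N : M ℕ.≤ N
      M≤N = ℕ.≤-trans (k≤k*p {K₈} (s≤s z≤n) M) (ℕ.≤-trans (ℕ.m≤n+m _ r) (ℕ.≤-reflexive (≡.sym N≡)))
      1≤N : 1 ℕ.≤ N
      1≤N = ℕ.≤-trans (s≤s z≤n) K₈≤N
      0≤θ : 0# ≤ θ N
      0≤θ = ∑ₚ-nonneg N (λ p pr _ → 0≤logp pr)
      N≤[1+M]K : ι N ≤ ι (suc M) * ι K₈
      N≤[1+M]K = ≤-trans (ι-mono-≤ (ℕ.≤-trans (ℕ.≤-reflexive N≡) (ℕ.+-monoˡ-≤ (M ℕ.* K₈) (ℕ.<⇒≤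
        r<K)))) (≈⇒≤ (ι-* (suc M) K₈))
      logM+logK≤logN : log (ι M) + log (ι K₈) ≤ log (ι N)
      logM+logK≤logN = ≤-trans (≈⇒≤ (sym (log-* (0<ι {M} (s≤s z≤n)) (0<ι-suc (proj₁ e⁸)))))
        (≤-trans (≈⇒≤ (log-cong (*-pos _ _ (0<ι {M} (s≤s z≤n)) (0<ι-suc (proj₁ e⁸))) (sym (ι-* M
          K₈))))
          (log-mono-≤ (0<ι {M ℕ.* K₈} (s≤s z≤n)) (ι-mono-≤ (ℕ.≤-trans (ℕ.m≤n+m _ r) (ℕ.≤-reflexive
            (≡.sym N≡))))))
      1≤A-gap : 1# ≤ A N - A M
      1≤A-gap = by≤ (gap≤ (A-≥ N 1≤N) ≤+≤ gap≤ (A-≤ M (s≤s z≤n)) ≤+≤ gap≤ logM+logK≤logN ≤+≤ gap≤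
        8≤logK₈) (solve 5 (λ a b c d e → a :- b :- κ 1 := a :- (c :- κ 3) :+ (d :+ κ 4 :- b :+ (c :-
        (d :+ e) :+ (e :- κ 8)))) refl _ _ _ _ _)
      f g : ℕ → ℝ
      f p = log (ι p) * ι p ⁻¹
      g p = ι (suc M) ⁻¹ * log (ι p)
      A-gap≤ : A N - A M ≤ ι (suc M) ⁻¹ * θ N
      A-gap≤ = gap (ℕ.m≤n⇒∃[o]m+o≡n M≤N)
        where
        gap : ∃[ k ] M ℕ.+ k ≡ N → A N - A M ≤ ι (suc M) ⁻¹ * θ N
        gap (k , ≡.refl) = by≤ (gap≈ (∑ₚ-split M k f) ≤+≤ gap≤ (∑<-mono k (λ i _ → when-mono (prime?
          (suc M ℕ.+ i)) (λ pr → termwise i pr))) ≤+≤ gap≈˘ (∑ₚ-split M k g) ≤+≤ ∑ₚ-nonneg M (λ p pr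
            _
          → *-nonneg (<⇒≤ (0<x⁻¹ (0<ι-suc M))) (0≤logp pr)) ≤+≤ gap≈ (∑ₚ-*ˡ (M ℕ.+ k) (ι (suc M) ⁻¹)
          (λ p → log (ι p)))) (solve 8 (λ a b c d e f g h → a :* b :- (c :- d) := d :+ e :- c :+ (f
            :-
          e :+ (g :- (h :+ f) :+ (h :+ (a :* b :- g))))) refl _ _ _ _ _ _ _ _)
          where
          termwise : ∀ i → Prime (suc M ℕ.+ i) → f (suc M ℕ.+ i) ≤ g (suc M ℕ.+ i)
          termwise i pr = ≤-trans (*-monoˡ-≤ _ (0≤logp pr) (⁻¹-mono-≤ (0<ι-suc M) (ι-mono-≤ (ℕ.m≤m+n
            (suc M) i)))) (≈⇒≤ (*-comm _ _))

  -- Mertens' second theorem.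

  reciprocalSum : ℕ → ℝ
  reciprocalSum N = ∑ₚ N (λ p → ι p ⁻¹)

  loglog : ℕ → ℝ
  loglog n = log (log (ι n))

  ½≤logι : ∀ {n} → 2 ℕ.≤ n → ι 2 ⁻¹ ≤ log (ι n)
  ½≤logι {n} 2≤n = by≤ (gap≤ (1-x⁻¹≤log (0<ι-suc 1)) ≤+≤ gap≈ 2*2⁻¹≈1 ≤+≤ gap≤ (logι-mono (s≤s z≤n)
    2≤n)) (solve 3 (λ a b c → a :- b := c :- (κ 1 :- b) :+ (κ 1 :- κ 2 :* b :+ (a :- c))) refl _ _
      _)

  0<logι : ∀ {n} → 2 ℕ.≤ n → 0# < log (ι n)
  0<logι 2≤n = <-≤-trans 0<2⁻¹ (½≤logι 2≤n)

  1/logι≤2 : ∀ {n} → 2 ℕ.≤ n → log (ι n) ⁻¹ ≤ ι 2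
  1/logι≤2 2≤n = ≤-trans (⁻¹-mono-≤ 0<2⁻¹ (½≤logι 2≤n)) (≈⇒≤ (sym (⁻¹-unique 0<2⁻¹ (trans (*-comm _
    _) 2*2⁻¹≈1))))

  -- reciprocalSum N - (A N - log N)/log N - log log N changes from m to
  -- n = m + 1 by (A m - log m)(1/log m - 1/log n) plus the error in replacing
  -- log log n - log log m by (log n - log m)/log n.
  remainder : ℕ → ℝ
  remainder n = reciprocalSum n - (A n - log (ι n)) * log (ι n) ⁻¹ - loglog n

  remainder-step : ∀ m → 2 ℕ.≤ m → let lm = log (ι m) ; ln = log (ι (suc m)) in
    remainder (suc m) ≈ remainder m + (A m - lm) * (lm ⁻¹ - ln ⁻¹) + ((ln - lm) * ln ⁻¹ - (loglog
      (suc m) - loglog m))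
  remainder-step m 2≤m =
    (by≈ (gap≈0˘ a*ln⁻¹≈c) (solve 10 (λ a b c d e f g h i j → a :- (b :- c) :* d :- e :+ (b :- c) :*
      (d :- f) :+ ((g :- c) :* f :- (h :- e)) :- (a :+ i :- (b :+ j :- g) :* f :- h) := j :* f :- i)
      refl _ _ _ _ _ _ _ _ _ _))
    where
    lm ln a c : ℝ
    lm = log (ι m)
    ln = log (ι (suc m))
    a = when (prime? (suc m)) (log (ι (suc m)) * ι (suc m) ⁻¹)
    c = when (prime? (suc m)) (ι (suc m) ⁻¹)
    a*ln⁻¹≈c : a * ln ⁻¹ ≈ c
    a*ln⁻¹≈c = trans (*-comm _ _) (trans (sym (when-*ˡ (prime? (suc m)) (ln ⁻¹) (ln * ι (suc m)
      ⁻¹)))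
      (when-cong (prime? (suc m)) λ _ → (by≈ (gap≈0 (*-congˡ (x*x⁻¹≈1 (0<logι (ℕ.m<n⇒m<1+n 2≤m)))))
        (solve 3 (λ a b c → a :- b :* (c :* a) := a :* κ 1 :- a :* (c :* b)) refl _ _ _))))

  -- Adding 4/log n makes the sequence decrease: A(m) - log m is at most 4, and the error in log log
  -- is at most 0 because (y - x)/y ≤ log y - log x.
  remainder-≤ : ∀ n → 2 ℕ.≤ n → remainder n + ι 4 * log (ι n) ⁻¹ ≤ remainder 2 + ι 4 * log (ι 2) ⁻¹
  remainder-≤ (suc zero) (s≤s ())
  remainder-≤ (suc (suc zero)) _ = ≤-refl
  remainder-≤ (suc m@(suc (suc _))) _ = ≤-trans
    (by≤ (gap≈ (remainder-step m 2≤m) ≤+≤ gap≤ (log-diff-≥ (0<logι 2≤m) (0<logι 2≤n)) ≤+≤ gap≤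
      (*-monoʳ-≤ (lm ⁻¹ - ln ⁻¹) 0≤gap D≤4)) (solve 9 (λ a b c d e f g h i → a :+ κ 4 :* b :- (c :+
        κ
      4 :* d) := a :+ (e :- f) :* (b :- d) :+ ((g :- f) :* d :- (h :- i)) :- c :+ (h :- i :- (g :-
        f)
      :* d :+ (κ 4 :* (b :- d) :- (e :- f) :* (b :- d)))) refl _ _ _ _ _ _ _ _ _))
    (remainder-≤ m 2≤m)
    where
    2≤m : 2 ℕ.≤ m
    2≤m = s≤s (s≤s z≤n)
    2≤n : 2 ℕ.≤ suc m
    2≤n = s≤s (s≤s z≤n)
    lm ln : ℝ
    lm = log (ι m)
    ln = log (ι (suc m))
    0≤gap : 0# ≤ lm ⁻¹ - ln ⁻¹
    0≤gap = gap≤ (⁻¹-mono-≤ (0<logι 2≤m) (logι-mono (s≤s z≤n) (ℕ.n≤1+n m)))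
    D≤4 : A m - lm ≤ ι 4
    D≤4 = by≤ (gap≤ (A-≤ m (s≤s z≤n))) (solve 2 (λ a b → κ 4 :- (a :- b) := b :+ κ 4 :- a) refl _ _)

  -- Subtracting 4/log (n+1) and 4/n makes the sequence increase. The first absorbs A(m) - log m ≥
  -- -4. The second absorbs the error in log log, which is at least -(log (m+1) - log m)²/(log m log
  -- (m+1)), hence at least -4/m² because 1/log m ≤ 2; and 1/m² ≤ 1/(m-1) - 1/m telescopes.
  remainder-≥ : ∀ n → 1 ℕ.≤ n → remainder 2 - ι 4 * log (ι 2) ⁻¹ - ι 4 * ι 1 ⁻¹ ≤ remainder (suc n)
    - ι 4 * log (ι (suc n)) ⁻¹ - ι 4 * ι n ⁻¹
  remainder-≥ (suc zero) _ = ≤-refl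
  remainder-≥ m@(suc k@(suc _)) _ = ≤-trans (remainder-≥ k (s≤s z≤n))
    (by≤ (gap≈˘ (remainder-step m 2≤m) ≤+≤ gap≤ (log-diff-≤ (0<logι 2≤m) (0<logι 2≤n)) ≤+≤ gap≤
      (*-monoʳ-≤ (lm ⁻¹ - ln ⁻¹) 0≤gap -4≤D) ≤+≤ gap≤ error) (solve 11 (λ a b c d e f g h i j k → a
        :-
      κ 4 :* b :- κ 4 :* c :- (d :- κ 4 :* e :- κ 4 :* f) := a :- (d :+ (g :- h) :* (e :- b) :+ ((i
        :-
      h) :* b :- (j :- k))) :+ ((i :- h) :* e :- (j :- k) :+ ((g :- h) :* (e :- b) :- :- κ 4 :* (e
        :-
      b) :+ (κ 4 :* (f :- c) :- (i :- h) :* (e :- b))))) refl _ _ _ _ _ _ _ _ _ _ _))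
    where
    2≤m : 2 ℕ.≤ m
    2≤m = s≤s (s≤s z≤n)
    2≤n : 2 ℕ.≤ suc m
    2≤n = s≤s (s≤s z≤n)
    lm ln : ℝ
    lm = log (ι m)
    ln = log (ι (suc m))
    0≤gap : 0# ≤ lm ⁻¹ - ln ⁻¹
    0≤gap = gap≤ (⁻¹-mono-≤ (0<logι 2≤m) (logι-mono (s≤s z≤n) (ℕ.n≤1+n m)))
    -4≤D : - ι 4 ≤ A m - lm
    -4≤D = by≤ (gap≤ (A-≥ m (s≤s z≤n)) ≤+≤ 0≤1) (solve 2 (λ a b → a :- b :- :- κ 4 := a :- (b :- κ
      3)
      :+ κ 1) refl _ _)
    0≤ln-lm : 0# ≤ ln - lm
    0≤ln-lm = gap≤ (logι-mono (s≤s z≤n) (ℕ.n≤1+n m))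
    0≤lm⁻¹ : 0# ≤ lm ⁻¹
    0≤lm⁻¹ = <⇒≤ (0<x⁻¹ (0<logι 2≤m))
    0≤ln⁻¹ : 0# ≤ ln ⁻¹
    0≤ln⁻¹ = <⇒≤ (0<x⁻¹ (0<logι 2≤n))
    0≤1/m : 0# ≤ ι m ⁻¹
    0≤1/m = <⇒≤ (0<x⁻¹ (0<ι-suc k))
    gap≈ln-lm : lm ⁻¹ - ln ⁻¹ ≈ (ln - lm) * (lm ⁻¹ * ln ⁻¹)
    gap≈ln-lm = by≈ (gap≈0˘ (*-congˡ {lm ⁻¹} (x*x⁻¹≈1 (0<logι 2≤n))) ≈0+≈0 gap≈0 (*-congˡ {ln ⁻¹}
      (x*x⁻¹≈1 (0<logι 2≤m)))) (solve 4 (λ a b c d → (a :- b) :* (c :* d) :- (c :- d) := c :* (a :*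
        d)
      :- c :* κ 1 :+ (d :* κ 1 :- d :* (b :* c))) refl _ _ _ _)
    error : (ln - lm) * (lm ⁻¹ - ln ⁻¹) ≤ ι 4 * (ι k ⁻¹ - ι m ⁻¹)
    error = begin
      (ln - lm) * (lm ⁻¹ - ln ⁻¹)                     ≈⟨ *-congˡ gap≈ln-lm ⟩
      (ln - lm) * ((ln - lm) * (lm ⁻¹ * ln ⁻¹)) ≤⟨ *-mono-≤ 0≤ln-lm (*-nonneg 0≤ln-lm (*-nonneg
        0≤lm⁻¹ 0≤ln⁻¹)) (log-suc-≤ {m} (s≤s z≤n))
                                                           (*-mono-≤ 0≤ln-lm (*-nonneg 0≤lm⁻¹
                                                             0≤ln⁻¹) (log-suc-≤ {m} (s≤s z≤n))
                                                             (*-mono-≤ 0≤lm⁻¹ 0≤ln⁻¹ (1/logι≤2 2≤m)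
                                                               (1/logι≤2 2≤n))) ⟩
      ι m ⁻¹ * (ι m ⁻¹ * (ι 2 * ι 2))                 ≤⟨ (by≤ (scale≤ 4 (gap≈˘ (1/m-1/[1+m] {k} (s≤s
        z≤n))) ≤+≤ scale≤ 4 (gap≤ (*-monoʳ-≤ (ι m ⁻¹) 0≤1/m (⁻¹-mono-≤ (0<ι {k} (s≤s z≤n)) (ι-mono-≤
        (ℕ.n≤1+n k)))))) (solve 2 (λ a b → κ 4 :* (a :- b) :- b :* (b :* (κ 2 :* κ 2)) := κ 4 :* (a
          :-
        b :- a :* b) :+ κ 4 :* (a :* b :- b :* b)) refl _ _)) ⟩
      ι 4 * (ι k ⁻¹ - ι m ⁻¹)                         ∎
      where open ≤-Reasoning

  mertens : ∃[ K ] ∀ n → 2 ℕ.≤ n → ∣ reciprocalSum n - loglog n ∣ℝ ≤ K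
  -- A generous constant: the initial corrections 4/log 2 ≤ 8 and 4/1 add up to 12.
  mertens = ∣ remainder 2 ∣ℝ + ι 24 , λ n 2≤n → ∣∣-≤
    (by≤ (gap≤ (remainder-≤ n 2≤n) ≤+≤ gap≤ (∣∣-upper (remainder 2)) ≤+≤ scale≤ 4 (gap≤ (1/logι≤2
      ℕ.≤-refl)) ≤+≤ gap≤ (*-monoʳ-≤ (log (ι n) ⁻¹) (<⇒≤ (0<x⁻¹ (0<logι 2≤n))) (A-≤ n (ℕ.<⇒≤ 2≤n)))
      ≤+≤ scale≤ 16 0≤1) (solve 8 (λ a b c d e f g h → a :+ κ 24 :- (b :- c) := d :+ κ 4 :* e :- (b
        :-
      (f :- g) :* h :- c :+ κ 4 :* h) :+ (a :- d :+ (κ 4 :* (κ 2 :- e) :+ ((g :+ κ 4) :* h :- f :* h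
      :+ κ 16 :* κ 1)))) refl _ _ _ _ _ _ _ _))
    (lower n 2≤n)
    where
    lower : ∀ n → 2 ℕ.≤ n → - (reciprocalSum n - loglog n) ≤ ∣ remainder 2 ∣ℝ + ι 24
    lower (suc n) (s≤s 1≤n) = by≤ (gap≤ (remainder-≥ n 1≤n) ≤+≤ gap≤ (∣∣-lower (remainder 2)) ≤+≤
      scale≤ 4 (gap≤ (1/logι≤2 ℕ.≤-refl)) ≤+≤ scale≤ 4 (gap≈ ι1⁻¹≈1) ≤+≤ scale≤ 4 (<⇒≤ (0<x⁻¹ (0<ι
      1≤n))) ≤+≤ <⇒≤ (0<x⁻¹ (0<logι (s≤s 1≤n))) ≤+≤ gap≤ (*-monoʳ-≤ (log (ι (suc n)) ⁻¹) (<⇒≤ (0<x⁻¹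
      (0<logι (s≤s 1≤n)))) (A-≥ (suc n) (s≤s z≤n))) ≤+≤ scale≤ 12 0≤1) (solve 10 (λ a b c d e f g h
        i
      j → a :+ κ 24 :- :- (b :- c) := b :- (d :- e) :* f :- c :- κ 4 :* f :- κ 4 :* g :- (h :- κ 4
        :*
      i :- κ 4 :* j) :+ (a :- :- h :+ (κ 4 :* (κ 2 :- i) :+ (κ 4 :* (κ 1 :- j) :+ (κ 4 :* g :+ (f :+
      (d :* f :- (e :- κ 3) :* f :+ κ 12 :* κ 1))))))) refl _ _ _ _ _ _ _ _ _ _)

  -- Bounded series and the weights 1/√n.

  bounded-series : ∀ {a b B} n₀ → (∀ i → ∣ a (n₀ ℕ.+ i) ∣ℝ ≤ b i) → (∀ k → ∑< k b ≤ B) →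
                   ∃[ K ] ∀ n → ∣ ∑< n a ∣ℝ ≤ K
  bounded-series {a} {b} {B} n₀ a≤b ∑b≤B = ∑< n₀ ∣a∣ + B , λ n → ≤-trans (∣∑<∣ n a)
    (by≤ (gap≤ (∑<-monoˡ ∣a∣ (λ i → 0≤∣∣ (a i)) (ℕ.m≤n+m n n₀)) ≤+≤ gap≈ (∑<-split n₀ n ∣a∣) ≤+≤
      gap≤
      (∑<-mono n (λ i _ → a≤b i)) ≤+≤ gap≤ (∑b≤B n)) (solve 6 (λ a b c d e f → a :+ b :- c := d :- c
      :+ (a :+ e :- d :+ (f :- e :+ (b :- f)))) refl _ _ _ _ _ _))
    where
    ∣a∣ : ℕ → ℝ
    ∣a∣ i = ∣ a i ∣ℝ

  term≤∑< : ∀ n f {i} → (∀ i → 0# ≤ f i) → i ℕ.< n → f i ≤ ∑< n f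
  term≤∑< n f {i} 0≤f i<n = ≤-trans (by≤ (∑<-nonneg i (λ j _ → 0≤f j)) (solve 2 (λ a b → a :+ b :- b
    := a) refl _ _)) (∑<-monoˡ f 0≤f i<n)

  eventually-bounded : ∀ {u : ℕ → ℝ} {B} n₀ → (∀ n → n₀ ℕ.≤ n → ∣ u n ∣ℝ ≤ B) → ∃[ K ] ∀ n → ∣ u n
    ∣ℝ ≤ K
  eventually-bounded {u} {B} n₀ h = ∣ B ∣ℝ + ∑< n₀ (λ i → ∣ u i ∣ℝ) , λ n → [ early n , late n ]′
    (ℕ.<-≤-connex n n₀)
    where
    early : ∀ n → n ℕ.< n₀ → ∣ u n ∣ℝ ≤ ∣ B ∣ℝ + ∑< n₀ (λ i → ∣ u i ∣ℝ)
    early n n<n₀ = by≤ (gap≤ (term≤∑< n₀ (λ i → ∣ u i ∣ℝ) (λ i → 0≤∣∣ (u i)) n<n₀) ≤+≤ 0≤∣∣ B)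
      (solve
      3 (λ a b c → a :+ b :- c := b :- c :+ a) refl _ _ _)
    late : ∀ n → n₀ ℕ.≤ n → ∣ u n ∣ℝ ≤ ∣ B ∣ℝ + ∑< n₀ (λ i → ∣ u i ∣ℝ)
    late n n₀≤n = by≤ (gap≤ (h n n₀≤n) ≤+≤ gap≤ (∣∣-upper B) ≤+≤ ∑<-nonneg n₀ (λ i _ → 0≤∣∣ (u i)))
      (solve 4 (λ a b c d → a :+ b :- c := d :- c :+ (a :- d :+ b)) refl _ _ _ _)

  w : ℕ → ℝ
  w n = √ (ι n) ⁻¹

  0<√ι : ∀ {n} → 1 ℕ.≤ n → 0# < √ (ι n)
  0<√ι 1≤n = 0<√ (0<ι 1≤n)

  0<w : ∀ {n} → 1 ℕ.≤ n → 0# < w n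
  0<w 1≤n = 0<x⁻¹ (0<√ι 1≤n)

  √*w≈1 : ∀ {n} → 1 ℕ.≤ n → √ (ι n) * w n ≈ 1#
  √*w≈1 1≤n = x*x⁻¹≈1 (0<√ι 1≤n)

  w*w : ∀ {n} → 1 ℕ.≤ n → w n * w n ≈ ι n ⁻¹
  w*w {n} 1≤n = ⁻¹-unique (0<ι 1≤n) (begin
    ι n * (w n * w n)                        ≈⟨ *-congʳ (√*√ (0≤ι n)) ⟨
    √ (ι n) * √ (ι n) * (w n * w n)          ≈⟨ (solve 2 (λ a b → a :* a :* (b :* b) := a :* b :* (a
      :* b)) refl _ _) ⟩
    √ (ι n) * w n * (√ (ι n) * w n)          ≈⟨ *-cong (√*w≈1 1≤n) (√*w≈1 1≤n) ⟩
    1# * 1#                                  ≈⟨ *-identityˡ 1# ⟩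
    1#                                       ∎)
    where open import Relation.Binary.Reasoning.Setoid setoid

  w-anti : ∀ {m n} → 1 ℕ.≤ m → m ℕ.≤ n → w n ≤ w m
  w-anti {m} 1≤m m≤n = ⁻¹-mono-≤ (0<√ι 1≤m) (√-mono-≤ (0≤ι m) (ι-mono-≤ m≤n))

  -- The telescoping bound for Σ n^(-3/2). With a = 1/√m and b = 1/√(m+1) one has a² - b² = a²b²,
  -- whence 2a(a - b) = a²b² + (a - b)² ≥ ab³ as b ≤ a; then a is cancelled.
  w-step : ∀ {m} → 1 ℕ.≤ m → w (suc m) * w (suc m) * w (suc m) ≤ ι 2 * (w m - w (suc m))
  w-step {m} 1≤m = *-cancelˡ-≤ (w m) (0<w 1≤m) (by≤ (gap≈˘ a²-b²≈a²b² ≤+≤ gap≤ (*-monoʳ-≤ (b * b *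
    a)
    (*-nonneg (0≤x² b) (<⇒≤ (0<w 1≤m))) b≤a) ≤+≤ 0≤x² (a - b)) (solve 2 (λ a b → a :* (κ 2 :* (a :-
    b)) :- a :* (b :* b :* b) := a :* a :- b :* b :- a :* a :* (b :* b) :+ (a :* (b :* b :* a) :- b
      :*
    (b :* b :* a) :+ (a :- b) :* (a :- b))) refl _ _))
    where
    a b : ℝ
    a = w m
    b = w (suc m)
    b≤a : b ≤ a
    b≤a = w-anti 1≤m (ℕ.n≤1+n m)
    a²-b²≈a²b² : a * a - b * b ≈ a * a * (b * b)
    a²-b²≈a²b² = trans (+-cong (w*w 1≤m) (-‿cong (w*w {suc m} (s≤s z≤n)))) (trans (1/m-1/[1+m] 1≤m)
      (sym (*-cong (w*w 1≤m) (w*w {suc m} (s≤s z≤n)))))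

  w³ : ℕ → ℝ
  w³ n = w n * w n * w n

  ∑w³-≤ : ∀ k → ∑< k (λ i → w³ (2 ℕ.+ i)) + ι 2 * w (1 ℕ.+ k) ≤ ι 2 * w 1
  ∑w³-≤ zero    = ≈⇒≤ (+-identityˡ _)
  ∑w³-≤ (suc k) = ≤-trans
    (by≤ (gap≤ (w-step {suc k} (s≤s z≤n))) (solve 4 (λ a b c d → a :+ κ 2 :* b :- (a :+ c :+ κ 2 :*
      d)
      := κ 2 :* (b :- d) :- c) refl _ _ _ _))
    (∑w³-≤ k)

  -- -log (1 - t) = t + t²/2 + O(t³), obtained by expanding (1 - t) exp (t + t²/2)
  -- with exp-cubic.
  module LogTaylor (t : ℝ) (∣t∣≤½ : ∣ t ∣ℝ + ∣ t ∣ℝ ≤ 1#) where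
    s h g : ℝ
    s = ∣ t ∣ℝ
    h = ι 2 ⁻¹
    g = t + t * t * h

    0≤s : 0# ≤ s
    0≤s = 0≤∣∣ t

    t≤s : t ≤ s
    t≤s = ∣∣-upper t

    -t≤s : - t ≤ s
    -t≤s = ∣∣-lower t

    s²≈t² : s * s ≈ t * t
    s²≈t² = ∣x∣²≈x² t

    s³ : ℝ
    s³ = s * s * s

    0≤s³ : 0# ≤ s³
    0≤s³ = *-nonneg (*-nonneg 0≤s 0≤s) 0≤s

    2g≈2t+t² : g + g ≈ t + t + t * t
    2g≈2t+t² = by≈ (gap≈0 (*-congˡ {t * t} 2*2⁻¹≈1)) (solve 2 (λ a b → a :+ a :+ a :* a :- (a :+ a
      :*
      a :* b :+ (a :+ a :* a :* b)) := a :* a :* κ 1 :- a :* a :* (κ 2 :* b)) refl _ _)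

    2s²≤s : s * s + s * s ≤ s
    2s²≤s = by≤ (gap≤ (*-monoˡ-≤ s 0≤s ∣t∣≤½)) (solve 1 (λ a → a :- (a :* a :+ a :* a) := a :* κ 1
      :-
      a :* (a :+ a)) refl _)

    -- For |t| ≤ 1/2 the quadratic term t²/2 is at most |t|/4.
    4∣g∣≤5s : ι 4 * ∣ g ∣ℝ ≤ ι 5 * s
    4∣g∣≤5s = ≤-trans (≈⇒≤ (trans (*-congʳ (sym (∣∣-nonneg (0≤ι 4)))) (sym (∣∣-* (ι 4) g)))) (∣∣-≤
      (by≤ (scale≤ 2 (gap≈ 2g≈2t+t²) ≤+≤ scale≤ 4 (gap≤ t≤s) ≤+≤ scale≤ 2 (gap≈˘ s²≈t²) ≤+≤ gap≤
        2s²≤s) (solve 3 (λ a b c → κ 5 :* a :- κ 4 :* b := κ 2 :* (c :+ c :+ c :* c :- (b :+ b)) :+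
          (κ
        4 :* (a :- c) :+ (κ 2 :* (a :* a :- c :* c) :+ (a :- (a :* a :+ a :* a))))) refl _ _ _))
      (by≤ (scale≤ 2 (gap≈˘ 2g≈2t+t²) ≤+≤ scale≤ 4 (gap≤ -t≤s) ≤+≤ scale≤ 2 (0≤x² t) ≤+≤ 0≤s) (solve
        3
        (λ a b c → κ 5 :* a :- :- (κ 4 :* b) := κ 2 :* (b :+ b :- (c :+ c :+ c :* c)) :+ (κ 4 :* (a
          :-
        :- c) :+ (κ 2 :* (c :* c) :+ a))) refl _ _ _)))

    ∣g∣≤1 : ∣ g ∣ℝ ≤ 1#
    ∣g∣≤1 = by≤-scaled 7 (scale≤ 2 (gap≤ 4∣g∣≤5s) ≤+≤ scale≤ 5 (gap≤ ∣t∣≤½) ≤+≤ scale≤ 3 0≤1) (solve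
      2
      (λ a b → κ 8 :* (κ 1 :- a) := κ 2 :* (κ 5 :* b :- κ 4 :* a) :+ (κ 5 :* (κ 1 :- (b :+ b)) :+ κ
        3
      :* κ 1)) refl _ _)

    ρ : ℝ
    ρ = expℝ g - (1# + g + g * g * h)

    -- The factor 5/4 just suffices: (5/4)³/2 = 125/128.
    ∣g∣³h≤s³ : ∣ g ∣ℝ * ∣ g ∣ℝ * ∣ g ∣ℝ * h ≤ s³
    ∣g∣³h≤s³ = by≤-scaled 127 (scale≤ 2 (gap≤ (*-monoʳ-≤ h (<⇒≤ 0<2⁻¹) (*-mono-≤ (*-nonneg 0≤4∣g∣
      0≤4∣g∣) 0≤4∣g∣ (*-mono-≤ 0≤4∣g∣ 0≤4∣g∣ 4∣g∣≤5s 4∣g∣≤5s) 4∣g∣≤5s))) ≤+≤ scale≤ 125 (gap≈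
        (*-congˡ
      {s³} 2*2⁻¹≈1)) ≤+≤ scale≤ 3 0≤s³) (solve 3 (λ a b c → κ 128 :* (a :* a :* a :- b :* b :* b :*
        c)
      := κ 2 :* (κ 5 :* a :* (κ 5 :* a) :* (κ 5 :* a) :* c :- κ 4 :* b :* (κ 4 :* b) :* (κ 4 :* b)
        :*
      c) :+ (κ 125 :* (a :* a :* a :* κ 1 :- a :* a :* a :* (κ 2 :* c)) :+ κ 3 :* (a :* a :* a)))
        refl
      _ _ _)
      where
      0≤4∣g∣ : 0# ≤ ι 4 * ∣ g ∣ℝ
      0≤4∣g∣ = *-nonneg (0≤ι 4) (0≤∣∣ g)

    ρ≤s³ : ρ ≤ s³
    ρ≤s³ = ≤-trans (∣∣-upper ρ) (≤-trans (exp-cubic g ∣g∣≤1) ∣g∣³h≤s³)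

    -s³≤ρ : - s³ ≤ ρ
    -s³≤ρ = by≤ (gap≤ (≤-trans (∣∣-lower ρ) (≤-trans (exp-cubic g ∣g∣≤1) ∣g∣³h≤s³))) (solve 2 (λ a b
      →
      a :- :- b := b :- :- a) refl _ _)

    0<1-t : 0# < 1# - t
    0<1-t = by<-scaled 1 (0<1 <+≤ scale≤ 2 (gap≤ t≤s) ≤+≤ gap≤ ∣t∣≤½) (solve 2 (λ a b → κ 2 :* (κ 1
      :-
      a :- κ 0) := κ 1 :+ (κ 2 :* (b :- a) :+ (κ 1 :- (b :+ b)))) refl _ _)

    y : ℝ
    y = (1# - t) * expℝ g

    -- Without the error ρ, the product (1 - t)(1 + g + g²/2) is 1 - t³/2 - 3t⁴/8 - t⁵/8: the choice
    -- of g cancels the linear and quadratic terms.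
    8y≈ : ι 8 * y ≈ ι 8 - ι 4 * (t * t * t) - ι 3 * (t * t * t * t) - t * t * t * t * t + ι 8 * ((1#
      - t) * ρ)
    8y≈ = by≈ (scale≈0 4 (gap≈0 (*-congˡ {1# - t} 2g≈2t+t²)) ≈0+≈0 gap≈0 (*-congˡ {1# - t} (*-cong
      2g≈2t+t² 2g≈2t+t²)) ≈0+≈0 scale≈0 4 (gap≈0 (*-congˡ {(1# - t) * (g * g)} 2*2⁻¹≈1))) (solve 4
        (λ
      a b c d → κ 8 :- κ 4 :* (a :* a :* a) :- κ 3 :* (a :* a :* a :* a) :- a :* a :* a :* a :* a :+
        κ
      8 :* ((κ 1 :- a) :* (b :- (κ 1 :+ c :+ c :* c :* d))) :- κ 8 :* ((κ 1 :- a) :* b) := κ 4 :*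
        ((κ
      1 :- a) :* (a :+ a :+ a :* a) :- (κ 1 :- a) :* (c :+ c)) :+ ((κ 1 :- a) :* ((a :+ a :+ a :* a)
      :* (a :+ a :+ a :* a)) :- (κ 1 :- a) :* ((c :+ c) :* (c :+ c)) :+ κ 4 :* ((κ 1 :- a) :* (c :*
        c)
      :* κ 1 :- (κ 1 :- a) :* (c :* c) :* (κ 2 :* d)))) refl _ _ _ _)

    t³≤s³ : t * t * t ≤ s³
    t³≤s³ = ≤-trans (*-monoˡ-≤ (t * t) (0≤x² t) t≤s) (≈⇒≤ (*-congʳ (sym s²≈t²)))

    -t³≤s³ : - (t * t * t) ≤ s³
    -t³≤s³ = by≤ (gap≤ (*-monoˡ-≤ (t * t) (0≤x² t) -t≤s) ≤+≤ gap≈˘ (*-congʳ {s} s²≈t²)) (solve 2 (λ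
      a
      b → a :* a :* a :- :- (b :* b :* b) := b :* b :* a :- b :* b :* :- b :+ (a :* a :* a :- b :* b
      :* a)) refl _ _)

    t⁴≈s⁴ : t * t * t * t ≈ s³ * s
    t⁴≈s⁴ = by≈ (gap≈0˘ (*-cong s²≈t² s²≈t²)) (solve 2 (λ a b → a :* a :* a :* a :- b :* b :* b :* b
      := a :* a :* (a :* a) :- b :* b :* (b :* b)) refl _ _)

    2s⁴≤s³ : s³ * s + s³ * s ≤ s³
    2s⁴≤s³ = by≤ (gap≤ (*-monoˡ-≤ s³ 0≤s³ ∣t∣≤½)) (solve 2 (λ a b → a :- (a :* b :+ a :* b) := a :*
      κ
      1 :- a :* (b :+ b)) refl _ _)

    0≤s⁴ : 0# ≤ s³ * s
    0≤s⁴ = *-nonneg 0≤s³ 0≤s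

    s⁵≤s⁴ : s³ * s * s ≤ s³ * s
    s⁵≤s⁴ = ≤-trans (*-monoˡ-≤ (s³ * s) 0≤s⁴ (by≤-scaled 1 (gap≤ ∣t∣≤½ ≤+≤ 0≤1) (solve 1 (λ a → κ 2
      :*
      (κ 1 :- a) := κ 1 :- (a :+ a) :+ κ 1) refl _))) (≈⇒≤ (*-identityʳ _))

    t⁵≤s⁵ : t * t * t * t * t ≤ s³ * s * s
    t⁵≤s⁵ = ≤-trans (≈⇒≤ (*-congʳ t⁴≈s⁴)) (*-monoˡ-≤ (s³ * s) 0≤s⁴ t≤s)

    -t⁵≤s⁵ : - (t * t * t * t * t) ≤ s³ * s * s
    -t⁵≤s⁵ = by≤ (gap≈˘ (*-congʳ {t} t⁴≈s⁴) ≤+≤ gap≤ (*-monoˡ-≤ (s³ * s) 0≤s⁴ -t≤s)) (solve 3 (λ a b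
      c
      → a :* b :* b :- :- (c :* c :* c :* c :* c) := c :* c :* c :* c :* c :- a :* b :* c :+ (a :* b
      :* b :- a :* b :* :- c)) refl _ _ _)

    [1-t]ρ≤ : (1# - t) * ρ ≤ s³ + s³ * s
    [1-t]ρ≤ = by≤ (gap≤ (*-monoˡ-≤ (1# - t) (<⇒≤ 0<1-t) ρ≤s³) ≤+≤ gap≤ (*-monoˡ-≤ s³ 0≤s³ -t≤s))
      (solve 4 (λ a b c d → a :+ a :* b :- (κ 1 :- c) :* d := (κ 1 :- c) :* a :- (κ 1 :- c) :* d :+
        (a
      :* b :- a :* :- c)) refl _ _ _ _)

    [1-t]ρ≥ : - (s³ + s³ * s) ≤ (1# - t) * ρ
    [1-t]ρ≥ = by≤ (gap≤ (*-monoˡ-≤ (1# - t) (<⇒≤ 0<1-t) -s³≤ρ) ≤+≤ gap≤ (*-monoˡ-≤ s³ 0≤s³ -t≤s))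
      (solve 4 (λ a b c d → (κ 1 :- a) :* b :- :- (c :+ c :* d) := (κ 1 :- a) :* b :- (κ 1 :- a) :*
        :-
      c :+ (c :* d :- c :* :- a)) refl _ _ _ _)

    -- In units of s³ the cubic term contributes 1/2, the quartic and quintic ones at most 1/4
    -- together, and (1 - t)ρ at most 3/2; the total stays below 3.
    y≤ : y ≤ 1# + ι 3 * s³
    y≤ = by≤-scaled 7 (gap≈ 8y≈ ≤+≤ scale≤ 4 (gap≤ -t³≤s³) ≤+≤ scale≤ 3 (gap≈˘ t⁴≈s⁴) ≤+≤ gap≤
      -t⁵≤s⁵
      ≤+≤ gap≤ s⁵≤s⁴ ≤+≤ scale≤ 3 (gap≤ 2s⁴≤s³) ≤+≤ scale≤ 8 (gap≤ [1-t]ρ≤) ≤+≤ scale≤ 9 0≤s³)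
        (solve
      5 (λ a b c d e → κ 8 :* (κ 1 :+ κ 3 :* a :- b) := κ 8 :- κ 4 :* (c :* c :* c) :- κ 3 :* (c :*
        c
      :* c :* c) :- c :* c :* c :* c :* c :+ κ 8 :* ((κ 1 :- c) :* d) :- κ 8 :* b :+ (κ 4 :* (a :-
        :-
      (c :* c :* c)) :+ (κ 3 :* (c :* c :* c :* c :- a :* e) :+ (a :* e :* e :- :- (c :* c :* c :* c
      :* c) :+ (a :* e :- a :* e :* e :+ (κ 3 :* (a :- (a :* e :+ a :* e)) :+ (κ 8 :* (a :+ a :* e
        :-
      (κ 1 :- c) :* d) :+ κ 9 :* a))))))) refl _ _ _ _ _)

    y≥ : 1# - ι 3 * s³ ≤ y
    y≥ = by≤-scaled 7 (gap≈˘ 8y≈ ≤+≤ scale≤ 4 (gap≤ t³≤s³) ≤+≤ scale≤ 3 (gap≈ t⁴≈s⁴) ≤+≤ gap≤ t⁵≤s⁵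
      ≤+≤ gap≤ s⁵≤s⁴ ≤+≤ scale≤ 6 (gap≤ 2s⁴≤s³) ≤+≤ scale≤ 8 (gap≤ [1-t]ρ≥) ≤+≤ scale≤ 6 0≤s³)
        (solve
      5 (λ a b c d e → κ 8 :* (a :- (κ 1 :- κ 3 :* b)) := κ 8 :* a :- (κ 8 :- κ 4 :* (c :* c :* c)
        :-
      κ 3 :* (c :* c :* c :* c) :- c :* c :* c :* c :* c :+ κ 8 :* ((κ 1 :- c) :* d)) :+ (κ 4 :* (b
        :-
      c :* c :* c) :+ (κ 3 :* (b :* e :- c :* c :* c :* c) :+ (b :* e :* e :- c :* c :* c :* c :* c
        :+
      (b :* e :- b :* e :* e :+ (κ 6 :* (b :- (b :* e :+ b :* e)) :+ (κ 8 :* ((κ 1 :- c) :* d :- :-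
        (b
      :+ b :* e)) :+ κ 6 :* b))))))) refl _ _ _ _ _)

    0<y : 0# < y
    0<y = *-pos _ _ 0<1-t (0<exp g)

    log-y : log y ≈ log (1# - t) + g
    log-y = trans (log-* 0<1-t (0<exp g)) (+-congˡ (log-exp g))

    8s³≤1 : ι 8 * s³ ≤ 1#
    8s³≤1 = by≤ (gap≤ (*-mono-≤ (*-nonneg 0≤2s 0≤2s) 0≤2s (*-mono-≤ 0≤2s 0≤2s ∣t∣≤½ ∣t∣≤½) ∣t∣≤½))
      (solve 1 (λ a → κ 1 :- κ 8 :* (a :* a :* a) := κ 1 :* κ 1 :* κ 1 :- (a :+ a) :* (a :+ a) :* (a
      :+ a)) refl _)
      where
      0≤2s : 0# ≤ s + s
      0≤2s = 0≤s ≤+≤ 0≤s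

    log-y≥ : - (ι 5 * s³) ≤ log y
    log-y≥ = by≤ (gap≤ (1-x⁻¹≤log 0<y) ≤+≤ gap≤ y⁻¹≤) (solve 3 (λ a b c → a :- :- (κ 5 :* b) := a :-
      (κ 1 :- c) :+ (κ 1 :+ κ 5 :* b :- c)) refl _ _ _)
      where
      -- For u = s³ ≤ 1/8 one has (1 - 3u)(1 + 5u) = 1 + 2u - 15u² ≥ 1, since 15u ≤ 2.
      y⁻¹≤ : y ⁻¹ ≤ 1# + ι 5 * s³
      y⁻¹≤ = *-cancelˡ-≤ y 0<y (by≤-scaled 7 (scale≤ 8 (gap≈ (x*x⁻¹≈1 0<y)) ≤+≤ scale≤ 8 (gap≤
        (*-monoʳ-≤ (1# + ι 5 * s³) (0≤1 ≤+≤ *-nonneg (0≤ι 5) 0≤s³) y≥)) ≤+≤ scale≤ 15 (gap≤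
          (*-monoˡ-≤
        s³ 0≤s³ 8s³≤1)) ≤+≤ 0≤s³) (solve 3 (λ a b c → κ 8 :* (a :* (κ 1 :+ κ 5 :* b) :- a :* c) := κ
          8
        :* (κ 1 :- a :* c) :+ (κ 8 :* (a :* (κ 1 :+ κ 5 :* b) :- (κ 1 :- κ 3 :* b) :* (κ 1 :+ κ 5 :*
        b)) :+ (κ 15 :* (b :* κ 1 :- b :* (κ 8 :* b)) :+ b))) refl _ _ _))

    log-taylor : ∣ - log (1# - t) - t - t * t * h ∣ℝ ≤ ι 5 * s³
    log-taylor = ∣∣-≤
      (by≤ (gap≈ log-y ≤+≤ gap≤ log-y≥) (solve 5 (λ a b c d e → κ 5 :* a :- (:- b :- c :- c :* c :*
        d)
        := b :+ (c :+ c :* c :* d) :- e :+ (e :- :- (κ 5 :* a))) refl _ _ _ _ _))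
      (by≤ (gap≈˘ log-y ≤+≤ gap≤ (log≤x-1 0<y) ≤+≤ gap≤ y≤ ≤+≤ scale≤ 2 0≤s³) (solve 6 (λ a b c d e
        f
        → κ 5 :* a :- :- (:- b :- c :- c :* c :* d) := e :- (b :+ (c :+ c :* c :* d)) :+ (f :- κ 1
          :-
        e :+ (κ 1 :+ κ 3 :* a :- f :+ κ 2 :* a))) refl _ _ _ _ _ _))

  -- Floors, lists of primes and orders of vanishing.

  floor-exists : ∀ n {x} → 0# ≤ x → x < ι n → ∃[ m ] ι m ≤ x × x < ι (suc m)
  floor-exists zero    0≤x x<0 = ⊥-elim (<⇒≱ x<0 0≤x)
  floor-exists (suc n) {x} 0≤x h = [ floor-exists n 0≤x , (λ n≤x → n , n≤x , h) ]′ (<-or-≥ x (ι n))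

  floor-spec : ∀ {x} → 0# ≤ x → ι ⌊ x ⌋ ≤ x × x < ι (suc ⌊ x ⌋)
  floor-spec {x} 0≤x = choose-satisfies (λ n → ι n ≤ x × x < ι (suc n)) 0
    (let n , x<n = archimedean x in floor-exists n 0≤x x<n)

  ι-cancel-≤ : ∀ {m n} → ι m ≤ ι n → m ℕ.≤ n
  ι-cancel-≤ h = ℕ.≮⇒≥ λ n<m → <⇒≱ (ι-mono-< n<m) h

  floor-ι : ∀ n → ⌊ ι n ⌋ ≡ n
  floor-ι n = let a , b = floor-spec (0≤ι n) in ℕ.≤-antisym (ι-cancel-≤ a) (ℕ.≤-pred (ι-cancel-< b))

  floor-≥ : ∀ {n x} → ι n ≤ x → n ℕ.≤ ⌊ x ⌋
  floor-≥ {n} n≤x = let _ , b = floor-spec (≤-trans (0≤ι n) n≤x) in ℕ.≤-pred (ι-cancel-< (≤-<-trans n≤x b))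

  ∑-filter : {A : Set} {P : A → Set} (P? : ∀ x → Dec (P x)) (xs : List A) (f : A → ℝ) →
             ∑ (filter P? xs) f ≈ ∑ xs (λ x → when (P? x) (f x))
  ∑-filter P? []       f = refl
  ∑-filter P? (x ∷ xs) f with P? x
  ... | yes _ = +-congˡ (∑-filter P? xs f)
  ... | no  _ = trans (∑-filter P? xs f) (sym (+-identityˡ _))

  primesUpTo : ℕ → List ℕ
  primesUpTo N = filter prime? (upTo (suc N))

  ∑-primesUpTo : ∀ N f → ∑ (primesUpTo N) f ≈ ∑ₚ N f
  ∑-primesUpTo N f = trans (∑-filter prime? (upTo (suc N)) f) (∑-upTo (suc N) _)

  -- If f had no order at s₀, then ord f s₀ would be its default value, also 0.
  ord-nonvanishing : ∀ f s₀ → ¬ (f s₀ ≈ᶜ 0ᶜ) → ord f s₀ ≡ 0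
  ord-nonvanishing f s₀ fs₀≉0 = choose-elim em
    where
    ∣s₀-s₀∣≤0 : ∣ s₀ -ᶜ s₀ ∣ᶜ ≤ 0#
    ∣s₀-s₀∣≤0 = ≤-trans (∣∣ᶜ-real (s₀ -ᶜ s₀) (-‿inverseʳ (im s₀)))
      (≈⇒≤ (trans (∣∣-cong (-‿inverseʳ (re s₀))) (∣∣-nonneg ≤-refl)))
    vanishes : ∀ z v g → z ≈ᶜ 0ᶜ → z *ᶜ v *ᶜ g ≈ᶜ 0ᶜ
    vanishes z v g (r , i) =
        (by≈ (gap≈0 (*-congʳ {re v * re g - im v * im g} r) ≈0+≈0 gap≈0˘ (*-congʳ {im v * re g + re
          v
          * im g} i)) (solve 6 (λ a b c d e f → κ 0 :- ((a :* b :- c :* d) :* e :- (a :* d :+ c :*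
            b)
          :* f) := κ 0 :* (b :* e :- d :* f) :- a :* (b :* e :- d :* f) :+ (c :* (d :* e :+ b :* f)
            :-
          κ 0 :* (d :* e :+ b :* f))) refl _ _ _ _ _ _))
      , (by≈ (gap≈0 (*-congʳ {re v * im g + im v * re g} r) ≈0+≈0 gap≈0 (*-congʳ {re v * re g - im v
        *
        im g} i)) (solve 6 (λ a b c d e f → κ 0 :- ((a :* b :- c :* d) :* e :+ (a :* d :+ c :* b) :*
        f) := κ 0 :* (b :* e :+ d :* f) :- a :* (b :* e :+ d :* f) :+ (κ 0 :* (b :* f :- d :* e) :-
          c
        :* (b :* f :- d :* e))) refl _ _ _ _ _ _))
    order-zero : ∀ m → IsOrder f s₀ m → m ≡ 0
    order-zero zero    _ = ≡.refl
    order-zero (suc m) (g , r , 0<r , _ , h) =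
      let _ , p , t = h s₀ (≤-<-trans ∣s₀-s₀∣≤0 0<r)
          a , b = vanishes (s₀ -ᶜ s₀) ((s₀ -ᶜ s₀) ^ᶜ m) (g s₀) (-‿inverseʳ (re s₀) , -‿inverseʳ (im
            s₀))
      in ⊥-elim (fs₀≉0 (trans p a , trans t b))
    choose-elim : Dec (∃ (IsOrder f s₀)) → ord f s₀ ≡ 0
    choose-elim (yes h) = order-zero _ (choose-satisfies (IsOrder f s₀) 0 h)
    choose-elim (no ¬h) = choose-default (IsOrder f s₀) 0 ¬h
      where
      choose-default : {A : Set} (P : A → Set) (d : A) → ¬ ∃ P → choose P d ≡ d
      choose-default P d ¬∃P with em {∃ P}
      ... | yes ∃P = ⊥-elim (¬∃P ∃P)
      ... | no  _  = ≡.refl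

  -- Euler products of quadratic characters at 1/2.

  -- The Euler factors of a quadratic character are positive reals, so the logarithm of a partial
  -- product is the real logarithm of its real part. The three claims go together because the
  -- additivity of `log` needs the positivity.
  ∏ᶜ-positive : {A : Set} (xs : List A) (f : A → ℂ) (u : A → ℝ) → All (λ x → f x ≈ᶜ ofℝ (u x) × 0# <
    u x) xs →
    0# < re (∏ᶜ xs f) × im (∏ᶜ xs f) ≈ 0# × log (re (∏ᶜ xs f)) ≈ ∑ xs (λ x → log (u x))
  ∏ᶜ-positive []       f u []                    = 0<1 , refl , log-1
  ∏ᶜ-positive (x ∷ xs) f u (((r , i) , 0<u) ∷ h) =
    let 0<P , imP≈0 , logP = ∏ᶜ-positive xs f u h
        P = ∏ᶜ xs f
        re≈ : re (f x) * re P - im (f x) * im P ≈ u x * re P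
        re≈ = by≈ (gap≈0 (*-congʳ r) ≈0+≈0 gap≈0˘ (*-congʳ i)) (solve 5 (λ a b c d e → a :* b :- (c
          :*
          b :- d :* e) := a :* b :- c :* b :+ (d :* e :- κ 0 :* e)) refl _ _ _ _ _)
        im≈ : re (f x) * im P + im (f x) * re P ≈ 0#
        im≈ = by≈ (gap≈0 (*-congˡ imP≈0) ≈0+≈0 gap≈0 (*-congʳ i)) (solve 4 (λ a b c d → κ 0 :- (a :*
          b
          :+ c :* d) := a :* κ 0 :- a :* b :+ (κ 0 :* d :- c :* d)) refl _ _ _ _)
        0<uP : 0# < u x * re P
        0<uP = *-pos _ _ 0<u 0<P
    in <-resp refl (sym re≈) 0<uP , im≈ ,
       trans (log-cong (<-resp refl (sym re≈) 0<uP) re≈) (trans (log-* 0<u 0<P) (+-congˡ logP))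

  euler-factor : ∀ v w → 0# < 1# - v * w → (1ᶜ -ᶜ ofℝ v *ᶜ ofℝ w) ⁻¹ᶜ ≈ᶜ ofℝ ((1# - v * w) ⁻¹)
  euler-factor v w 0<u = re≈ , im≈
    where
    z : ℂ
    z = 1ᶜ -ᶜ ofℝ v *ᶜ ofℝ w
    u : ℝ
    u = 1# - v * w
    normSq≈ : normSq z ≈ u * u
    normSq≈ = solve 2 (λ a b → (κ 1 :- (a :* b :- κ 0 :* κ 0)) :* (κ 1 :- (a :* b :- κ 0 :* κ 0)) :+
      (κ 0 :- (a :* κ 0 :+ κ 0 :* b)) :* (κ 0 :- (a :* κ 0 :+ κ 0 :* b)) := (κ 1 :- a :* b) :* (κ 1
        :-
      a :* b)) refl _ _
    0<normSq : 0# < normSq z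
    0<normSq = <-resp refl (sym normSq≈) (*-pos _ _ 0<u 0<u)
    re≈ : re z / normSq z ≈ u ⁻¹
    re≈ = trans (*-cong (solve 2 (λ a b → κ 1 :- (a :* b :- κ 0 :* κ 0) := κ 1 :- a :* b) refl _ _)
      (trans (⁻¹-cong 0<normSq normSq≈) (*⁻¹ 0<u 0<u)))
      (by≈ (gap≈0 (*-congˡ {u ⁻¹} (x*x⁻¹≈1 0<u))) (solve 2 (λ a b → a :- b :* (a :* a) := a :* κ 1
        :-
        a :* (b :* a)) refl _ _))
    im≈ : - im z / normSq z ≈ 0#
    im≈ = trans (*-congʳ (solve 2 (λ a b → :- (κ 0 :- (a :* κ 0 :+ κ 0 :* b)) := κ 0) refl _ _))
      (zeroˡ _)

  module Characters (q : ℕ) (3≤q : 3 ℕ.≤ q) where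
    open Residues em R q 3≤q

    σ : Bool → ℝ
    σ false = 1#
    σ true  = - 1#

    σ-xor : ∀ a b → σ (a xor b) ≈ σ a * σ b
    σ-xor false b     = sym (*-identityˡ _)
    σ-xor true  false = sym (*-identityʳ _)
    σ-xor true  true  = solve 1 (λ a → κ 1 := :- κ 1 :* :- κ 1) refl 0#

    value : SignCharacter → ℕ → ℝ
    value c a = when (coprime? a q) (σ (sign c a))

    value-≋ : ∀ c {a b} → a ≋ b → value c a ≈ value c b
    value-≋ c {a} {b} a≋b = by-cases (coprime? a q) (coprime? b q)
      where
      by-cases : (d : Dec (Coprime a q)) (e : Dec (Coprime b q)) → when d (σ (sign c a)) ≈ when e (σ
        (sign c b))
      by-cases (yes _)  (yes _)  = reflexive (≡.cong σ (sign-≋ c a≋b))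
      by-cases (yes ca) (no ¬cb) = ⊥-elim (¬cb (Coprime-≋ a≋b ca))
      by-cases (no ¬ca) (yes cb) = ⊥-elim (¬ca (Coprime-≋ (≡.sym a≋b) cb))
      by-cases (no _)   (no _)   = refl

    value-* : ∀ c a b → value c (a ℕ.* b) ≈ value c a * value c b
    value-* c a b = by-cases (coprime? (a ℕ.* b) q) (coprime? a q) (coprime? b q)
      where
      by-cases : (d : Dec (Coprime (a ℕ.* b) q)) (e : Dec (Coprime a q)) (f : Dec (Coprime b q)) →
                 when d (σ (sign c (a ℕ.* b))) ≈ when e (σ (sign c a)) * when f (σ (sign c b))
      by-cases (yes _) (yes ca) (yes cb) = trans (reflexive (≡.cong σ (sign-* c ca cb))) (σ-xor
        (sign c a) (sign c b))
      by-cases (no ¬cab) (yes ca) (yes cb) = ⊥-elim (¬cab (Coprime-* ca cb))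
      by-cases (yes cab) (no ¬ca) _        = ⊥-elim (¬ca (Coprime-*ˡ {a} cab))
      by-cases (yes cab) (yes _)  (no ¬cb) = ⊥-elim (¬cb (Coprime-*ʳ {a} cab))
      by-cases (no _)    (no _)   _        = sym (zeroˡ _)
      by-cases (no _)    (yes _)  (no _)   = sym (zeroʳ _)

    toDirichlet : SignCharacter → DirichletCharacter q
    toDirichlet c = record
      { eval           = λ n → ofℝ (value c n)
      ; periodic       = λ n → value-≋ c (ℕ.[m+n]%n≡m%n n q) , refl
      ; multiplicative = λ m n → trans (value-* c m n) (solve 2 (λ a b → a :* b := a :* b :- κ 0 :*
        κ
        0) refl _ _)
                               , (solve 2 (λ a b → κ 0 := a :* κ 0 :+ κ 0 :* b) refl _ _)
      ; one = trans (when-yes (coprime? 1 q) 1-coprime) (reflexive (≡.cong σ (sign-square c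
        1-coprime))) , refl
      ; vanishing      = λ n ¬cn → when-no (coprime? n q) ¬cn , refl
      }
      where
      1-coprime : Coprime 1 q
      1-coprime (d∣1 , _) = ℕ.∣1⇒≡1 d∣1

    toDirichlet-nontrivial : ∀ c → NontrivialSign c → Nontrivial (toDirichlet c)
    toDirichlet-nontrivial c (a , ca , e) h = <-irrefl (<-resp refl (by≈ (gap≈0˘ 1≈-1) (solve 1 (λ a
      →
      κ 0 :- (κ 1 :+ κ 1) := :- κ 1 :- κ 1) refl 0#)) (by< (scale< 1 0<1) (solve 1 (λ a → κ 1 :+ κ 1
        :- κ 0 := κ 2 :* κ 1) refl 0#)))
      where
      1≈-1 : - 1# ≈ 1#
      1≈-1 = trans (reflexive (≡.cong σ (≡.sym e))) (trans (sym (when-yes (coprime? a q) ca)) (proj₁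
        (h a ca)))

    ∣value∣≤1 : ∀ c a → ∣ value c a ∣ℝ ≤ 1#
    ∣value∣≤1 c a = by-cases (coprime? a q) (sign c a)
      where
      by-cases : (d : Dec (Coprime a q)) (b : Bool) → ∣ when d (σ b) ∣ℝ ≤ 1#
      by-cases (yes _) false = ≈⇒≤ (∣∣-nonneg 0≤1)
      by-cases (yes _) true  = ≈⇒≤ (trans (∣-∣ 1#) (∣∣-nonneg 0≤1))
      by-cases (no _)  _     = ≤-trans (≈⇒≤ (∣∣-nonneg ≤-refl)) 0≤1

    value² : ∀ c a → value c a * value c a ≈ when (coprime? a q) 1#
    value² c a = by-cases (coprime? a q) (sign c a)
      where
      by-cases : (d : Dec (Coprime a q)) (b : Bool) → when d (σ b) * when d (σ b) ≈ when d 1#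
      by-cases (yes _) false = *-identityˡ 1#
      by-cases (yes _) true  = solve 1 (λ a → :- κ 1 :* :- κ 1 := κ 1) refl 0#
      by-cases (no _)  _     = zeroˡ 0#

    ∣value*w∣≤w : ∀ c {p} → 1 ℕ.≤ p → ∣ value c p * w p ∣ℝ ≤ w p
    ∣value*w∣≤w c {p} 1≤p = ≤-trans (≈⇒≤ (∣∣-* (value c p) (w p))) (≤-trans
      (*-mono-≤ (0≤∣∣ _) (0≤∣∣ _) (∣value∣≤1 c p) (≈⇒≤ (∣∣-nonneg (<⇒≤ (0<w 1≤p))))) (≈⇒≤
        (*-identityˡ (w p))))

    w<1 : ∀ {p} → Prime p → w p < 1#
    w<1 {p} pr = [ id , (λ 1≤w → ⊥-elim (<⇒≱ w²<1 (≤-trans (≈⇒≤ (sym (*-identityˡ 1#))) (*-mono-≤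
      0≤1 0≤1 1≤w 1≤w)))) ]′ (<-or-≥ (w p) 1#)
      where
      w²<1 : w p * w p < 1#
      w²<1 = ≤-<-trans (≤-trans (≈⇒≤ (w*w (prime⇒≥1 pr))) (⁻¹-mono-≤ (0<ι-suc 1) (ι-mono-≤ (prime⇒≥2
        pr))))
        (by<-scaled 1 (0<1 <+≤ gap≈ 2*2⁻¹≈1) (solve 1 (λ a → κ 2 :* (κ 1 :- a) := κ 1 :+ (κ 1 :- κ 2
          :* a)) refl _))

    0<1-value*w : ∀ c {p} → Prime p → 0# < 1# - value c p * w p
    0<1-value*w c {p} pr = by< (gap< (w<1 pr) <+≤ gap≤ (∣∣-upper (value c p * w p)) ≤+≤ gap≤
      (∣value*w∣≤w c (prime⇒≥1 pr))) (solve 3 (λ a b c → κ 1 :- a :* b :- κ 0 := κ 1 :- b :+ (c :- a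
      :* b :+ (b :- c))) refl _ _ _)

    module _ (c : SignCharacter) (drh : DRH-A (toDirichlet c)) (m≡0 : m[ toDirichlet c ] ≡ 0) where

      private
        eulerFactor : ℕ → ℂ
        eulerFactor p = (1ᶜ -ᶜ ofℝ (value c p) *ᶜ ofℝ (√ (ι p) ⁻¹)) ⁻¹ᶜ

        u : ℕ → ℝ
        u p = (1# - value c p * w p) ⁻¹

        P : ℕ → ℂ
        P N = ∏ᶜ (primesUpTo N) eulerFactor

        P-positive : ∀ N → 0# < re (P N) × im (P N) ≈ 0# × log (re (P N)) ≈ ∑ (primesUpTo N) (λ p →
          log (u p))
        P-positive N = ∏ᶜ-positive (primesUpTo N) eulerFactor u (All.map
          (λ {p} pr → euler-factor (value c p) (w p) (0<1-value*w c pr) , 0<x⁻¹ (0<1-value*w c pr))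
          (All.all-filter prime? (upTo (suc N))))

        l : ℂ
        l = proj₁ drh

        -- Once the order is replaced by 0, the power of log x computes to 1.
        limit : (λ x → ofℝ 1# *ᶜ ∏ᶜ (primes≤ x) eulerFactor) ⟶∞ᶜ l
        limit = ≡.subst (λ m → (λ x → ofℝ (log x ^ m) *ᶜ ∏ᶜ (primes≤ x) eulerFactor) ⟶∞ᶜ l) m≡0
          (proj₂ (proj₂ drh))

        limit-ℕ : (λ N → ofℝ 1# *ᶜ P N) ⟶ l
        limit-ℕ ε 0<ε = let X , h = limit ε 0<ε ; N , X<N = archimedean X in N , λ n N≤n →
          ≡.subst (λ k → ∣ ofℝ 1# *ᶜ P k -ᶜ l ∣ᶜ < ε) (floor-ι n) (h (ι n) (<-≤-trans X<N (ι-mono-≤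
            N≤n)))

        re-limit : (λ N → re (P N)) ⇢ re l
        re-limit = ⇢-cong (λ N → (solve 2 (λ a b → κ 1 :* a :- κ 0 :* b := a) refl _ _)) (re-⟶
          limit-ℕ)

        im-l≈0 : im l ≈ 0#
        im-l≈0 = ⇢-unique (im-⟶ limit-ℕ) (⇢-cong (λ N → sym
          (by≈ (gap≈0 (proj₁ (proj₂ (P-positive N)))) (solve 2 (λ a b → κ 0 :- (κ 1 :* a :+ κ 0 :*
            b)
            := κ 0 :- a) refl _ _))) (⇢-const 0#))

        -- DRH(A) only says that l is not 0; as a limit of positive reals, l has imaginary part 0
        -- and real part at least 0, hence positive.
        0<re-l : 0# < re l
        0<re-l = positive (⇢-eventually-≥ 0 (λ N _ → <⇒≤ (proj₁ (P-positive N))) re-limit)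
          where
          positive : 0# ≤ re l → 0# < re l
          positive (inj₁ 0<r) = 0<r
          positive (inj₂ 0≈r) = ⊥-elim (proj₁ (proj₂ drh) (sym 0≈r , im-l≈0))

        logP-bounded : ∃[ K ] ∀ N → ∣ log (re (P N)) ∣ℝ ≤ K
        logP-bounded = let N , h = re-limit (re l * ι 2 ⁻¹) (*-pos _ _ 0<re-l 0<2⁻¹) in
          eventually-bounded {λ N → log (re (P N))} N (λ n N≤n → between n (h n N≤n))
          where
          lo hi : ℝ
          lo = re l * ι 2 ⁻¹
          hi = re l * ι 2
          between : ∀ n → ∣ re (P n) - re l ∣ℝ < lo → ∣ log (re (P n)) ∣ℝ ≤ ∣ log lo ∣ℝ + ∣ log hi
            ∣ℝ
          between n h = ∣∣-≤
            (by≤ (gap≤ (log-mono-≤ (proj₁ (P-positive n)) P≤hi) ≤+≤ gap≤ (∣∣-upper (log hi)) ≤+≤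
              0≤∣∣
              (log lo)) (solve 4 (λ a b c d → a :+ b :- c := d :- c :+ (b :- d :+ a)) refl _ _ _ _))
            (by≤ (gap≤ (log-mono-≤ (*-pos _ _ 0<re-l 0<2⁻¹) lo≤P) ≤+≤ gap≤ (∣∣-lower (log lo)) ≤+≤
              0≤∣∣ (log hi)) (solve 4 (λ a b c d → a :+ b :- :- c := c :- d :+ (a :- :- d :+ b))
                refl
              _ _ _ _))
            where
            P≤hi : re (P n) ≤ hi
            P≤hi = by≤-scaled 1 (scale≤ 2 (gap<⇒≤ h) ≤+≤ scale≤ 2 (gap≤ (∣∣-upper (re (P n) - re
              l)))
              ≤+≤ gap≈ (*-congˡ {re l} 2*2⁻¹≈1) ≤+≤ <⇒≤ 0<re-l) (solve 4 (λ a b c d → κ 2 :* (a :* κ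
                2
              :- b) := κ 2 :* (a :* c :- d) :+ (κ 2 :* (d :- (b :- a)) :+ (a :* κ 1 :- a :* (κ 2 :*
                c)
              :+ a))) refl _ _ _ _)
            lo≤P : lo ≤ re (P n)
            lo≤P = by≤ (gap<⇒≤ h ≤+≤ gap≤ (∣∣-lower (re (P n) - re l)) ≤+≤ gap≈ (*-congˡ {re l}
              2*2⁻¹≈1)) (solve 4 (λ a b c d → a :- b :* c := b :* c :- d :+ (d :- :- (a :- b) :+ (b
                :*
              κ 1 :- b :* (κ 2 :* c)))) refl _ _ _ _)

      -- This is the form in which DRH(A) is used: the partial products end up between half and
      -- twice their positive limit, so their logarithms are bounded.
      ∑ₚ-log-bounded : ∃[ K ] ∀ N → ∣ ∑ₚ N (λ p → - log (1# - value c p * w p)) ∣ℝ ≤ K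
      ∑ₚ-log-bounded = proj₁ logP-bounded , λ N → ≤-trans (≈⇒≤ (∣∣-cong (begin
        ∑ₚ N (λ p → - log (1# - value c p * w p)) ≈⟨ ∑ₚ-cong N (λ p pr _ → log-⁻¹ (0<1-value*w c
          pr)) ⟨
        ∑ₚ N (λ p → log (u p))                      ≈⟨ ∑-primesUpTo N (λ p → log (u p)) ⟨
        ∑ (primesUpTo N) (λ p → log (u p))          ≈⟨ proj₂ (proj₂ (P-positive N)) ⟨
        log (re (P N))                              ∎))) (proj₂ logP-bounded N)
        where open import Relation.Binary.Reasoning.Setoid setoid

  -- Sums over characters, partial summation and asymptotics.

  unless : {A : Set} → Dec A → ℝ → ℝ
  unless (yes _) x = 0#
  unless (no _)  x = x

  when+unless : {A : Set} (d : Dec A) (x : ℝ) → when d x + unless d x ≈ x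
  when+unless (yes _) x = +-identityʳ x
  when+unless (no _)  x = +-identityˡ x

  ∑-list-cong : {A : Set} (xs : List A) {f g : A → ℝ} → (∀ x → f x ≈ g x) → ∑ xs f ≈ ∑ xs g
  ∑-list-cong []       h = refl
  ∑-list-cong (x ∷ xs) h = +-cong (h x) (∑-list-cong xs h)

  ∑-*ʳ : {A : Set} (xs : List A) (f : A → ℝ) (c : ℝ) → ∑ xs (λ x → f x * c) ≈ ∑ xs f * c
  ∑-*ʳ []       f c = sym (zeroˡ c)
  ∑-*ʳ (x ∷ xs) f c = trans (+-congˡ (∑-*ʳ xs f c)) (sym (distribʳ c _ _))

  ∑-∑ₚ : {A : Set} (xs : List A) (N : ℕ) (g : A → ℕ → ℝ) → ∑ xs (λ x → ∑ₚ N (g x)) ≈ ∑ₚ N (λ p → ∑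
    xs (λ x → g x p))
  ∑-∑ₚ []       N g = sym (∑ₚ-zero N (λ _ _ _ → refl))
  ∑-∑ₚ (x ∷ xs) N g = trans (+-congˡ (∑-∑ₚ xs N g)) (sym (∑ₚ-+ N (g x) (λ p → ∑ xs (λ y → g y p))))

  length≈∑ : {A : Set} (xs : List A) → ι (length xs) ≈ ∑ xs (λ _ → 1#)
  length≈∑ []       = refl
  length≈∑ (x ∷ xs) = +-congˡ (length≈∑ xs)

  -- The common term G is counted once per list entry; with G = (1/2) Σ 1/p and the list of
  -- characters this produces the factor δ/2.
  ∑-bounded : {A : Set} {F : A → ℕ → ℝ} {G : ℕ → ℝ} (xs : List A) →
    All (λ x → ∃[ K ] ∀ n → ∣ F x n + G n ∣ℝ ≤ K) xs →
    ∃[ K ] ∀ n → ∣ ∑ xs (λ x → F x n) + ι (length xs) * G n ∣ℝ ≤ K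
  ∑-bounded {G = G} [] [] = 0# , λ n → ≤-trans (≈⇒≤ (∣∣-cong (solve 1 (λ a → κ 0 :+ κ 0 :* a := κ 0)
    refl _))) (≈⇒≤ (∣∣-nonneg ≤-refl))
  ∑-bounded {F = F} {G} (x ∷ xs) ((K , h) ∷ hs) = let L , k = ∑-bounded xs hs in K + L , λ n → ≤-trans
    (≈⇒≤ (∣∣-cong (solve 4 (λ a b c d → a :+ b :+ (κ 1 :+ c) :* d := a :+ d :+ (b :+ c :* d)) refl _
      _
      _ _)))
    (≤-trans (∣∣-triangle _ _) (by≤ (gap≤ (h n) ≤+≤ gap≤ (k n)) (solve 4 (λ a b c d → a :+ b :- (c
      :+
      d) := a :- c :+ (b :- d)) refl _ _ _ _)))

  ∑ₚ-0 : ∀ f → ∑ₚ 0 f ≈ 0#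
  ∑ₚ-0 f = trans (+-identityˡ _) (when-no (prime? 0) {f 0} ¬prime[0])

  -- Partial summation; the increments of √n are nonnegative and add up to √N.
  ∑ₚ-from-weighted : ∀ {B} f N → (∀ n → n ℕ.≤ N → ∣ ∑ₚ n (λ p → f p * w p) ∣ℝ ≤ B) → ∣ ∑ₚ N f ∣ℝ ≤ ι
    2 * (√ (ι N) * B)
  ∑ₚ-from-weighted {B} f N F≤B = ≤-trans (≈⇒≤ (∣∣-cong (solve 3 (λ a b c → a := a :- b :* c :+ b :*
    c)
    refl _ _ _))) (≤-trans (∣∣-triangle _ _)
      (by≤ (gap≤ (claim N ℕ.≤-refl) ≤+≤ gap≤ (√F≤ N ℕ.≤-refl)) (solve 4 (λ a b c d → κ 2 :* (a :* b)
        :- (c :+ d) := a :* b :- c :+ (a :* b :- d)) refl _ _ _ _)))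
    where
    F V : ℕ → ℝ
    F n = ∑ₚ n (λ p → f p * w p)
    V n = ∑ₚ n f
    √F≤ : ∀ n → n ℕ.≤ N → ∣ √ (ι n) * F n ∣ℝ ≤ √ (ι n) * B
    √F≤ n n≤N = ≤-trans (≈⇒≤ (trans (∣∣-* _ _) (*-congʳ (∣∣-nonneg (0≤√ (0≤ι n)))))) (*-monoˡ-≤ _
      (0≤√ (0≤ι n)) (F≤B n n≤N))
    0≤B : 0# ≤ B
    0≤B = ≤-trans (0≤∣∣ (F 0)) (F≤B 0 z≤n)
    claim : ∀ n → n ℕ.≤ N → ∣ V n - √ (ι n) * F n ∣ℝ ≤ √ (ι n) * B
    claim zero _ = ≤-trans (≈⇒≤ (∣∣-cong (by≈ (gap≈0 (∑ₚ-0 f) ≈0+≈0 gap≈0˘ (*-congˡ {√ (ι 0)} (∑ₚ-0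
      (λ
      p → f p * w p)))) (solve 3 (λ a b c → κ 0 :- (a :- b :* c) := κ 0 :- a :+ (b :* c :- b :* κ
        0))
      refl _ _ _))))
      (≤-trans (≈⇒≤ (∣∣-nonneg ≤-refl)) (*-nonneg (0≤√ (0≤ι 0)) 0≤B))
    claim (suc n) n<N = ≤-trans (≈⇒≤ (∣∣-cong split)) (≤-trans (∣∣-triangle _ _)
      (by≤ (gap≤ (claim n n≤N) ≤+≤ gap≤ gapF≤) (solve 5 (λ a b c d e → a :* b :- (c :+ d) := e :* b
        :-
        c :+ ((a :- e) :* b :- d)) refl _ _ _ _ _)))
      where
      n≤N : n ℕ.≤ N
      n≤N = ℕ.<⇒≤ n<N
      0≤gap : 0# ≤ √ (ι (suc n)) - √ (ι n)
      0≤gap = gap≤ (√-mono-≤ (0≤ι n) (ι-mono-≤ (ℕ.n≤1+n n)))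
      gapF≤ : ∣ - ((√ (ι (suc n)) - √ (ι n)) * F n) ∣ℝ ≤ (√ (ι (suc n)) - √ (ι n)) * B
      gapF≤ = ≤-trans (≈⇒≤ (trans (∣-∣ _) (trans (∣∣-* _ _) (*-congʳ (∣∣-nonneg 0≤gap)))))
        (*-monoˡ-≤ _ 0≤gap (F≤B n n≤N))
      last : √ (ι (suc n)) * when (prime? (suc n)) (f (suc n) * w (suc n)) ≈ when (prime? (suc n))
        (f (suc n))
      last = trans (sym (when-*ˡ (prime? (suc n)) (√ (ι (suc n))) (f (suc n) * w (suc n))))
        (when-cong (prime? (suc n)) λ _ →
        (by≈ (gap≈0 (*-congˡ {f (suc n)} (√*w≈1 {suc n} (s≤s z≤n)))) (solve 3 (λ a b c → a :- b :*
          (a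
          :* c) := a :* κ 1 :- a :* (b :* c)) refl _ _ _)))
      split : V (suc n) - √ (ι (suc n)) * F (suc n) ≈ (V n - √ (ι n) * F n) + - ((√ (ι (suc n)) - √
        (ι n)) * F n)
      split = by≈ (gap≈0˘ last) (solve 6 (λ a b c d e f → a :- b :* c :+ :- ((d :- b) :* c) :- (a :+
        e
        :- d :* (c :+ f)) := d :* f :- e) refl _ _ _ _ _ _)

  ∼-of-bounded-difference : ∀ {F G K} X₀ → (∀ x → X₀ < x → ∣ F x - G x ∣ℝ ≤ K) →
    (∀ B → ∃[ X ] ∀ x → X < x → B < G x) → F ∼ G
  -- The sum of the absolute values exceeds both thresholds. Beyond it G > |K|/ε, so |F/G - 1| = |F
  -- - G|/G < ε.
  ∼-of-bounded-difference {F} {G} {K} X₀ F-G≤K G→∞ ε 0<ε = ∣ X₀ ∣ℝ + ∣ X₁ ∣ℝ , λ x X<x →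
      close x (F-G≤K x (by< (gap< X<x <+≤ gap≤ (∣∣-upper X₀) ≤+≤ 0≤∣∣ X₁) (solve 4 (λ a b c d → a :-
        b
        := a :- (c :+ d) :+ (c :- b :+ d)) refl _ _ _ _)))
        (proj₂ (G→∞ (∣ K ∣ℝ * ε ⁻¹)) x (by< (gap< X<x <+≤ gap≤ (∣∣-upper X₁) ≤+≤ 0≤∣∣ X₀) (solve 4
          (λ
          a b c d → a :- b := a :- (c :+ d) :+ (d :- b :+ c)) refl _ _ _ _)))
    where
    X₁ : ℝ
    X₁ = proj₁ (G→∞ (∣ K ∣ℝ * ε ⁻¹))
    close : ∀ x → ∣ F x - G x ∣ℝ ≤ K → ∣ K ∣ℝ * ε ⁻¹ < G x → ∣ F x / G x - 1# ∣ℝ < ε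
    close x F-G≤K K/ε<G = begin-strict
      ∣ F x / G x - 1# ∣ℝ ≈⟨ ∣∣-cong (by≈ (gap≈0 (x*x⁻¹≈1 0<G)) (solve 3 (λ a b c → (a :- b)
        :* c :- (a :* c :- κ 1) := κ 1 :- b :* c) refl _ _ _)) ⟩
      ∣ (F x - G x) * G x ⁻¹ ∣ℝ    ≈⟨ trans (∣∣-* _ _) (*-congˡ (∣∣-nonneg (<⇒≤ 0<G⁻¹))) ⟩
      ∣ F x - G x ∣ℝ * G x ⁻¹      ≤⟨ *-monoʳ-≤ _ (<⇒≤ 0<G⁻¹) (≤-trans F-G≤K (∣∣-upper K)) ⟩
      ∣ K ∣ℝ * G x ⁻¹              <⟨ *-monoʳ-< _ 0<G⁻¹ K<ε*G ⟩
      ε * G x * G x ⁻¹             ≈⟨ (by≈ (gap≈0 (*-congˡ {ε} (x*x⁻¹≈1 0<G))) (solve 3 (λ a b c → a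
        :- a :* b :* c := a :* κ 1 :- a :* (b :* c)) refl _ _ _)) ⟩
      ε                            ∎
      where
      open ≤-Reasoning
      0<G : 0# < G x
      0<G = ≤-<-trans (*-nonneg (0≤∣∣ K) (<⇒≤ (0<x⁻¹ 0<ε))) K/ε<G
      0<G⁻¹ : 0# < G x ⁻¹
      0<G⁻¹ = 0<x⁻¹ 0<G
      K<ε*G : ∣ K ∣ℝ < ε * G x
      K<ε*G = by< (gap< (*-monoˡ-< ε 0<ε K/ε<G) <+≤ gap≈˘ (*-congˡ {∣ K ∣ℝ} (x*x⁻¹≈1 0<ε))) (solve 4
        (λ a b c d → a :* b :- c := a :* b :- a :* (c :* d) :+ (c :* (a :* d) :- c :* κ 1)) refl _ _
          _
        _)

  -- The passage from integers N = ⌊x⌋ back to real x: log x ≤ log N + 1, so the iterated logarithm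
  -- grows by at most 1/log N ≤ 2.
  loglog-floor : ∀ {x} → ι 2 ≤ x → ∣ log (log x) - loglog ⌊ x ⌋ ∣ℝ ≤ ι 2
  loglog-floor {x} 2≤x = ∣∣-≤
    (by≤ (gap≤ (log-mono-≤ 0<logx logx≤) ≤+≤ gap≤ (log-diff-≤ 0<logN (0<logN <+≤ 0≤1)) ≤+≤ gap≤
      (1/logι≤2 2≤N)) (solve 5 (λ a b c d e → κ 2 :- (a :- b) := c :- a :+ ((d :+ κ 1 :- d) :* e :-
        (c
      :- b) :+ (κ 2 :- e))) refl _ _ _ _ _))
    (by≤ (gap≤ (log-mono-≤ 0<logN (log-mono-≤ (0<ι 1≤N) N≤x)) ≤+≤ scale≤ 2 0≤1) (solve 2 (λ a b → κ
      2
      :- :- (a :- b) := a :- b :+ κ 2 :* κ 1) refl _ _))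
    where
    N : ℕ
    N = ⌊ x ⌋
    spec : ι N ≤ x × x < ι (suc N)
    spec = floor-spec (≤-trans (0≤ι 2) 2≤x)
    N≤x : ι N ≤ x
    N≤x = proj₁ spec
    2≤N : 2 ℕ.≤ N
    2≤N = floor-≥ 2≤x
    1≤N : 1 ℕ.≤ N
    1≤N = ℕ.<⇒≤ 2≤N
    0<logN : 0# < log (ι N)
    0<logN = 0<logι 2≤N
    0<logx : 0# < log x
    0<logx = <-≤-trans 0<logN (log-mono-≤ (0<ι 1≤N) N≤x)
    logx≤ : log x ≤ log (ι N) + 1#
    logx≤ = by≤ (gap≤ (log-mono-≤ (<-≤-trans (0<ι 1≤N) N≤x) (<⇒≤ (proj₂ spec))) ≤+≤ gap≤ (log-suc-≤
      1≤N) ≤+≤ gap≤ (⁻¹-mono-≤ (0<ι-suc 0) (ι-mono-≤ 1≤N)) ≤+≤ gap≈ ι1⁻¹≈1) (solve 5 (λ a b c d e →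
        a
      :+ κ 1 :- b := c :- b :+ (d :- (c :- a) :+ (e :- d :+ (κ 1 :- e)))) refl _ _ _ _ _)

  loglog→∞ : ∀ {c} → 0# < c → ∀ B → ∃[ X ] ∀ x → X < x → B < c * log (log x)
  loglog→∞ {c} 0<c B = expℝ (expℝ (B * c ⁻¹)) , λ x X<x →
    let e<log = <-resp (log-exp _) refl (log-mono-< (0<exp _) X<x)
        B/c<loglog = <-resp (log-exp _) refl (log-mono-< (0<exp _) e<log)
    in (by< (gap< (*-monoˡ-< c 0<c B/c<loglog) <+≤ gap≈˘ (*-congˡ {B} (x*x⁻¹≈1 0<c))) (solve 4 (λ a
      b
      c d → a :* b :- c := a :* b :- a :* (c :* d) :+ (c :* (a :* d) :- c :* κ 1)) refl _ _ _ _))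

  -- At z = (log n)/2 the single term z³/6 = (log n)³/48 of the series is at most exp z = √n.
  log³≤48√ : ∀ {n} → 1 ℕ.≤ n → log (ι n) * log (ι n) * log (ι n) ≤ ι 48 * √ (ι n)
  log³≤48√ {n} 1≤n = by≤ (scale≤ 8 (gap≈˘ 6term) ≤+≤ gap≈˘ z³ ≤+≤ scale≤ 48 (gap≤ (⇢-eventually-≥ 4
    (λ
    m 4≤m → ≤-trans term≤ (partialExp-mono 0≤z 4≤m)) (partialExp⇢exp z))) ≤+≤ scale≤ 48 (gap≤
    exp-z≤√)) (solve 5 (λ a b c d e → κ 48 :* a :- b :* b :* b := κ 8 :* (κ 6 :* c :- d :* d :* d)
      :+
    ((d :+ d) :* (d :+ d) :* (d :+ d) :- b :* b :* b :+ (κ 48 :* (e :- c) :+ κ 48 :* (a :- e))))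
      refl
    _ _ _ _ _)
    where
    y z : ℝ
    y = log (ι n)
    z = y * ι 2 ⁻¹
    0≤z : 0# ≤ z
    0≤z = *-nonneg (0≤logι 1≤n) (<⇒≤ 0<2⁻¹)
    2z≈y : z + z ≈ y
    2z≈y = by≈ (gap≈0 (*-congˡ {y} 2*2⁻¹≈1)) (solve 2 (λ a b → a :- (a :* b :+ a :* b) := a :* κ 1
      :-
      a :* (κ 2 :* b)) refl _ _)
    z³ : (z + z) * (z + z) * (z + z) ≈ y * y * y
    z³ = *-cong (*-cong 2z≈y 2z≈y) 2z≈y
    term≤ : term z 3 ≤ partialExp z 4
    term≤ = by≤ (∑<-nonneg 3 (λ i _ → term-nonneg i 0≤z)) (solve 2 (λ a b → a :+ b :- b := a) refl _
      _)
    6term : ι 6 * term z 3 ≈ z * z * z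
    6term = term-3 z
    exp-z≤√ : expℝ z ≤ √ (ι n)
    exp-z≤√ = ²-cancel-≤ (0≤√ (0≤ι n)) (≈⇒≤ (trans (sym (exp-+ z z)) (trans (exp-cong 2z≈y) (trans
      (exp-log (0<ι 1≤n)) (sym (√*√ (0≤ι n)))))))

  -- Twisted prime sums and orthogonality.

  module Bias (q : ℕ) (3≤q : 3 ℕ.≤ q) where
    open Residues em R q 3≤q
    open Characters q 3≤q

    -- A prime above q is coprime to q, so the sum stops changing at q, whatever f is.
    ramified-bounded : (f : ℕ → ℝ) → ∃[ K ] ∀ N → ∣ ∑ₚ N (λ p → unless (coprime? p q) (f p)) ∣ℝ ≤ K
    ramified-bounded f = let K , h = bounded-series {a} {λ _ → 0#} {0#} (suc q)
                               (λ i → ≤-trans (≈⇒≤ (∣∣-cong (a-large i))) (≈⇒≤ (∣∣-nonneg ≤-refl)))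
                               (λ k → ≈⇒≤ (∑<-zero k)) in K , λ N → h (suc N)
      where
      a : ℕ → ℝ
      a n = when (prime? n) (unless (coprime? n q) (f n))
      a-large : ∀ i → a (suc q ℕ.+ i) ≈ 0#
      a-large i = trans (when-cong (prime? (suc q ℕ.+ i)) λ pr → unless-yes (coprime? (suc q ℕ.+ i)
        q)
          (prime⇒coprime pr (s≤s (ℕ.m≤m+n q i)))) (when-zero (prime? (suc q ℕ.+ i)))
        where
        unless-yes : {A : Set} (d : Dec A) {x : ℝ} → A → unless d x ≈ 0#
        unless-yes (yes _) _ = refl
        unless-yes (no ¬a) a = ⊥-elim (¬a a)

    -- If Q(N) is the Euler product of c at 1/2 over p ≤ N, then
    -- log Q(N) = Σ χ(p)/√p + Σ χ(p)²/(2p) + O(1).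
    twisted-sum-bounded : ∀ c → DRH-A (toDirichlet c) → m[ toDirichlet c ] ≡ 0 →
      ∃[ K ] ∀ N → ∣ ∑ₚ N (λ p → value c p * w p) + ι 2 ⁻¹ * reciprocalSum N ∣ℝ ≤ K
    twisted-sum-bounded c drh m≡0 = K₁ + K₂ + ι 2 ⁻¹ * K₃ , λ N → ≤-trans (≈⇒≤ (∣∣-cong (identity
      N)))
        (≤-trans (≤-trans (∣∣-triangle _ _) (+-mono (∣∣-triangle _ _) ≤-refl))
          (by≤ (gap≤ (b₁ N) ≤+≤ gap≤ (≤-trans (≈⇒≤ (∣-∣ (S₂ N))) (b₂ (suc N))) ≤+≤ gap≤ (≤-trans
            (≈⇒≤
            (trans (∣∣-* h (S₃ N)) (*-congʳ (∣∣-nonneg (<⇒≤ 0<2⁻¹))))) (*-monoˡ-≤ h (<⇒≤ 0<2⁻¹) (b₃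
            N)))) (solve 7 (λ a b c d e f g → a :+ b :+ c :* d :- (e :+ f :+ g) := a :- e :+ (b :- f
            :+ (c :* d :- g))) refl _ _ _ _ _ _ _)))
      where
      +-mono : ∀ {x y z u} → x ≤ y → z ≤ u → x + z ≤ y + u
      +-mono {x} {y} {z} {u} x≤y z≤u = by≤ (gap≤ x≤y ≤+≤ gap≤ z≤u) (solve 4 (λ a b c d → a :+ b :-
        (c
        :+ d) := a :- c :+ (b :- d)) refl _ _ _ _)
      h : ℝ
      h = ι 2 ⁻¹
      t r ℓ U : ℕ → ℝ
      t p = value c p * w p
      ℓ p = - log (1# - value c p * w p)
      r p = ℓ p - t p - t p * t p * h
      U p = unless (coprime? p q) (ι p ⁻¹)
      S₁ S₂ S₃ : ℕ → ℝ
      S₁ N = ∑ₚ N ℓ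
      S₂ N = ∑ₚ N r
      S₃ N = ∑ₚ N U
      -- The index starts at 4 because 1/√n ≤ 1/2 holds exactly from there on, as `LogTaylor`
      -- requires.
      r-small : ∀ i → ∣ when (prime? (4 ℕ.+ i)) (r (4 ℕ.+ i)) ∣ℝ ≤ ι 5 * w³ (4 ℕ.+ i)
      r-small i = ≤-trans (≈⇒≤ (when-∣∣ (prime? n) (r n))) (≤-trans (when-≤ (prime? n) (0≤∣∣ (r n)))
        (≤-trans (LogTaylor.log-taylor (t n) ∣t∣≤½) (*-monoˡ-≤ (ι 5) (0≤ι 5)
          (*-mono-≤ (*-nonneg (0≤∣∣ (t n)) (0≤∣∣ (t n))) (0≤∣∣ (t n)) (*-mono-≤ (0≤∣∣ (t n)) (0≤∣∣
            (t n)) ∣t∣≤w ∣t∣≤w) ∣t∣≤w))))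
        where
        n : ℕ
        n = 4 ℕ.+ i
        ∣t∣≤w : ∣ t n ∣ℝ ≤ w n
        ∣t∣≤w = ∣value*w∣≤w c {n} (s≤s z≤n)
        2w≤1 : w n + w n ≤ 1#
        2w≤1 = ²-cancel-≤ 0≤1 (by≤ (scale≤ 4 (gap≈ (w*w {n} (s≤s z≤n))) ≤+≤ scale≤ 4 (gap≤
          (⁻¹-mono-≤
          (0<ι-suc 3) (ι-mono-≤ (ℕ.m≤m+n 4 i)))) ≤+≤ gap≈ (x*x⁻¹≈1 (0<ι-suc 3))) (solve 3 (λ a b c →
            κ
          1 :* κ 1 :- (a :+ a) :* (a :+ a) := κ 4 :* (b :- a :* a) :+ (κ 4 :* (c :- b) :+ (κ 1 :- κ
            4
          :* c))) refl _ _ _))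
        ∣t∣≤½ : ∣ t n ∣ℝ + ∣ t n ∣ℝ ≤ 1#
        ∣t∣≤½ = ≤-trans (+-mono ∣t∣≤w ∣t∣≤w) 2w≤1
      w³-tail : ∀ k → ∑< k (λ i → ι 5 * w³ (4 ℕ.+ i)) ≤ ι 5 * (ι 2 * w 1)
      w³-tail k = ≤-trans (≈⇒≤ (∑<-*ˡ k (ι 5) (λ i → w³ (4 ℕ.+ i)))) (*-monoˡ-≤ (ι 5) (0≤ι 5)
        (by≤ (gap≤ (∑w³-≤ (2 ℕ.+ k)) ≤+≤ scale≤ 2 (<⇒≤ (0<w {3 ℕ.+ k} (s≤s z≤n))) ≤+≤ gap≈˘
          (∑<-split
          2 k (λ i → w³ (2 ℕ.+ i))) ≤+≤ ∑<-nonneg 2 (λ i _ → 0≤w³ i)) (solve 5 (λ a b c d e → κ 2 :*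
            a
          :- b := κ 2 :* a :- (c :+ κ 2 :* d) :+ (κ 2 :* d :+ (c :- (e :+ b) :+ e))) refl _ _ _ _
            _)))
        where
        0≤w³ : ∀ i → 0# ≤ w³ (2 ℕ.+ i)
        0≤w³ i = let 0≤w = <⇒≤ (0<w {2 ℕ.+ i} (s≤s z≤n)) in *-nonneg (*-nonneg 0≤w 0≤w) 0≤w
      B₁ = ∑ₚ-log-bounded c drh m≡0
      B₂ = bounded-series {λ n → when (prime? n) (r n)} 4 r-small w³-tail
      B₃ = ramified-bounded (λ p → ι p ⁻¹)
      K₁ K₂ K₃ : ℝ
      K₁ = proj₁ B₁
      K₂ = proj₁ B₂
      K₃ = proj₁ B₃
      b₁ : ∀ N → ∣ S₁ N ∣ℝ ≤ K₁
      b₁ = proj₂ B₁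
      b₂ : ∀ n → ∣ ∑< n (λ n → when (prime? n) (r n)) ∣ℝ ≤ K₂
      b₂ = proj₂ B₂
      b₃ : ∀ N → ∣ S₃ N ∣ℝ ≤ K₃
      b₃ = proj₂ B₃
      -- χ(p)² is 1 unless p divides q, when it is 0; U restores the missing 1/p.
      t²≈ : ∀ p → Prime p → t p * t p ≈ ι p ⁻¹ - U p
      t²≈ p pr = by≈ (gap≈0 (*-cong (value² c p) (w*w (prime⇒≥1 pr))) ≈0+≈0 gap≈0 (trans (*-comm _
        _)
        (sym (when-*ˡ (coprime? p q) (ι p ⁻¹) 1#))) ≈0+≈0 gap≈0 (when-cong (coprime? p q) (λ _ →
        *-identityʳ (ι p ⁻¹))) ≈0+≈0 gap≈0 (when+unless (coprime? p q) (ι p ⁻¹))) (solve 7 (λ a b c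
          d
        e f g → a :- b :- c :* d :* (c :* d) := e :* a :- c :* c :* (d :* d) :+ (f :- e :* a :+ (g
          :-
        f :+ (a :- (g :+ b))))) refl _ _ _ _ _ _ _)
      identity : ∀ N → ∑ₚ N t + h * reciprocalSum N ≈ S₁ N + - S₂ N + h * S₃ N
      identity N = begin
        ∑ₚ N t + h * reciprocalSum N ≈⟨ +-congˡ (∑ₚ-*ˡ N h (λ p → ι p ⁻¹)) ⟨
        ∑ₚ N t + ∑ₚ N (λ p → h * ι p ⁻¹)                       ≈⟨ ∑ₚ-+ N t (λ p → h * ι p ⁻¹) ⟨
        ∑ₚ N (λ p → t p + h * ι p ⁻¹)                          ≈⟨ ∑ₚ-cong N (λ p pr _ → (by≈ (gap≈0˘
          (*-congˡ {h} (t²≈ p pr))) (solve 5 (λ a b c d e → a :+ (:- κ 1 :* (a :- b :- b :* b :* c)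
            :+
          c :* d) :- (b :+ c :* e) := c :* (b :* b) :- c :* (e :- d)) refl _ _ _ _ _))) ⟩
        ∑ₚ N (λ p → ℓ p + (- 1# * r p + h * U p)) ≈⟨ ∑ₚ-+ N ℓ (λ p → - 1# * r p + h * U p) ⟩
        S₁ N + ∑ₚ N (λ p → - 1# * r p + h * U p) ≈⟨ +-congˡ (∑ₚ-+ N (λ p → - 1# * r p) (λ p → h * U
          p)) ⟩
        S₁ N + (∑ₚ N (λ p → - 1# * r p) + ∑ₚ N (λ p → h * U p)) ≈⟨ +-congˡ (+-cong (∑ₚ-*ˡ N (- 1#)
          r) (∑ₚ-*ˡ N h U)) ⟩
        S₁ N + (- 1# * S₂ N + h * S₃ N)                        ≈⟨ (solve 4 (λ a b c d → a :+ (:- κ 1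
          :* b :+ c :* d) := a :+ :- b :+ c :* d) refl _ _ _ _) ⟩
        S₁ N + - S₂ N + h * S₃ N                               ∎
        where open import Relation.Binary.Reasoning.Setoid setoid

    characters : List SignCharacter
    characters = products family

    -- The number is 2^r - 1 for a family of r characters. The family is independent and its common
    -- kernel on the units is the group of squares, so this is the index of the squares minus one.
    δ : ℝ
    δ = ι (length characters)

    ∑-signs-trivial : ∀ {a} cs → All (λ c → sign c a ≡ false) cs → ∑ cs (λ c → σ (sign c a)) ≈ ι
      (length cs)
    ∑-signs-trivial []       []       = refl
    ∑-signs-trivial (c ∷ cs) (e ∷ es) = +-cong (reflexive (≡.cong σ e)) (∑-signs-trivial cs es)

    -- The product of all 1 + c, with one factor split off; the added 1 stands for the empty
    -- product.
    ∑-products : ∀ a c cs → 1# + ∑ (products (c ∷ cs)) (λ d → σ (sign d a))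
                            ≈ (1# + σ (sign c a)) * (1# + ∑ (products cs) (λ d → σ (sign d a)))
    ∑-products a c cs = by≈ (gap≈0 (∑-++ ps (map (c ⊗_) ps) φ) ≈0+≈0 gap≈0 (∑-map ps)) (solve 4 (λ a
      b
      c d → (κ 1 :+ a) :* (κ 1 :+ b) :- (κ 1 :+ (a :+ c)) := b :+ d :- c :+ (a :* b :- d)) refl _ _
        _
      _)
      where
      φ : SignCharacter → ℝ
      φ d = σ (sign d a)
      ps : List SignCharacter
      ps = products cs
      ∑-map : ∀ ds → ∑ (map (c ⊗_) ds) φ ≈ φ c * ∑ ds φ
      ∑-map []       = sym (zeroʳ (φ c))
      ∑-map (d ∷ ds) = trans (+-cong (σ-xor (sign c a) (sign d a)) (∑-map ds)) (sym (distribˡ (φ c)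
        _ _))

    -- A character of value -1 at a makes its factor 1 + d(a) vanish, and with it the whole product.
    ∑-signs-separated : ∀ {a d} cs → d ∈ cs → sign d a ≡ true → 1# + ∑ (products cs) (λ c → σ (sign
      c a)) ≈ 0#
    ∑-signs-separated {a} (c ∷ cs) (here ≡.refl) e = trans (∑-products a c cs)
      (trans (*-congʳ (trans (+-congˡ (reflexive (≡.cong σ e))) (-‿inverseʳ 1#))) (zeroˡ _))
    ∑-signs-separated {a} (c ∷ cs) (there d∈cs) e = trans (∑-products a c cs)
      (trans (*-congˡ (∑-signs-separated cs d∈cs e)) (zeroʳ _))

    QR : ℕ → Set
    QR = QuadraticResidue q

    residueSum nonresidueSum ramifiedSum twistedSum : (ℕ → ℝ) → ℕ → ℝ
    residueSum    f N = ∑ₚ N (λ p → when (em {QR p}) (f p))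
    nonresidueSum f N = ∑ₚ N (λ p → when (em {¬ QR p}) (f p))
    ramifiedSum   f N = ∑ₚ N (λ p → unless (coprime? p q) (f p))
    twistedSum    f N = ∑ characters (λ c → ∑ₚ N (λ p → value c p * f p))

    residue+nonresidue : ∀ f N → residueSum f N + nonresidueSum f N ≈ ∑ₚ N f
    residue+nonresidue f N = trans (sym (∑ₚ-+ N (λ p → when (em {QR p}) (f p)) (λ p → when (em {¬ QR
      p}) (f p))))
      (∑ₚ-cong N λ p _ _ → by-cases em em)
      where
      by-cases : {A : Set} {x : ℝ} (d : Dec A) (e : Dec (¬ A)) → when d x + when e x ≈ x
      by-cases (yes a) (yes ¬a) = ⊥-elim (¬a a)
      by-cases (yes _) (no _)   = +-identityʳ _
      by-cases (no _)  (yes _)  = +-identityˡ _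
      by-cases (no ¬a) (no ¬¬a) = ⊥-elim (¬¬a ¬a)

    -- By orthogonality the nontrivial characters killing the squares sum to δ on
    -- the squares and to -1 on all other units.
    nonresidue-residue : ∀ f N → nonresidueSum f N - δ * residueSum f N ≈ ramifiedSum f N -
      twistedSum f N
    nonresidue-residue f N = begin
      nonresidueSum f N - δ * residueSum f N
        ≈⟨ (solve 3 (λ a b c → a :- b :* c := a :+ :- b :* c) refl _ _ _) ⟩
      nonresidueSum f N + - δ * residueSum f N
        ≈⟨ +-congˡ (∑ₚ-*ˡ N (- δ) (λ p → when (em {QR p}) (f p))) ⟨
      nonresidueSum f N + ∑ₚ N (λ p → - δ * when (em {QR p}) (f p))
        ≈⟨ ∑ₚ-+ N (λ p → when (em {¬ QR p}) (f p)) (λ p → - δ * when (em {QR p}) (f p)) ⟨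
      ∑ₚ N (λ p → when (em {¬ QR p}) (f p) + - δ * when (em {QR p}) (f p))
        ≈⟨ ∑ₚ-cong N (λ p _ _ → pointwise p (coprime? p q) em em) ⟩
      ∑ₚ N (λ p → unless (coprime? p q) (f p) + - 1# * ∑ characters (λ c → value c p * f p))
        ≈⟨ ∑ₚ-+ N (λ p → unless (coprime? p q) (f p)) (λ p → - 1# * ∑ characters (λ c → value c p *
          f p)) ⟩
      ramifiedSum f N + ∑ₚ N (λ p → - 1# * ∑ characters (λ c → value c p * f p))
        ≈⟨ +-congˡ (∑ₚ-*ˡ N (- 1#) (λ p → ∑ characters (λ c → value c p * f p))) ⟩
      ramifiedSum f N + - 1# * ∑ₚ N (λ p → ∑ characters (λ c → value c p * f p))
        ≈⟨ +-congˡ (*-congˡ (∑-∑ₚ characters N (λ c p → value c p * f p))) ⟨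
      ramifiedSum f N + - 1# * twistedSum f N
        ≈⟨ (solve 2 (λ a b → a :+ :- κ 1 :* b := a :- b) refl _ _) ⟩
      ramifiedSum f N - twistedSum f N ∎
      where
      open import Relation.Binary.Reasoning.Setoid setoid
      -- At a square both sides are -δ f(p); at another unit the character sum is -1 and both are
      -- f(p). A prime dividing q is no quadratic residue, so it contributes f(p) on the left, and
      -- on the right only through the ramified sum.
      pointwise : ∀ p (d : Dec (Coprime p q)) (e : Dec (QR p)) (e′ : Dec (¬ QR p)) →
        when e′ (f p) + - δ * when e (f p) ≈ unless d (f p) + - 1# * ∑ characters (λ c → when d (σ
          (sign c p)) * f p)
      pointwise p d        (yes r)  (yes ¬r)  = ⊥-elim (¬r r)
      pointwise p d        (no ¬r)  (no ¬¬r)  = ⊥-elim (¬¬r ¬r)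
      pointwise p (no ¬cp) (yes r)  (no _)    = ⊥-elim (¬cp (proj₁ r))
      pointwise p (no ¬cp) (no _)   (yes _)   = by≈ (gap≈0 (trans (∑-*ʳ characters (λ _ → 0#) (f p))
        (trans (*-congʳ ∑-0) (zeroˡ (f p))))) (solve 3 (λ a b c → a :+ :- κ 1 :* b :- (a :+ :- c :*
          κ
        0) := κ 0 :- b) refl _ _ _)
        where
        ∑-0 : ∑ characters (λ _ → 0#) ≈ 0#
        ∑-0 = go characters
          where
          go : (cs : List SignCharacter) → ∑ cs (λ _ → 0#) ≈ 0#
          go []       = refl
          go (_ ∷ cs) = trans (+-identityˡ _) (go cs)
      pointwise p (yes cp) (yes r)  (no _)    = by≈ (gap≈0 (∑-*ʳ characters (λ c → σ (sign c p)) (f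
        p)) ≈0+≈0 gap≈0 (*-congʳ {f p} (∑-signs-trivial characters (family-false (residue⇒Square
        r))))) (solve 4 (λ a b c d → κ 0 :+ :- κ 1 :* a :- (κ 0 :+ :- b :* c) := d :* c :- a :+ (b
          :*
        c :- d :* c)) refl _ _ _ _)
      pointwise p (yes cp) (no ¬r)  (yes _)   = by≈ (gap≈0 (∑-*ʳ characters (λ c → σ (sign c p)) (f
        p)) ≈0+≈0 gap≈0 (*-congʳ {f p} separated)) (solve 4 (λ a b c d → κ 0 :+ :- κ 1 :* a :- (b :+
        :- c :* κ 0) := d :* b :- a :+ (κ 0 :* b :- (κ 1 :+ d) :* b)) refl _ _ _ _)
        where
        separated : 1# + ∑ characters (λ c → σ (sign c p)) ≈ 0#
        separated = let c , c∈ , e = family-separates p cp (λ s → ¬r (Square⇒residue s)) in ∑-signs-separated family c∈ e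

    1≤δ : 1# ≤ δ
    1≤δ = 1≤ιn products-nonempty

  ∑-list-bounded : {A : Set} {F : A → ℕ → ℝ} {H : ℕ → ℝ} {Q : ℕ → Set} (xs : List A) →
    All (λ x → ∃[ K ] ∀ n → Q n → ∣ F x n ∣ℝ ≤ K * H n) xs → ∃[ K ] ∀ n → Q n → ∣ ∑ xs (λ x → F x n)
      ∣ℝ ≤ K * H n
  ∑-list-bounded [] [] = 0# , λ n _ → ≈⇒≤ (trans (∣∣-nonneg ≤-refl) (sym (zeroˡ _)))
  ∑-list-bounded {F = F} {H} (x ∷ xs) ((K , h) ∷ hs) = let L , k = ∑-list-bounded xs hs in K + L , λ n Qn → ≤-trans (∣∣-triangle _ _)
    (by≤ (gap≤ (h n Qn) ≤+≤ gap≤ (k n Qn)) (solve 5 (λ a b c d e → (a :+ b) :* c :- (d :+ e) := a :*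
      c
      :- d :+ (b :* c :- e)) refl _ _ _ _ _))

  -- The equation for e says that e = ε/(2(1 + δ) + 2ε).
  ratio-close : ∀ {δ ε e c₁ c₂ n} → 0# ≤ δ → 0# < e → 0# < ε → 0# < n →
    ι 2 * (1# + δ) * e + ι 2 * e * ε ≈ ε → c₂ + c₁ ≈ n → ∣ c₁ - δ * c₂ ∣ℝ ≤ e * n → ∣ c₁ / c₂ - δ ∣ℝ
      < ε
  ratio-close {δ} {ε} {e} {c₁} {c₂} {n} 0≤δ 0<e 0<ε 0<n e-def sum η≤ = begin-strict
    ∣ c₁ / c₂ - δ ∣ℝ ≈⟨ ∣∣-cong (by≈ (gap≈0 (*-congˡ {δ} (x*x⁻¹≈1 0<c₂))) (solve 4 (λ a
      b c d → (a :- b :* c) :* d :- (a :* d :- b) := b :* κ 1 :- b :* (c :* d)) refl _ _ _ _)) ⟩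
    ∣ (c₁ - δ * c₂) * c₂ ⁻¹ ∣ℝ      ≈⟨ trans (∣∣-* _ _) (*-congˡ (∣∣-nonneg (<⇒≤ 0<c₂⁻¹))) ⟩
    ∣ c₁ - δ * c₂ ∣ℝ * c₂ ⁻¹        ≤⟨ *-monoʳ-≤ _ (<⇒≤ 0<c₂⁻¹) η≤ ⟩
    e * n * c₂ ⁻¹                   <⟨ *-monoʳ-< _ 0<c₂⁻¹ en<εc₂ ⟩
    ε * c₂ * c₂ ⁻¹ ≈⟨ (by≈ (gap≈0 (*-congˡ {ε} (x*x⁻¹≈1 0<c₂))) (solve 3 (λ a b c → a
      :- a :* b :* c := a :* κ 1 :- a :* (b :* c)) refl _ _ _)) ⟩
    ε                               ∎
    where
    open ≤-Reasoning
    0<1+δ : 0# < 1# + δ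
    0<1+δ = 0<1 <+≤ 0≤δ
    e≤½ : ι 2 * e < 1#
    e≤½ = *-cancelˡ-< ε (<⇒≤ 0<ε) (by< (scale< 1 (*-pos _ _ 0<1+δ 0<e) <+≤ gap≈ e-def) (solve 3 (λ a
      b
      c → a :* κ 1 :- a :* (κ 2 :* b) := κ 2 :* ((κ 1 :+ c) :* b) :+ (a :- (κ 2 :* (κ 1 :+ c) :* b
        :+
      κ 2 :* b :* a))) refl _ _ _))
    -- Indeed (1 + δ)c₂ = n - (c₁ - δc₂). So c₂ is at least a fixed positive proportion of n, which
    -- is what allows division by it.
    [1+δ]c₂≥ : n - e * n ≤ (1# + δ) * c₂
    [1+δ]c₂≥ = by≤ (gap≈˘ sum ≤+≤ gap≤ (∣∣-upper (c₁ - δ * c₂)) ≤+≤ gap≤ η≤) (solve 6 (λ a b c d e f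
      →
      (κ 1 :+ a) :* b :- (c :- d :* c) := b :+ e :- c :+ (f :- (e :- a :* b) :+ (d :* c :- f))) refl
        _
      _ _ _ _ _)
    0<c₂ : 0# < c₂
    0<c₂ = *-cancelˡ-< (1# + δ) (<⇒≤ 0<1+δ) (by<-scaled 1 (gap< (*-monoʳ-< n 0<n e≤½) <+≤ scale≤ 2
      (gap≤ [1+δ]c₂≥) ≤+≤ <⇒≤ 0<n) (solve 4 (λ a b c d → κ 2 :* ((κ 1 :+ a) :* b :- (κ 1 :+ a) :* κ
        0)
      := κ 1 :* c :- κ 2 :* d :* c :+ (κ 2 :* ((κ 1 :+ a) :* b :- (c :- d :* c)) :+ c)) refl _ _ _
        _))
    0<c₂⁻¹ : 0# < c₂ ⁻¹
    0<c₂⁻¹ = 0<x⁻¹ 0<c₂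
    -- The equation for e turns 2(1+δ)en into εn - 2eεn, while 2(1+δ)εc₂ is at least 2εn - 2eεn.
    en<εc₂ : e * n < ε * c₂
    en<εc₂ = *-cancelˡ-< (1# + δ) (<⇒≤ 0<1+δ) (by<-scaled 1 (*-pos _ _ 0<ε 0<n <+≤ scale≤ 2 (gap≤
      (*-monoˡ-≤ ε (<⇒≤ 0<ε) [1+δ]c₂≥)) ≤+≤ gap≈ (*-congʳ {n} e-def)) (solve 5 (λ a b c d e → κ 2 :*
      ((κ 1 :+ a) :* (b :* c) :- (κ 1 :+ a) :* (d :* e)) := b :* e :+ (κ 2 :* (b :* ((κ 1 :+ a) :*
        c)
      :- b :* (e :- d :* e)) :+ (b :* e :- (κ 2 :* (κ 1 :+ a) :* d :+ κ 2 :* d :* b) :* e))) refl _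
        _
      _ _ _))

  -- The bias and the ratio of the counts.

  module Theorem (q : ℕ) (3≤q : 3 ℕ.≤ q)
    (drh : (χ : DirichletCharacter q) → Nontrivial χ → DRH-A χ)
    (L≉0 : (χ : DirichletCharacter q) → Nontrivial χ → ¬ (L χ ½ ≈ᶜ 0ᶜ)) where
    open Residues em R q 3≤q
    open Characters q 3≤q
    open Bias q 3≤q

    h : ℝ
    h = ι 2 ⁻¹

    twisted-sums-bounded : All (λ c → ∃[ K ] ∀ N → ∣ ∑ₚ N (λ p → value c p * w p) + h *
      reciprocalSum N ∣ℝ ≤ K) characters
    twisted-sums-bounded = All.map (λ {c} nt → twisted-sum-bounded c (drh (toDirichlet c)
      (toDirichlet-nontrivial c nt))
      (ord-nonvanishing (L (toDirichlet c)) ½ (L≉0 (toDirichlet c) (toDirichlet-nontrivial c nt))))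
        family-nontrivial

    K-mertens : ℝ
    K-mertens = proj₁ mertens

    biasConstant : ℝ
    biasConstant = δ * h

    0<biasConstant : 0# < biasConstant
    0<biasConstant = *-pos _ _ (<-≤-trans 0<1 1≤δ) 0<2⁻¹

    -- Three bounded pieces: the primes dividing q, the twisted sums each corrected by (1/2) Σ 1/p,
    -- and δ/2 times the error in Mertens' theorem.
    weighted-asymptotic : ∃[ K ] ∀ N → 2 ℕ.≤ N → ∣ (nonresidueSum w N - δ * residueSum w N) -
      biasConstant * loglog N ∣ℝ ≤ K
    weighted-asymptotic = K₁ + K₂ + biasConstant * K-mertens , λ N 2≤N → ≤-trans
        (≈⇒≤ (∣∣-cong (by≈ (gap≈0 (nonresidue-residue w N)) (solve 8 (λ a b c d e f g h → a :+ (:-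
          (b
          :+ c :* (d :* e)) :+ c :* d :* (e :- f)) :- (g :- c :* h :- c :* d :* f) := a :- b :- (g
            :-
          c :* h)) refl _ _ _ _ _ _ _ _))))
        (≤-trans (∣∣-triangle _ _)
          (by≤ (gap≤ (proj₂ (ramified-bounded w) N) ≤+≤ gap≤ (∣∣-triangle (- (twistedSum w N + δ *
            (h
            * reciprocalSum N))) (δ * h * (reciprocalSum N - loglog N))) ≤+≤ gap≤ (≤-trans (≈⇒≤ (∣-∣
            _)) (proj₂ twisted N)) ≤+≤ gap≤ (≤-trans (≈⇒≤ (trans (∣∣-* _ _) (*-congʳ (∣∣-nonneg (<⇒≤
            0<biasConstant))))) (*-monoˡ-≤ _ (<⇒≤ 0<biasConstant) (proj₂ mertens N 2≤N)))) (solve 8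
              (λ
            a b c d e f g h → a :+ b :+ c :* d :- (e :+ f) := a :- e :+ (g :+ h :- f :+ (b :- g :+
              (c
            :* d :- h)))) refl _ _ _ _ _ _ _ _)))
      where
      twisted : ∃[ K ] ∀ N → ∣ twistedSum w N + δ * (h * reciprocalSum N) ∣ℝ ≤ K
      twisted = ∑-bounded {F = λ c N → ∑ₚ N (λ p → value c p * w p)} {G = λ N → h * reciprocalSum N}
        characters twisted-sums-bounded
      K₁ K₂ : ℝ
      K₁ = proj₁ (ramified-bounded w)
      K₂ = proj₁ twisted

    one : ℕ → ℝ
    one _ = 1#

    growth : ℕ → ℝ
    growth N = √ (ι N) * log (ι N)

    -- The bound log N ≥ 1 lets constants be absorbed into multiples of log N and of `growth N`.
    Large : ℕ → Set
    Large N = 2 ℕ.≤ N × 1# ≤ log (ι N)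

    1≤√ : ∀ {N} → 1 ℕ.≤ N → 1# ≤ √ (ι N)
    1≤√ {N} 1≤N = ²-cancel-≤ (0≤√ (0≤ι N)) (≤-trans (≈⇒≤ (*-identityˡ 1#)) (≤-trans (1≤ιn 1≤N) (≈⇒≤
      (sym (√*√ (0≤ι N))))))

    reciprocalSum-≤ : ∀ N → Large N → reciprocalSum N ≤ (∣ K-mertens ∣ℝ + 1#) * log (ι N)
    reciprocalSum-≤ N (2≤N , 1≤logN) = by≤ (gap≤ (∣∣-upper (reciprocalSum N - loglog N)) ≤+≤ gap≤
      (proj₂ mertens N 2≤N) ≤+≤ gap≤ (∣∣-upper K-mertens) ≤+≤ gap≤ (*-monoˡ-≤ ∣ K-mertens ∣ℝ (0≤∣∣
      K-mertens) 1≤logN) ≤+≤ gap≤ (log≤x-1 (0<logι 2≤N)) ≤+≤ 0≤1) (solve 6 (λ a b c d e f → (a :+ κ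
        1)
      :* b :- c := d :- (c :- e) :+ (f :- d :+ (a :- f :+ (a :* b :- a :* κ 1 :+ (b :- κ 1 :- e :+ κ
      1))))) refl _ _ _ _ _ _)

    -- Partial summation removes the weights at the cost of √N times a bound for all weighted sums
    -- up to N. Those are of size Σ 1/p, so about log log N; the cruder bound by a multiple of log N
    -- is enough to be o(π(N)) after the factor √N.
    character-sum-bounded : ∀ c → ∃[ K ] (∀ N → ∣ ∑ₚ N (λ p → value c p * w p) + h * reciprocalSum N
      ∣ℝ ≤ K) →
      ∃[ K ] ∀ N → Large N → ∣ ∑ₚ N (λ p → value c p * one p) ∣ℝ ≤ K * growth N
    character-sum-bounded c (K , bound) = ι 2 * (∣ K ∣ℝ + ∣ K-mertens ∣ℝ + 1#) , λ N large → ≤-trans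
        (∑ₚ-from-weighted {B N} (λ p → value c p * one p) N (λ n n≤N → weighted N n n≤N))
        (by≤ (scale≤ 2 (gap≤ (*-monoˡ-≤ (√ (ι N)) (0≤√ (0≤ι N)) (B≤ N large)))) (solve 5 (λ a b c d
          e
          → κ 2 :* (a :+ b :+ κ 1) :* (c :* d) :- κ 2 :* (c :* e) := κ 2 :* (c :* ((a :+ b :+ κ 1)
            :*
          d) :- c :* e)) refl _ _ _ _ _))
      where
      -- The bound must serve every n ≤ N at once, so it uses the reciprocal sum at N, which
      -- dominates those at n.
      B : ℕ → ℝ
      B N = ∣ K ∣ℝ + reciprocalSum N
      0≤1/n : ∀ n → 0# ≤ when (prime? n) (ι n ⁻¹)
      0≤1/n n = when-nonneg (prime? n) λ pr → <⇒≤ (0<x⁻¹ (0<ιp pr))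
      0≤R : ∀ N → 0# ≤ reciprocalSum N
      0≤R N = ∑<-nonneg (suc N) (λ n _ → 0≤1/n n)
      h*R≤R : ∀ N → h * reciprocalSum N ≤ reciprocalSum N
      h*R≤R N = by≤ (gap≈ (*-congʳ {reciprocalSum N} 2*2⁻¹≈1) ≤+≤ *-nonneg (<⇒≤ 0<2⁻¹) (0≤R N))
        (solve
        2 (λ a b → a :- b :* a := κ 1 :* a :- κ 2 :* b :* a :+ b :* a) refl _ _)
      weighted : ∀ N n → n ℕ.≤ N → ∣ ∑ₚ n (λ p → value c p * one p * w p) ∣ℝ ≤ B N
      weighted N n n≤N = ≤-trans (≈⇒≤ (∣∣-cong (trans (∑ₚ-cong n λ p _ _ → *-congʳ (*-identityʳ
        (value c p)))
          (solve 3 (λ a b c → a := a :+ b :* c :+ :- (b :* c)) refl _ _ _))))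
        (≤-trans (∣∣-triangle _ _) (by≤ (gap≤ (bound n) ≤+≤ gap≤ (∣∣-upper K) ≤+≤ gap≤ (≈⇒≤ (trans
          (∣-∣ _) (∣∣-nonneg (*-nonneg (<⇒≤ 0<2⁻¹) (0≤R n))))) ≤+≤ gap≤ (h*R≤R n) ≤+≤ gap≤ (∑<-monoˡ
          (λ n → when (prime? n) (ι n ⁻¹)) 0≤1/n (s≤s n≤N))) (solve 7 (λ a b c d e f g → a :+ b :-
            (c
          :+ d) := e :- c :+ (a :- e :+ (f :* g :- d :+ (g :- f :* g :+ (b :- g))))) refl _ _ _ _ _
            _
          _)))
        where
        S : ℝ
        S = ∑ₚ n (λ p → value c p * w p)
      B≤ : ∀ N → Large N → B N ≤ (∣ K ∣ℝ + ∣ K-mertens ∣ℝ + 1#) * log (ι N)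
      B≤ N large = by≤ (gap≤ (reciprocalSum-≤ N large) ≤+≤ gap≤ (*-monoˡ-≤ ∣ K ∣ℝ (0≤∣∣ K) (proj₂
        large))) (solve 4 (λ a b c d → (a :+ b :+ κ 1) :* c :- (a :+ d) := (b :+ κ 1) :* c :- d :+
          (a
        :* c :- a :* κ 1)) refl _ _ _ _)

    η : ℕ → ℝ
    η N = nonresidueSum one N - δ * residueSum one N

    η-bounded : ∃[ K ] ∀ N → Large N → ∣ η N ∣ℝ ≤ K * growth N
    η-bounded = ∣ K₁ ∣ℝ + K₂ , λ N large → ≤-trans (≈⇒≤ (∣∣-cong (nonresidue-residue one N)))
      (≤-trans (∣∣-triangle _ _)
        (by≤ (gap≤ (proj₂ (ramified-bounded one) N) ≤+≤ gap≤ (∣∣-upper K₁) ≤+≤ gap≤ (*-monoˡ-≤ ∣ K₁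
          ∣ℝ
          (0≤∣∣ K₁) (1≤growth N large)) ≤+≤ gap≤ (≤-trans (≈⇒≤ (∣-∣ _)) (proj₂ twisted N large)))
          (solve 6 (λ a b c d e f → (a :+ b) :* c :- (d :+ e) := f :- d :+ (a :- f :+ (a :* c :- a
            :*
          κ 1 :+ (b :* c :- e)))) refl _ _ _ _ _ _)))
      where
      twisted : ∃[ K ] ∀ N → Large N → ∣ twistedSum one N ∣ℝ ≤ K * growth N
      twisted = ∑-list-bounded {F = λ c N → ∑ₚ N (λ p → value c p * one p)} {H = growth} {Q = Large}
        characters
        (All.map (λ {c} → character-sum-bounded c) twisted-sums-bounded)
      K₁ K₂ : ℝ
      K₁ = proj₁ (ramified-bounded one)
      K₂ = proj₁ twisted
      1≤growth : ∀ N → Large N → 1# ≤ growth N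
      1≤growth N (2≤N , 1≤logN) = ≤-trans (≈⇒≤ (sym (*-identityˡ 1#))) (*-mono-≤ 0≤1 0≤1 (1≤√ (ℕ.<⇒≤
        2≤N)) 1≤logN)

    -- Against π(N) ≥ N/(K₈ log N), the bound K√N log N is small enough once K K₈ (log N)² ≤ e√N. As
    -- (log N)³ ≤ 48√N, this holds when log N ≥ 48 K K₈/e, which is `y₀`.
    η-small : ∀ {e} → 0# < e → ∃[ N₀ ] ∀ N → N₀ ℕ.≤ N → 0# < primeCount N × ∣ η N ∣ℝ ≤ e *
      primeCount N
    η-small {e} 0<e = N₀ , λ N N₀≤N → conclude N N₀≤N
      where
      K y₀ : ℝ
      K = ∣ proj₁ η-bounded ∣ℝ
      y₀ = ι 48 * K * ι K₈ * e ⁻¹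
      bound₁ = archimedean (expℝ 1#)
      bound₂ = archimedean (expℝ y₀)
      n₁ n₂ N₀ : ℕ
      n₁ = proj₁ bound₁
      n₂ = proj₁ bound₂
      -- A sum in place of a maximum: it ensures N ≥ 2, N ≥ K₈, log N ≥ 1 and log N ≥ y₀.
      N₀ = 2 ℕ.+ K₈ ℕ.+ n₁ ℕ.+ n₂
      log≥ : ∀ {y n N} → expℝ y < ι n → n ℕ.≤ N → y ≤ log (ι N)
      log≥ {y} e<n n≤N = ≤-trans (≈⇒≤ (sym (log-exp y))) (log-mono-≤ (0<exp y) (≤-trans (<⇒≤ e<n)
        (ι-mono-≤ n≤N)))
      conclude : ∀ N → N₀ ℕ.≤ N → 0# < primeCount N × ∣ η N ∣ℝ ≤ e * primeCount N
      conclude N N₀≤N = 0<π , ≤-trans (proj₂ η-bounded N (2≤N , 1≤y))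
          (*-cancelˡ-≤ (ι K₈ * y) 0<K₈y (by≤-scaled 47 (scale≤ 48 (gap≤ (*-monoʳ-≤ (ι K₈ * y * s *
            y)
            (*-nonneg (*-nonneg (<⇒≤ 0<K₈y) 0≤s) 0≤y) (∣∣-upper (proj₁ η-bounded)))) ≤+≤ gap≤
            (*-monoʳ-≤ (s * y * y) (*-nonneg (*-nonneg 0≤s 0≤y) 0≤y) 48KK₈≤ey) ≤+≤ gap≤ (*-monoˡ-≤
              (e
            * s) (*-nonneg (<⇒≤ 0<e) 0≤s) (log³≤48√ (ℕ.<⇒≤ 2≤N))) ≤+≤ scale≤ 48 (gap≈ (*-congˡ {e}
            (√*√ (0≤ι N)))) ≤+≤ scale≤ 48 (gap≤ (*-monoˡ-≤ e (<⇒≤ 0<e) (primeCount-≥ N K₈≤N))))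
              (solve
            8 (λ a b c d e f g h → κ 48 :* (a :* b :* (c :* d) :- a :* b :* (e :* (f :* b))) := κ 48
            :* (g :* (a :* b :* f :* b) :- e :* (a :* b :* f :* b)) :+ (c :* b :* (f :* b :* b) :- κ
            48 :* g :* a :* (f :* b :* b) :+ (c :* f :* (κ 48 :* f) :- c :* f :* (b :* b :* b) :+ (κ
            48 :* (c :* h :- c :* (f :* f)) :+ κ 48 :* (c :* (a :* (b :* d)) :- c :* h))))) refl _ _
              _
            _ _ _ _ _)))
        where
        y s : ℝ
        y = log (ι N)
        s = √ (ι N)
        2≤N : 2 ℕ.≤ N
        2≤N = ℕ.≤-trans (ℕ.m≤m+n 2 (K₈ ℕ.+ n₁ ℕ.+ n₂)) N₀≤N
        K₈≤N : K₈ ℕ.≤ N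
        K₈≤N = ℕ.≤-trans (ℕ.≤-trans (ℕ.≤-trans (ℕ.m≤n+m K₈ 2) (ℕ.m≤m+n (2 ℕ.+ K₈) n₁)) (ℕ.m≤m+n (2
          ℕ.+ K₈ ℕ.+ n₁) n₂)) N₀≤N
        1≤y : 1# ≤ y
        1≤y = log≥ (proj₂ bound₁) (ℕ.≤-trans (ℕ.≤-trans (ℕ.m≤n+m n₁ (2 ℕ.+ K₈)) (ℕ.m≤m+n (2 ℕ.+ K₈
          ℕ.+ n₁) n₂)) N₀≤N)
        y₀≤y : y₀ ≤ y
        y₀≤y = log≥ (proj₂ bound₂) (ℕ.≤-trans (ℕ.m≤n+m n₂ (2 ℕ.+ K₈ ℕ.+ n₁)) N₀≤N)
        0<y : 0# < y
        0<y = <-≤-trans 0<1 1≤y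
        0≤y : 0# ≤ y
        0≤y = <⇒≤ 0<y
        0≤s : 0# ≤ s
        0≤s = 0≤√ (0≤ι N)
        0<K₈y : 0# < ι K₈ * y
        0<K₈y = *-pos _ _ (0<ι-suc (proj₁ e⁸)) 0<y
        48KK₈≤ey : ι 48 * K * ι K₈ ≤ e * y
        48KK₈≤ey = by≤ (gap≤ (*-monoˡ-≤ e (<⇒≤ 0<e) y₀≤y) ≤+≤ gap≈˘ (*-congˡ {ι 48 * K * ι K₈}
          (x*x⁻¹≈1 0<e))) (solve 5 (λ a b c d e → a :* b :- κ 48 :* c :* d := a :* b :- a :* (κ 48
            :*
          c :* d :* e) :+ (κ 48 :* c :* d :* (a :* e) :- κ 48 :* c :* d :* κ 1)) refl _ _ _ _ _)
        0<π : 0# < primeCount N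
        0<π = *-cancelˡ-< (ι K₈ * y) (<⇒≤ 0<K₈y) (≤-<-trans (≈⇒≤ (zeroʳ _))
          (<-≤-trans (0<ι (ℕ.<⇒≤ 2≤N)) (≤-trans (primeCount-≥ N K₈≤N) (≈⇒≤ (sym (*-assoc _ _ _))))))

    satisfying-sum : ∀ (Q : ℕ → Set) f x → ∑ (primes≤ x satisfying Q) f ≈ ∑ₚ ⌊ x ⌋ (λ p → when (em
      {Q p}) (f p))
    satisfying-sum Q f x = trans (∑-filter (λ p → em {Q p}) (primes≤ x) f) (∑-primesUpTo ⌊ x ⌋ (λ p
      → when (em {Q p}) (f p)))

    count-sum : ∀ Q x → count Q x ≈ ∑ₚ ⌊ x ⌋ (λ p → when (em {Q p}) (one p))
    count-sum Q x = trans (length≈∑ (primes≤ x satisfying Q)) (satisfying-sum Q one x)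

    ratio-limit : (λ x → count (λ p → ¬ QR p) x / count QR x) ⟶∞ δ
    ratio-limit ε 0<ε = ι N₀ , λ x N₀<x → let N = ⌊ x ⌋ ; 0<π , η≤ = proj₂ small N (floor-≥ (<⇒≤ N₀<x)) in
        ratio-close 0≤δ 0<e 0<ε 0<π e-def
          (trans (+-cong (count-sum QR x) (count-sum (λ p → ¬ QR p) x)) (residue+nonresidue one N))
          (≤-trans (≈⇒≤ (∣∣-cong (+-cong (count-sum (λ p → ¬ QR p) x) (-‿cong (*-congˡ (count-sum QR
            x)))))) η≤)
      where
      0≤δ : 0# ≤ δ
      0≤δ = ≤-trans 0≤1 1≤δ
      D e : ℝ
      D = ι 2 * (1# + δ) + ι 2 * ε
      e = ε * D ⁻¹
      0<D : 0# < D
      0<D = by< (scale< 1 0<ε <+≤ scale≤ 2 0≤δ ≤+≤ scale≤ 2 0≤1) (solve 2 (λ a b → κ 2 :* (κ 1 :+ a)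
        :+ κ 2 :* b :- κ 0 := κ 2 :* b :+ (κ 2 :* a :+ κ 2 :* κ 1)) refl _ _)
      0<e : 0# < e
      0<e = *-pos _ _ 0<ε (0<x⁻¹ 0<D)
      e-def : ι 2 * (1# + δ) * e + ι 2 * e * ε ≈ ε
      e-def = trans (solve 3 (λ a b c → κ 2 :* (κ 1 :+ a) :* (b :* c) :+ κ 2 :* (b :* c) :* b := b
        :*
        ((κ 2 :* (κ 1 :+ a) :+ κ 2 :* b) :* c)) refl _ _ _)
        (trans (*-congˡ (x*x⁻¹≈1 0<D)) (*-identityʳ ε))
      small = η-small 0<e
      N₀ : ℕ
      N₀ = proj₁ small

    bias-asymptotic : (λ x → invSqrtSum (λ p → ¬ QR p) x - δ * invSqrtSum QR x) ∼ (λ x →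
      biasConstant * log (log x))
    -- The extra 2 times `biasConstant` is the cost of replacing log log ⌊x⌋ by log log x, available
    -- from x ≥ 2 on.
    bias-asymptotic = ∼-of-bounded-difference {K = K + biasConstant * ι 2} (ι 2) (λ x 2<x → close x (<⇒≤ 2<x)) (loglog→∞ 0<biasConstant)
      where
      K : ℝ
      K = proj₁ weighted-asymptotic
      close : ∀ x → ι 2 ≤ x → ∣ (invSqrtSum (λ p → ¬ QR p) x - δ * invSqrtSum QR x) - biasConstant *
        log (log x) ∣ℝ ≤ K + biasConstant * ι 2
      close x 2≤x = ≤-trans (≈⇒≤ (∣∣-cong (trans
          (+-congʳ (+-cong (satisfying-sum (λ p → ¬ QR p) w x) (-‿cong (*-congˡ (satisfying-sum QR w
            x)))))
          (solve 6 (λ a b c d e f → a :- b :* c :- d :* e := a :- b :* c :- d :* f :+ :- (d :* (e :-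
            f))) refl _ _ _ _ _ _))))
        (≤-trans (∣∣-triangle _ _)
          (by≤ (gap≤ (proj₂ weighted-asymptotic N (floor-≥ 2≤x)) ≤+≤ gap≤ (≤-trans (≈⇒≤ (trans (∣-∣
            _)
            (trans (∣∣-* _ _) (*-congʳ (∣∣-nonneg (<⇒≤ 0<biasConstant)))))) (*-monoˡ-≤ _ (<⇒≤
            0<biasConstant) (loglog-floor 2≤x)))) (solve 4 (λ a b c d → a :+ b :* κ 2 :- (c :+ d) :=
              a
            :- c :+ (b :* κ 2 :- d)) refl _ _ _ _)))
        where
        N : ℕ
        N = ⌊ x ⌋

    bias : ChebyshevBiasAgainst QR
    bias = record
      { partition  = λ p _ → partition-by em , λ (¬r , r) → ¬r r
      ; δ          = δ
      ; ratio      = ratio-limit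
      ; C          = biasConstant
      ; C>0        = 0<biasConstant
      ; asymptotic = bias-asymptotic
      }
      where
      partition-by : {A : Set} → Dec A → ¬ A ⊎ A
      partition-by (yes a) = inj₂ a
      partition-by (no ¬a) = inj₁ ¬a

  corollary : (q : ℕ) → 3 ℕ.≤ q →
    ((χ : DirichletCharacter q) → Nontrivial χ → DRH-A χ) →
    ((χ : DirichletCharacter q) → Nontrivial χ → ¬ (L χ ½ ≈ᶜ 0ᶜ)) →
    ((a : ℕ) → Coprime a q → mσ q a ≈ᶜ 0ᶜ) →
    ChebyshevBiasAgainst (QuadraticResidue q)
  corollary q 3≤q drh L≉0 _ = Theorem.bias q 3≤q drh L≉0

open import Data.Nat.Base using (_≤_)

corollary3p2 :
    (em : ExcludedMiddle 0ℓ) (R : CompleteOrderedField) →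
    let open Analysis em R in
    (q : ℕ) → 3 ≤ q →
    ((χ : DirichletCharacter q) → Nontrivial χ → DRH-A χ) →
    ((χ : DirichletCharacter q) → Nontrivial χ → ¬ (L χ ½ ≈ᶜ 0ᶜ)) →
    ((a : ℕ) → Coprime a q → mσ q a ≈ᶜ 0ᶜ) →
    ChebyshevBiasAgainst (QuadraticResidue q)
corollary3p2 = Development.corollary
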